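{- For every integer $k\geq 2$ there exists a constant $c=c(k)>0$ such that the following holds. Let $r$ be a positive integer and let $G$ be a linear $k$-uniform hypergraph on $n$ vertices with at least $$c\, r^{\frac{1}{k-1}}n^{2-\frac{1}{k-1}}(\log n)^{2k+\frac{1}{k-1}}$$ edges. Then $G$ contains an $r$-regular subhypergraph.
   Context: A hypergraph is linear if any two distinct edges intersect in at most one vertex; $k$-uniform means all edges have size $k$. A non-empty hypergraph is $r$-regular if every vertex has degree $r$; a subhypergraph is given by a subset of edges together with the vertices they cover. $\log$ is the natural logarithm.
   Formalization: The formal statement assumes n ≥ 2: for n = 1 the threshold is 0 and the edgeless hypergraph on one vertex meets it without containing a non-empty r-regular subhypergraph, and for n = 0 the logarithm is undefined. -}

module Defs where

open import Data.Nat as ℕ using (ℕ; zero; suc; _∸_)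
open import Data.Nat.Properties using (_!≢0)
open import Data.Nat.Base using (_!)
open import Data.Bool using (Bool; true; false; _∧_)
open import Data.Fin using (Fin)
open import Data.Fin.Subset using (Subset; _∈_; _∩_; ∣_∣; Nonempty)
open import Data.Vec using (lookup; tabulate)
open import Data.Integer using (+_)
open import Data.Rational as ℚ using (ℚ; 0ℚ; 1ℚ; _/_)
open import Data.Product using (Σ; ∃; _×_)
open import Relation.Binary.PropositionalEquality using (_≡_; _≢_)

Edges : ℕ → ℕ → Set
Edges n m = Fin m → Subset n

-- a hypergraph is a *set* of edges: distinct indices give distinct edges
Simple : ∀ {n m} → Edges n m → Set
Simple {m = m} E = (i j : Fin m) → E i ≡ E j → i ≡ j

Uniform : ∀ {n m} → ℕ → Edges n m → Set
Uniform {m = m} k E = (i : Fin m) → ∣ E i ∣ ≡ k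

Linear : ∀ {n m} → Edges n m → Set
Linear {m = m} E = (i j : Fin m) → i ≢ j → ∣ E i ∩ E j ∣ ℕ.≤ 1

-- A subhypergraph is given by a subset S of the edges (vertex set =
-- vertices covered by the chosen edges).

degreeIn : ∀ {n m} → Edges n m → Subset m → Fin n → ℕ
degreeIn E S v = ∣ tabulate (λ i → lookup S i ∧ lookup (E i) v) ∣

Covered : ∀ {n m} → Edges n m → Subset m → Fin n → Set
Covered E S v = ∃ λ i → i ∈ S × v ∈ E i

RegularSub : ∀ {n m} → ℕ → Edges n m → Subset m → Set
RegularSub {n} r E S = Nonempty S × ((v : Fin n) → Covered E S v → degreeIn E S v ≡ r)

infixr 8 _^ℚ_
_^ℚ_ : ℚ → ℕ → ℚ
x ^ℚ zero = 1ℚ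
x ^ℚ suc j = x ℚ.* (x ^ℚ j)

expPartial : ℚ → ℕ → ℚ
expPartial x zero = 1ℚ
expPartial x (suc m) = expPartial x m ℚ.+ (x ^ℚ suc m) ℚ.* ((+ 1) / (suc m !)) {{suc m !≢0}}

-- for a rational x:  x ≤ log n  (natural log)  ⇔  exp x ≤ n
--                                             ⇔  every partial sum of the series for exp x is ≤ n
-- (valid for x ≥ 0, where the partial sums increase to exp x)
≤log : ℚ → ℕ → Set
≤log x n = (m : ℕ) → expPartial x m ℚ.≤ ((+ n) / 1)

ℕtoℚ : ℕ → ℚ
ℕtoℚ a = (+ a) / 1

{-# OPTIONS --safe #-}

-- If many matchings of H cover the same vertex set, then the petals of a sunflower with r petals among
-- them have equal degrees, all 0 or 1, so the union of the petals is r-regular.  A sunflower exists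
-- among more than (C r log² n)^t matchings of size t: pass to a maximal kernel, so that the remaining
-- sets are spread, colour the edges at random with 2r groups of O(log² n) colours each, and absorb a
-- member into the colours of one group step by step (the encoding argument of Alweiss, Lovett, Wu, Zhang
-- and Rao).  To get that many matchings, keep the edges whose largest vertex degree lies in one dyadic
-- interval [D/2, D): there are at least m / O(log n) of them, hence at least (m / O(log n))^t ordered
-- matchings with t ≈ m / (D log n).  They cover few vertex sets because every edge meets the set of
-- vertices of degree at least D/2, which has only O(t log n) elements; linearity enters through D ≤ 2n.
module Submission where

open import Defs
import Data.Bool as Bool
open import Data.Bool using (Bool; true; false; _∧_; if_then_else_)
open import Data.Fin using (Fin; zero; suc; toℕ; combine; quotient; remainder)
import Data.Fin.Properties as Fin
open import Data.Fin.Subset using (Subset; _∈_; _∉_; _⊆_; _∩_; _∪_; _─_; ∣_∣; ⁅_⁆; ⊥)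
import Data.Fin.Subset as Sub
open import Data.Fin.Subset.Properties
import Data.Integer as ℤ
import Data.Integer.Properties as ℤ
open import Data.List as List using (List; []; _∷_; length; _++_; concatMap; filter; allFin; take)
import Data.List.Properties as List
open import Data.List.Membership.Propositional renaming (_∈_ to _∈ₗ_; lose to loseₗ) using ()
open import Data.List.Membership.Propositional.Properties using (∈-allFin; ∈-map⁻; ∈-filter⁻)
open import Data.List.Relation.Unary.All as All using (All; []; _∷_)
import Data.List.Relation.Unary.All.Properties as All
open import Data.List.Relation.Unary.AllPairs as AllPairs using (AllPairs; []; _∷_)
import Data.List.Relation.Unary.AllPairs.Properties as AllPairs
open import Data.List.Relation.Unary.Any as Any using (Any; here; there)
import Data.List.Relation.Unary.Any.Properties as Any
import Data.List.Relation.Unary.Unique.Propositional.Properties as Unique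
open import Data.Nat as ℕ
open import Data.Nat.Coprimality using (1-coprimeTo) renaming (sym to coprime-sym)
open import Data.Nat.DivMod
open import Data.Nat.Properties as ℕ
open import Data.Nat.Solver using (module +-*-Solver)
open import Data.Product using (Σ; ∃; _×_; _,_; proj₁; proj₂)
open import Data.Rational as Q using (ℚ; 0ℚ; 1ℚ; ½; mkℚ; *≤*)
import Data.Rational.Properties as Q
import Data.Rational.Solver as QSolver
import Data.Rational.Unnormalised as ℚᵘ
import Data.Rational.Unnormalised.Properties as ℚᵘ
open import Data.Sum using (_⊎_; inj₁; inj₂; [_,_]′)
open import Data.Vec as Vec using (Vec; []; _∷_; lookup; tabulate; here; there)
import Data.Vec.Properties as Vec
open import Function using (_∘_; id; const)
open import Level using (Level)
open import Relation.Binary.PropositionalEquality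
open import Relation.Nullary using (Dec; yes; no; does; ¬_; ¬?; contradiction; _×-dec_)
open import Relation.Nullary.Decidable using (decidable-stable; dec-true; dec-false; map′)
open import Relation.Unary using (Pred; Decidable)

-- The final comparison is between `t`-th powers, so only the cost per edge matters. Ordered
-- matchings of size `t` number at least (`#H` / 2)^t. Counting the vertex sets of size kt without
-- restriction would cost O(n/t)^k per edge and end at the exponent 2 - 1/k. One vertex per edge
-- taken from a set of only O(t log n) vertices replaces a factor n/t by O(log n). Some vertex set
-- then carries more than (tR)^t matchings as soon as D exceeds a constant times (n/t)^(k-1) R log
-- n, where R is of order r log² n. As n/t is of order n D log n / m, this reads m^(k-1) > const r
-- n^(k-1) D^(k-2) (log n)^(k+2), and D ≤ 2n turns the powers of n and D into n^(2k-3). The factor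
-- t^t pays for the orders in which one matching is listed. The factorial sunflower bound of Erdős
-- and Rado would put a further factor t into the base, a loss of a power of n in general; hence the
-- need for a base that is linear in r and polylogarithmic in n.

private
  variable
    a a′ p : Level
    A : Set a
    A′ : Set a′
    N q : ℕ

-- Finite sums and counting

∑ : List A → (A → ℕ) → ℕ
∑ []       f = 0
∑ (x ∷ xs) f = f x + ∑ xs f

⟦_⟧ : Bool → ℕ
⟦ true ⟧  = 1
⟦ false ⟧ = 0

𝟙 : {P : Set p} → Dec P → ℕ
𝟙 d = ⟦ does d ⟧

module _ {P : Set p} where

  𝟙-yes : (d : Dec P) → P → 𝟙 d ≡ 1
  𝟙-yes (yes _) _ = refl
  𝟙-yes (no ¬h) h = contradiction h ¬h

  𝟙-no : (d : Dec P) → ¬ P → 𝟙 d ≡ 0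
  𝟙-no (yes h) ¬h = contradiction h ¬h
  𝟙-no (no _)  _  = refl

  𝟙≤1 : (d : Dec P) → 𝟙 d ≤ 1
  𝟙≤1 (yes _) = ≤-refl
  𝟙≤1 (no _)  = z≤n

  𝟙-bound : (d : Dec P) {x y : ℕ} → (P → x ≤ y) → 𝟙 d * x ≤ y
  𝟙-bound (yes h) {x} le = ≤-trans (≤-reflexive (*-identityˡ x)) (le h)
  𝟙-bound (no _)  le = z≤n

  𝟙-case : (d : Dec P) {y : ℕ} → (P → 1 ≤ y) → 𝟙 d ≤ y
  𝟙-case (yes h) le = le h
  𝟙-case (no _)  le = z≤n

𝟙-mono : {P : Set p} {Q : Set a} (d : Dec P) (e : Dec Q) → (P → Q) → 𝟙 d ≤ 𝟙 e
𝟙-mono d e f = 𝟙-case d (λ h → ≤-reflexive (sym (𝟙-yes e (f h))))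

⟦⟧≡𝟙 : ∀ {n} {x : Fin n} (S : Subset n) → ⟦ lookup S x ⟧ ≡ 𝟙 (x ∈? S)
⟦⟧≡𝟙 {x = zero} (true ∷ S) = refl
⟦⟧≡𝟙 {x = zero} (false ∷ S) = refl
⟦⟧≡𝟙 {x = suc x} (s ∷ S) = ⟦⟧≡𝟙 {x = x} S

∑-cong : (xs : List A) {f g : A → ℕ} → (∀ x → f x ≡ g x) → ∑ xs f ≡ ∑ xs g
∑-cong []       eq = refl
∑-cong (x ∷ xs) eq = cong₂ _+_ (eq x) (∑-cong xs eq)

∑-mono : (xs : List A) {f g : A → ℕ} → (∀ x → f x ≤ g x) → ∑ xs f ≤ ∑ xs g
∑-mono []       le = z≤n
∑-mono (x ∷ xs) le = +-mono-≤ (le x) (∑-mono xs le)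

∑-mono-∈ : (xs : List A) {f g : A → ℕ} → (∀ {x} → x ∈ₗ xs → f x ≤ g x) → ∑ xs f ≤ ∑ xs g
∑-mono-∈ []       le = z≤n
∑-mono-∈ (x ∷ xs) le = +-mono-≤ (le (here refl)) (∑-mono-∈ xs (le ∘ there))

∑-const : (xs : List A) (c : ℕ) → ∑ xs (const c) ≡ length xs * c
∑-const []       c = refl
∑-const (x ∷ xs) c = cong (c +_) (∑-const xs c)

∑-zero : (xs : List A) → ∑ xs (const 0) ≡ 0
∑-zero xs = trans (∑-const xs 0) (*-zeroʳ (length xs))

∑-1 : (xs : List A) → ∑ xs (const 1) ≡ length xs
∑-1 xs = trans (∑-const xs 1) (*-identityʳ (length xs))

∑-+ : (xs : List A) (f g : A → ℕ) → ∑ xs (λ x → f x + g x) ≡ ∑ xs f + ∑ xs g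
∑-+ []       f g = refl
∑-+ (x ∷ xs) f g = trans (cong (f x + g x +_) (∑-+ xs f g))
  (solve 4 (λ u v s t → u :+ v :+ (s :+ t) := u :+ s :+ (v :+ t)) refl (f x) (g x) (∑ xs f) (∑ xs g))
  where open +-*-Solver

∑-*ˡ : (xs : List A) (c : ℕ) (f : A → ℕ) → ∑ xs (λ x → c * f x) ≡ c * ∑ xs f
∑-*ˡ []       c f = sym (*-zeroʳ c)
∑-*ˡ (x ∷ xs) c f = trans (cong (c * f x +_) (∑-*ˡ xs c f)) (sym (*-distribˡ-+ c (f x) (∑ xs f)))

∑-*ʳ : (xs : List A) (f : A → ℕ) (c : ℕ) → ∑ xs (λ x → f x * c) ≡ ∑ xs f * c
∑-*ʳ xs f c = trans (∑-cong xs (λ x → *-comm (f x) c)) (trans (∑-*ˡ xs c f) (*-comm c _))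

∑-swap : (xs : List A) (ys : List A′) (f : A → A′ → ℕ) →
         ∑ xs (λ x → ∑ ys (f x)) ≡ ∑ ys (λ y → ∑ xs (λ x → f x y))
∑-swap []       ys f = sym (∑-zero ys)
∑-swap (x ∷ xs) ys f = trans (cong (∑ ys (f x) +_) (∑-swap xs ys f))
                             (sym (∑-+ ys (f x) (λ y → ∑ xs (λ x → f x y))))

∑-++ : (xs ys : List A) (f : A → ℕ) → ∑ (xs ++ ys) f ≡ ∑ xs f + ∑ ys f
∑-++ []       ys f = refl
∑-++ (x ∷ xs) ys f = trans (cong (f x +_) (∑-++ xs ys f)) (sym (+-assoc (f x) _ _))

∑-map : (h : A → A′) (xs : List A) (f : A′ → ℕ) → ∑ (List.map h xs) f ≡ ∑ xs (f ∘ h)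
∑-map h []       f = refl
∑-map h (x ∷ xs) f = cong (f (h x) +_) (∑-map h xs f)

∑-concatMap : (h : A → List A′) (xs : List A) (f : A′ → ℕ) → ∑ (concatMap h xs) f ≡ ∑ xs (λ x → ∑ (h x) f)
∑-concatMap h []       f = refl
∑-concatMap h (x ∷ xs) f = trans (∑-++ (h x) (concatMap h xs) f) (cong (∑ (h x) f +_) (∑-concatMap h xs f))

∑-filter : {P : Pred A p} (P? : Decidable P) (xs : List A) (f : A → ℕ) →
           ∑ (filter P? xs) f ≡ ∑ xs (λ x → 𝟙 (P? x) * f x)
∑-filter P? []       f = refl
∑-filter P? (x ∷ xs) f with P? x
... | yes _ = cong₂ _+_ (sym (*-identityˡ (f x))) (∑-filter P? xs f)
... | no _  = ∑-filter P? xs f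

length-filter≡∑ : {P : Pred A p} (P? : Decidable P) (xs : List A) → length (filter P? xs) ≡ ∑ xs (𝟙 ∘ P?)
length-filter≡∑ P? xs = trans (sym (∑-1 (filter P? xs)))
  (trans (∑-filter P? xs (const 1)) (∑-cong xs (λ x → *-identityʳ _)))

term≤∑ : {xs : List A} {x : A} (f : A → ℕ) → x ∈ₗ xs → f x ≤ ∑ xs f
term≤∑ f (here refl) = m≤m+n _ _
term≤∑ f (there x∈)  = ≤-trans (term≤∑ f x∈) (m≤n+m _ _)

∑<∑⇒∃< : (xs : List A) (f g : A → ℕ) → ∑ xs f < ∑ xs g → ∃ λ x → f x < g x
∑<∑⇒∃< (x ∷ xs) f g lt with f x <? g x
... | yes fx<gx = x , fx<gx
... | no  fx≮gx with ∑ xs f <? ∑ xs g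
...   | yes lt′ = ∑<∑⇒∃< xs f g lt′
...   | no  ≮   = contradiction lt (≤⇒≯ (+-mono-≤ (≮⇒≥ fx≮gx) (≮⇒≥ ≮)))

∑-tabulate : ∀ {n} (h : Fin n → A) (f : A → ℕ) → ∑ (List.tabulate h) f ≡ ∑ (allFin n) (f ∘ h)
∑-tabulate {n = zero}  h f = refl
∑-tabulate {n = suc n} h f = cong (f (h zero) +_)
  (trans (∑-tabulate (h ∘ suc) f) (sym (∑-tabulate suc (f ∘ h))))

length-allFin : ∀ n → length (allFin n) ≡ n
length-allFin n = List.length-tabulate id

∣∣≡∑ : ∀ {n} (S : Subset n) → ∣ S ∣ ≡ ∑ (allFin n) (λ x → 𝟙 (x ∈? S))
∣∣≡∑ [] = refl
∣∣≡∑ (true ∷ S)  = cong suc (trans (∣∣≡∑ S) (sym (∑-tabulate suc (λ x → 𝟙 (x ∈? (true ∷ S))))))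
∣∣≡∑ (false ∷ S) = trans (∣∣≡∑ S) (sym (∑-tabulate suc (λ x → 𝟙 (x ∈? (false ∷ S)))))

∑-allFin-≟ : ∀ {n} (x : Fin n) → ∑ (allFin n) (λ y → 𝟙 (x Fin.≟ y)) ≡ 1
∑-allFin-≟ {n} x = trans (∑-cong (allFin n) (λ y → ≤-antisym
    (𝟙-mono (x Fin.≟ y) (y ∈? ⁅ x ⁆) (λ { refl → x∈⁅x⁆ x }))
    (𝟙-mono (y ∈? ⁅ x ⁆) (x Fin.≟ y) (λ h → sym (x∈⁅y⁆⇒x≡y x h)))))
  (trans (sym (∣∣≡∑ ⁅ x ⁆)) (∣⁅x⁆∣≡1 x))

allVecs : List A → ∀ n → List (Vec A n)
allVecs xs zero    = [] ∷ []
allVecs xs (suc n) = concatMap (λ x → List.map (x ∷_) (allVecs xs n)) xs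

∑-allVecs : (xs : List A) → ∀ n (f : Vec A (suc n) → ℕ) →
            ∑ (allVecs xs (suc n)) f ≡ ∑ xs (λ x → ∑ (allVecs xs n) (λ v → f (x ∷ v)))
∑-allVecs xs n f = trans (∑-concatMap (λ x → List.map (x ∷_) (allVecs xs n)) xs f)
  (∑-cong xs (λ x → ∑-map (x ∷_) (allVecs xs n) f))

term≤∑-allVecs : (xs : List A) → (∀ x → x ∈ₗ xs) → ∀ {n} (f : Vec A n → ℕ) v → f v ≤ ∑ (allVecs xs n) f
term≤∑-allVecs xs all f []      = m≤m+n _ _
term≤∑-allVecs xs all {suc n} f (x ∷ v) = ≤-trans
  (≤-trans (term≤∑-allVecs xs all (λ v → f (x ∷ v)) v) (term≤∑ (λ x → ∑ (allVecs xs n) (λ v → f (x ∷ v))) (all x)))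
  (≤-reflexive (sym (∑-allVecs xs n f)))

length-allVecs : (xs : List A) → ∀ n → length (allVecs xs n) ≡ length xs ^ n
length-allVecs xs zero    = refl
length-allVecs xs (suc n) = trans (sym (∑-1 (allVecs xs (suc n)))) (trans (∑-allVecs xs n (const 1))
  (trans (∑-cong xs (λ _ → trans (∑-1 (allVecs xs n)) (length-allVecs xs n))) (∑-const xs (length xs ^ n))))

-- The encoding step for spread families

subsetsOf : Subset N → List (Subset N)
subsetsOf []          = [] ∷ []
subsetsOf (true ∷ S)  = List.map (true ∷_) (subsetsOf S) ++ List.map (false ∷_) (subsetsOf S)
subsetsOf (false ∷ S) = List.map (false ∷_) (subsetsOf S)

∈-subsetsOf : {A S : Subset N} → A ⊆ S → A ∈ₗ subsetsOf S
∈-subsetsOf {A = []} {[]} sub = here refl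
∈-subsetsOf {A = true ∷ A} {true ∷ S} sub = Any.++⁺ˡ (Any.map⁺ (Any.map (cong (true ∷_)) (∈-subsetsOf (drop-∷-⊆ sub))))
∈-subsetsOf {A = true ∷ A} {false ∷ S} sub with () ← sub here
∈-subsetsOf {A = false ∷ A} {true ∷ S} sub =
  Any.++⁺ʳ (List.map (true ∷_) (subsetsOf S)) (Any.map⁺ (Any.map (cong (false ∷_)) (∈-subsetsOf (drop-∷-⊆ sub))))
∈-subsetsOf {A = false ∷ A} {false ∷ S} sub = Any.map⁺ (Any.map (cong (false ∷_)) (∈-subsetsOf (drop-∷-⊆ sub)))

length-subsetsOf : (S : Subset N) → length (subsetsOf S) ≡ 2 ^ ∣ S ∣
length-subsetsOf []          = refl
length-subsetsOf (true ∷ S)  = trans (List.length-++ (List.map (true ∷_) (subsetsOf S)))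
  (cong₂ _+_ (trans (List.length-map _ (subsetsOf S)) (length-subsetsOf S))
    (trans (trans (List.length-map _ (subsetsOf S)) (length-subsetsOf S)) (sym (+-identityʳ _))))
length-subsetsOf (false ∷ S) = trans (List.length-map _ (subsetsOf S)) (length-subsetsOf S)

recolour : Subset N → A → Vec A N → Vec A N
recolour []      κ []      = []
recolour (b ∷ B) κ (x ∷ c) = (if b then κ else x) ∷ recolour B κ c

colourings : ∀ q N → List (Vec (Fin q) N)
colourings q = allVecs (allFin q)

-- A 0/1 indicator written as a product over coordinates, so that its sum over all colourings
-- factors and comes out as `q ^ ∣ B ∣`.
agreeOff : Subset N → Vec (Fin q) N → Vec (Fin q) N → ℕ
agreeOff []          []      []      = 1
agreeOff (true ∷ B)  (x ∷ c) (y ∷ d) = agreeOff B c d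
agreeOff (false ∷ B) (x ∷ c) (y ∷ d) = 𝟙 (x Fin.≟ y) * agreeOff B c d

agreeOff-recolour : (B : Subset N) (κ : Fin q) (c : Vec (Fin q) N) → agreeOff B (recolour B κ c) c ≡ 1
agreeOff-recolour []          κ []      = refl
agreeOff-recolour (true ∷ B)  κ (x ∷ c) = agreeOff-recolour B κ c
agreeOff-recolour (false ∷ B) κ (x ∷ c) = cong₂ _*_ (𝟙-yes (x Fin.≟ x) refl) (agreeOff-recolour B κ c)

∑-agreeOff : (B : Subset N) (c : Vec (Fin q) N) → ∑ (colourings q N) (agreeOff B c) ≡ q ^ ∣ B ∣
∑-agreeOff []          []      = refl
∑-agreeOff {suc N} {q} (true ∷ B) (x ∷ c) = trans (∑-allVecs (allFin q) N (agreeOff (true ∷ B) (x ∷ c)))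
  (trans (∑-cong (allFin q) (λ _ → ∑-agreeOff B c))
  (trans (∑-const (allFin q) (q ^ ∣ B ∣)) (cong (_* q ^ ∣ B ∣) (length-allFin q))))
∑-agreeOff {suc N} {q} (false ∷ B) (x ∷ c) = trans (∑-allVecs (allFin q) N (agreeOff (false ∷ B) (x ∷ c)))
  (trans (∑-cong (allFin q) (λ y → trans (∑-*ˡ (colourings q N) (𝟙 (x Fin.≟ y)) (agreeOff B c))
                                          (cong (𝟙 (x Fin.≟ y) *_) (∑-agreeOff B c))))
  (trans (∑-*ʳ (allFin q) (λ y → 𝟙 (x Fin.≟ y)) (q ^ ∣ B ∣))
  (trans (cong (_* q ^ ∣ B ∣) (∑-allFin-≟ x)) (*-identityˡ _))))

cls : (A → Bool) → Vec A N → Subset N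
cls = Vec.map

-- Only points outside the class change, and they receive a colour outside the class. A decoder that
-- sees only the new colouring therefore still knows the old class.
cls-recolour-off : (ω : A → Bool) {κ : A} → ω κ ≡ false → (B : Subset N) (c : Vec A N) →
                   cls ω (recolour (B ─ cls ω c) κ c) ≡ cls ω c
cls-recolour-off ω ωκ []      []      = refl
cls-recolour-off ω ωκ (b ∷ B) (x ∷ c) with ω x in ωx
... | true  = cong₂ _∷_ ωx (cls-recolour-off ω ωκ B c)
cls-recolour-off ω ωκ (true ∷ B)  (x ∷ c) | false = cong₂ _∷_ ωκ (cls-recolour-off ω ωκ B c)
cls-recolour-off ω ωκ (false ∷ B) (x ∷ c) | false = cong₂ _∷_ ωx (cls-recolour-off ω ωκ B c)

cls-recolour-on : (ω : A → Bool) {κ : A} → ω κ ≡ true → (B : Subset N) (c : Vec A N) →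
                  cls ω (recolour B κ c) ≡ cls ω c ∪ B
cls-recolour-on ω ωκ []          []      = refl
cls-recolour-on ω ωκ (true ∷ B)  (x ∷ c) with ω x
... | true = cong₂ _∷_ ωκ (cls-recolour-on ω ωκ B c)
... | false = cong₂ _∷_ ωκ (cls-recolour-on ω ωκ B c)
cls-recolour-on ω ωκ (false ∷ B) (x ∷ c) with ω x
... | true = cong₂ _∷_ refl (cls-recolour-on ω ωκ B c)
... | false = cong₂ _∷_ refl (cls-recolour-on ω ωκ B c)

∈-cls⁺ : (ω : A → Bool) (c : Vec A N) {x : Fin N} → ω (lookup c x) ≡ true → x ∈ cls ω c
∈-cls⁺ ω c {x} eq = Vec.lookup⇒[]= x (cls ω c) (trans (Vec.lookup-map x ω c) eq)

∈-cls⁻ : (ω : A → Bool) (c : Vec A N) {x : Fin N} → x ∈ cls ω c → ω (lookup c x) ≡ true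
∈-cls⁻ ω c {x} h = trans (sym (Vec.lookup-map x ω c)) (Vec.[]=⇒lookup h)

∈─⇒∉ : {p q : Subset N} {x : Fin N} → x ∈ p ─ q → x ∉ q
∈─⇒∉ {p = _ ∷ p} {false ∷ q} (there h) (there h′) = ∈─⇒∉ {p = p} h h′
∈─⇒∉ {p = _ ∷ p} {true ∷ q}  (there h) (there h′) = ∈─⇒∉ {p = p} h h′

-- A canonical choice: it depends on the predicate and the list alone, so a decoder recomputes the
-- same member. The value `⊥` of a failed search satisfies every predicate used below.
firstSat : {P : Pred (Subset N) p} → Decidable P → List (Subset N) → Subset N
firstSat P? []       = ⊥
firstSat P? (S ∷ Ss) = if does (P? S) then S else firstSat P? Ss

module _ {P : Pred (Subset N) p} (P? : Decidable P) where

  firstSat-sat : P ⊥ → ∀ Ss → P (firstSat P? Ss)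
  firstSat-sat P⊥ []       = P⊥
  firstSat-sat P⊥ (S ∷ Ss) with P? S
  ... | yes h = h
  ... | no _  = firstSat-sat P⊥ Ss

  firstSat-∈ : ∀ {Ss} → Any P Ss → firstSat P? Ss ∈ₗ Ss
  firstSat-∈ {S ∷ Ss} h with P? S
  ... | yes _ = here refl
  firstSat-∈ {S ∷ Ss} (here h)  | no ¬h = contradiction h ¬h
  firstSat-∈ {S ∷ Ss} (there h) | no _  = there (firstSat-∈ h)

module Spread {N : ℕ} (F : List (Subset N)) where

  -- The witness `S′` may differ from `S`; only what it takes from outside `W` counts, and this part
  -- must come from `S`. At `w = 0` the witness lies inside `W`, so `S` drops out.
  Fits : ℕ → Subset N → Subset N → Pred (Subset N) _
  Fits w S W S′ = (S′ ⊆ S ∪ W) × ∣ S′ ─ W ∣ ≤ w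

  fits? : ∀ w S W → Decidable (Fits w S W)
  fits? w S W S′ = (S′ ⊆? S ∪ W) ×-dec (∣ S′ ─ W ∣ ≤? w)

  Good : ℕ → Subset N → Subset N → Set
  Good w S W = Any (Fits w S W) F

  good? : ∀ w S W → Dec (Good w S W)
  good? w S W = Any.any? (fits? w S W) F

  fits-⊥ : ∀ w S W → Fits w S W ⊥
  fits-⊥ w S W = (λ h → contradiction h ∉⊥) ,
    ≤-trans (∣p─q∣≤∣p∣ ⊥ W) (≤-trans (≤-reflexive (∣⊥∣≡0 N)) z≤n)

  bad : ∀ {q} → ℕ → (Fin q → Bool) → ℕ
  bad {q} w ω = ∑ (colourings q N) λ c → ∑ F λ S → 𝟙 (¬? (good? w S (cls ω c)))

  #⊇ : Subset N → ℕ
  #⊇ Y = ∑ F λ S → 𝟙 (Y ⊆? S)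

  module Step {R : ℕ} (spread : ∀ Y → #⊇ Y * R ^ ∣ Y ∣ ≤ length F)
              (R>0 : 0 < R)
              {q : ℕ} (q>0 : 0 < q) (ω ω′ : Fin q → Bool) (κ : Fin q)
              (ωκ : ω κ ≡ false) (ω′κ : ω′ κ ≡ true) (ω⊆ω′ : ∀ x → ω x ≡ true → ω′ x ≡ true)
              (w w′ : ℕ) where

    private
      C = colourings q N
      instance
        _ = >-nonZero R>0
        _ = >-nonZero q>0

    fresh : Subset N → Vec (Fin q) N → Subset N
    fresh S c = firstSat (fits? w S (cls ω c)) F ─ cls ω c

    -- Reads a member off the recoloured colouring alone.
    target? : ∀ c → Decidable {A = Subset N} (λ S′ → (S′ ⊆ cls ω′ c) × ∣ S′ ─ cls ω c ∣ ≤ w)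
    target? c S′ = (S′ ⊆? cls ω′ c) ×-dec (∣ S′ ─ cls ω c ∣ ≤? w)

    target : Vec (Fin q) N → Subset N
    target c = firstSat (target? c) F

    ∣fresh∣≤w : ∀ S c → ∣ fresh S c ∣ ≤ w
    ∣fresh∣≤w S c = proj₂ (firstSat-sat (fits? w S (cls ω c)) (fits-⊥ w S (cls ω c)) F)

    target-sat : ∀ c → (target c ⊆ cls ω′ c) × ∣ target c ─ cls ω c ∣ ≤ w
    target-sat c = firstSat-sat (target? c)
      ((λ h → contradiction h ∉⊥) , proj₂ (fits-⊥ w ⊥ (cls ω c))) F

    -- The pair `(c , S)` is charged to `(d , A)`. The last factor recomputes the fragment from `S`
    -- and `d`, so once these are known only the old colours of at most `w` points are open.
    code : Vec (Fin q) N → Subset N → Subset N → Vec (Fin q) N → ℕ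
    code c S A d = 𝟙 (w′ <? ∣ A ∣) * (𝟙 (A ⊆? S) * agreeOff (fresh S d) d c)

    codes : Vec (Fin q) N → Subset N → ℕ
    codes c S = ∑ C λ d → ∑ (subsetsOf (target d ─ cls ω d)) λ A → code c S A d

    -- Paint the fragment `B` with the new colour `κ`. The class of `ω′` now contains a whole
    -- member, and `T` is such a member, read off `d` alone. Its part `K` inside `B` lies in `S` and
    -- has more than `w′` points, since otherwise `T` itself would make the pair good at `w′`.
    encode : ∀ c S → Good w S (cls ω c) → ¬ Good w′ S (cls ω′ c) → 1 ≤ codes c S
    encode c S good ¬good = ≤-trans
      (≤-trans (≤-reflexive (sym code≡1)) (term≤∑ (λ A → code c S A d) (∈-subsetsOf {S = T ─ cls ω d} (p∩q⊆p (T ─ cls ω d) B))))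
      (term≤∑-allVecs (allFin q) ∈-allFin (λ d → ∑ (subsetsOf (target d ─ cls ω d)) (λ A → code c S A d)) d)
      where
      W = cls ω c
      W′ = cls ω′ c
      B₀ = firstSat (fits? w S W) F
      B = fresh S c
      d = recolour B κ c
      W-d : cls ω d ≡ W
      W-d = cls-recolour-off ω ωκ B₀ c
      W′-d : cls ω′ d ≡ W′ ∪ B
      W′-d = cls-recolour-on ω′ ω′κ B c
      W⊆W′ : W ⊆ W′
      W⊆W′ h = ∈-cls⁺ ω′ c (ω⊆ω′ _ (∈-cls⁻ ω c h))
      fresh≡ : fresh S d ≡ B
      fresh≡ = cong (λ W → firstSat (fits? w S W) F ─ W) W-d
      B₀-fits : Fits w S W B₀
      B₀-fits = firstSat-sat (fits? w S W) (fits-⊥ w S W) F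
      B⊆S : B ⊆ S
      B⊆S h with x∈p∪q⁻ S W (proj₁ B₀-fits (p─q⊆p B₀ W h))
      ... | inj₁ h′ = h′
      ... | inj₂ h′ = contradiction h′ (∈─⇒∉ {p = B₀} h)
      B₀⊆ : B₀ ⊆ cls ω′ d
      B₀⊆ {x} h = subst (x ∈_) (sym W′-d) (x∈p∪q⁺ (helper (x ∈? W)))
        where
        helper : Dec (x ∈ W) → x ∈ W′ ⊎ x ∈ B
        helper (yes x∈W) = inj₁ (W⊆W′ x∈W)
        helper (no x∉W)  = inj₂ (x∈p∧x∉q⇒x∈p─q h x∉W)
      T = target d
      -- `B₀` passes the test that `target?` makes on `d`, so the search for `T` succeeds and does
      -- not fall back to `⊥`.
      T∈F : T ∈ₗ F
      T∈F = firstSat-∈ (target? d) (loseₗ (firstSat-∈ (fits? w S W) good)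
        (B₀⊆ , subst (λ W → ∣ B₀ ─ W ∣ ≤ w) (sym W-d) (∣fresh∣≤w S c)))
      T⊆ : T ⊆ W′ ∪ B
      T⊆ {x} h = subst (x ∈_) W′-d (proj₁ (target-sat d) h)
      T⊆S∪W′ : T ⊆ S ∪ W′
      T⊆S∪W′ h with x∈p∪q⁻ W′ B (T⊆ h)
      ... | inj₁ h′ = q⊆p∪q S W′ h′
      ... | inj₂ h′ = p⊆p∪q W′ (B⊆S h′)
      K = (T ─ cls ω d) ∩ B
      T─W′⊆K : T ─ W′ ⊆ K
      T─W′⊆K {x} h = x∈p∩q⁺ (x∈p∧x∉q⇒x∈p─q x∈T (λ x∈ → x∉W′ (W⊆W′ (subst (x ∈_) W-d x∈))) ,
                              [ (λ x∈ → contradiction x∈ x∉W′) , id ]′ (x∈p∪q⁻ W′ B (T⊆ x∈T)))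
        where
        x∈T = p─q⊆p T W′ h
        x∉W′ = ∈─⇒∉ {p = T} h
      w′<∣K∣ : w′ < ∣ K ∣
      w′<∣K∣ = ≤-trans (≰⇒> (λ le → ¬good (loseₗ T∈F (T⊆S∪W′ , le)))) (p⊆q⇒∣p∣≤∣q∣ T─W′⊆K)
      code≡1 : code c S K d ≡ 1
      code≡1 = cong₂ _*_ (𝟙-yes (w′ <? ∣ K ∣) w′<∣K∣) (cong₂ _*_
        (𝟙-yes (K ⊆? S) (λ h → B⊆S (p∩q⊆q (T ─ cls ω d) B h)))
        (trans (cong (λ B → agreeOff B d c) fresh≡) (agreeOff-recolour B κ c)))

    lost : ℕ
    lost = ∑ C λ c → ∑ F λ S → codes c S

    bad-step : bad w′ ω′ ≤ bad w ω + lost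
    bad-step = begin
      bad w′ ω′ ≤⟨ ∑-mono C (λ c → ∑-mono F (λ S → split c S)) ⟩
      ∑ C (λ c → ∑ F λ S → 𝟙 (¬? (good? w S (cls ω c))) + codes c S)
        ≡⟨ trans (∑-cong C (λ c → ∑-+ F _ (codes c))) (∑-+ C _ (λ c → ∑ F (codes c))) ⟩
      bad w ω + lost ∎
      where
      open ≤-Reasoning
      split : ∀ c S → 𝟙 (¬? (good? w′ S (cls ω′ c))) ≤ 𝟙 (¬? (good? w S (cls ω c))) + codes c S
      split c S = 𝟙-case (¬? (good? w′ S (cls ω′ c))) helper
        where
        helper : ¬ Good w′ S (cls ω′ c) → 1 ≤ 𝟙 (¬? (good? w S (cls ω c))) + codes c S
        helper ¬g with good? w S (cls ω c)
        ... | yes g = encode c S g ¬g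
        ... | no _  = s≤s z≤n

    -- Spreadness leaves at most `length F / R ^ ∣ A ∣` members above `A`, with `∣ A ∣ > w′`, and
    -- each of them leaves at most `q ^ w` old colourings.
    code-count : ∀ d A → (∑ F λ S → ∑ C λ c → code c S A d) * R ^ suc w′ ≤ length F * q ^ w
    code-count d A = begin
      (∑ F λ S → ∑ C λ c → code c S A d) * R ^ suc w′
        ≤⟨ *-monoˡ-≤ (R ^ suc w′) (∑-mono F (λ S → inner S)) ⟩
      (∑ F λ S → 𝟙 (w′ <? ∣ A ∣) * (𝟙 (A ⊆? S) * q ^ w)) * R ^ suc w′
        ≡⟨ cong (_* R ^ suc w′) (trans (∑-*ˡ F (𝟙 (w′ <? ∣ A ∣)) _) (cong (𝟙 (w′ <? ∣ A ∣) *_) (∑-*ʳ F (λ S → 𝟙 (A ⊆? S)) (q ^ w)))) ⟩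
      𝟙 (w′ <? ∣ A ∣) * (#⊇ A * q ^ w) * R ^ suc w′
        ≡⟨ *-assoc (𝟙 (w′ <? ∣ A ∣)) _ _ ⟩
      𝟙 (w′ <? ∣ A ∣) * (#⊇ A * q ^ w * R ^ suc w′)
        ≤⟨ 𝟙-bound (w′ <? ∣ A ∣) large ⟩
      length F * q ^ w ∎
      where
      open ≤-Reasoning
      inner : ∀ S → (∑ C λ c → code c S A d) ≤ 𝟙 (w′ <? ∣ A ∣) * (𝟙 (A ⊆? S) * q ^ w)
      inner S = begin
        (∑ C λ c → code c S A d)
          ≡⟨ trans (∑-*ˡ C (𝟙 (w′ <? ∣ A ∣)) _) (cong (𝟙 (w′ <? ∣ A ∣) *_) (∑-*ˡ C (𝟙 (A ⊆? S)) _)) ⟩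
        𝟙 (w′ <? ∣ A ∣) * (𝟙 (A ⊆? S) * ∑ C (agreeOff (fresh S d) d))
          ≡⟨ cong (λ z → 𝟙 (w′ <? ∣ A ∣) * (𝟙 (A ⊆? S) * z)) (∑-agreeOff (fresh S d) d) ⟩
        𝟙 (w′ <? ∣ A ∣) * (𝟙 (A ⊆? S) * q ^ ∣ fresh S d ∣)
          ≤⟨ *-monoʳ-≤ (𝟙 (w′ <? ∣ A ∣)) (*-monoʳ-≤ (𝟙 (A ⊆? S)) (^-monoʳ-≤ q (∣fresh∣≤w S d))) ⟩
        𝟙 (w′ <? ∣ A ∣) * (𝟙 (A ⊆? S) * q ^ w) ∎
      large : w′ < ∣ A ∣ → #⊇ A * q ^ w * R ^ suc w′ ≤ length F * q ^ w
      large lt = begin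
        #⊇ A * q ^ w * R ^ suc w′ ≤⟨ *-monoʳ-≤ (#⊇ A * q ^ w) (^-monoʳ-≤ R lt) ⟩
        #⊇ A * q ^ w * R ^ ∣ A ∣  ≡⟨ solve 3 (λ x y z → x :* y :* z := x :* z :* y) refl (#⊇ A) (q ^ w) (R ^ ∣ A ∣) ⟩
        #⊇ A * R ^ ∣ A ∣ * q ^ w  ≤⟨ *-monoˡ-≤ (q ^ w) (spread A) ⟩
        length F * q ^ w ∎
        where open +-*-Solver

    -- `A` is a subset of a set of at most `w` points, which costs `2 ^ w` on top of `code-count`.
    -- The sums are reordered so that `d` and `A` are fixed before `S` and `c`.
    lost-bound : lost * R ^ suc w′ ≤ length C * (2 ^ w * (length F * q ^ w))
    lost-bound = begin
      lost * R ^ suc w′ ≡⟨ cong (_* R ^ suc w′) reorder ⟩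
      (∑ C λ d → ∑ (subs d) λ A → ∑ F λ S → ∑ C λ c → code c S A d) * R ^ suc w′
        ≡⟨ sym (trans (∑-cong C (λ d → ∑-*ʳ (subs d) (λ A → ∑ F λ S → ∑ C λ c → code c S A d) (R ^ suc w′))) (∑-*ʳ C _ (R ^ suc w′))) ⟩
      (∑ C λ d → ∑ (subs d) λ A → (∑ F λ S → ∑ C λ c → code c S A d) * R ^ suc w′)
        ≤⟨ ∑-mono C (λ d → ∑-mono (subs d) (code-count d)) ⟩
      (∑ C λ d → ∑ (subs d) λ A → length F * q ^ w)
        ≡⟨ ∑-cong C (λ d → trans (∑-const (subs d) (length F * q ^ w)) (cong (_* (length F * q ^ w)) (length-subsetsOf (target d ─ cls ω d)))) ⟩
      (∑ C λ d → 2 ^ ∣ target d ─ cls ω d ∣ * (length F * q ^ w))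
        ≤⟨ ∑-mono C (λ d → *-monoˡ-≤ (length F * q ^ w) (^-monoʳ-≤ 2 (proj₂ (target-sat d)))) ⟩
      (∑ C λ d → 2 ^ w * (length F * q ^ w)) ≡⟨ ∑-const C _ ⟩
      length C * (2 ^ w * (length F * q ^ w)) ∎
      where
      open ≤-Reasoning
      subs : Vec (Fin q) N → List (Subset N)
      subs d = subsetsOf (target d ─ cls ω d)
      reorder : lost ≡ (∑ C λ d → ∑ (subs d) λ A → ∑ F λ S → ∑ C λ c → code c S A d)
      reorder = begin-equality
        (∑ C λ c → ∑ F λ S → ∑ C λ d → ∑ (subs d) λ A → code c S A d)
          ≡⟨ ∑-swap C F _ ⟩
        (∑ F λ S → ∑ C λ c → ∑ C λ d → ∑ (subs d) λ A → code c S A d)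
          ≡⟨ ∑-cong F (λ S → ∑-swap C C _) ⟩
        (∑ F λ S → ∑ C λ d → ∑ C λ c → ∑ (subs d) λ A → code c S A d)
          ≡⟨ ∑-cong F (λ S → ∑-cong C (λ d → ∑-swap C (subs d) (λ c A → code c S A d))) ⟩
        (∑ F λ S → ∑ C λ d → ∑ (subs d) λ A → ∑ C λ c → code c S A d)
          ≡⟨ ∑-swap F C _ ⟩
        (∑ C λ d → ∑ F λ S → ∑ (subs d) λ A → ∑ C λ c → code c S A d)
          ≡⟨ ∑-cong C (λ d → ∑-swap F (subs d) (λ S A → ∑ C λ c → code c S A d)) ⟩
        (∑ C λ d → ∑ (subs d) λ A → ∑ F λ S → ∑ C λ c → code c S A d) ∎

-- Iterating the encoding step

module Threshold (ℓ : ℕ) .{{_ : NonZero ℓ}} where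

  -- Halving the threshold would cost √R per point; the factor 1 − 1/ℓ costs only R^(1/ℓ) ≤ 2, which keeps R linear in r.
  shrink : ℕ → ℕ
  shrink zero    = zero
  shrink (suc v) = v ∸ v / ℓ

  threshold : ℕ → ℕ → ℕ
  threshold t zero    = t
  threshold t (suc i) = shrink (threshold t i)

  -- While the threshold exceeds `h * ℓ`, the quotient by `ℓ` is at least `h`, so a step removes at
  -- least `suc h`.
  shrink-≤ : ∀ h j w → w ≤ h * ℓ + suc j * suc h → shrink w ≤ h * ℓ + j * suc h
  shrink-≤ h j zero    le = z≤n
  shrink-≤ h j (suc v) le with h * ℓ ≤? v
  ... | yes hℓ≤v = begin
    v ∸ v / ℓ              ≤⟨ ∸-monoʳ-≤ v h≤ ⟩
    v ∸ h                  ≤⟨ m≤n+o⇒m∸n≤o v h (s≤s⁻¹ (≤-trans le (≤-reflexive eq))) ⟩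
    h * ℓ + j * suc h      ∎
    where
    open ≤-Reasoning
    open +-*-Solver
    h≤ : h ≤ v / ℓ
    h≤ = ≤-trans (≤-reflexive (sym (m*n/n≡m h ℓ))) (/-monoˡ-≤ ℓ hℓ≤v)
    eq : h * ℓ + suc j * suc h ≡ suc (h + (h * ℓ + j * suc h))
    eq = solve 3 (λ h ℓ j → h :* ℓ :+ (con 1 :+ j) :* (con 1 :+ h) := con 1 :+ (h :+ (h :* ℓ :+ j :* (con 1 :+ h)))) refl h ℓ j
  ... | no hℓ≰v = ≤-trans (m∸n≤m v (v / ℓ)) (≤-trans (<⇒≤ (≰⇒> hℓ≰v)) (m≤m+n _ _))

  threshold-≤ : ∀ h j t i → threshold t i ≤ h * ℓ + j * suc h → threshold t (j + i) ≤ h * ℓ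
  threshold-≤ h zero    t i le = ≤-trans le (≤-reflexive (+-identityʳ _))
  threshold-≤ h (suc j) t i le = subst (λ z → threshold t z ≤ h * ℓ) (+-suc j i)
    (threshold-≤ h j t (suc i) (shrink-≤ h j (threshold t i) le))

  -- A phase of `ℓ` steps halves `suc h`, because until then every step removes at least `suc h′`,
  -- half of `suc h`. After `a` phases nothing is left, and this is why a group gets `a * ℓ`
  -- colours.
  threshold-zero : ∀ a h t i → suc h ≡ 2 ^ a → threshold t i ≤ h * ℓ → threshold t (a * ℓ + i) ≡ 0
  threshold-zero zero    zero t i eq le = n≤0⇒n≡0 le
  threshold-zero (suc a) h    t i eq le = subst (λ z → threshold t z ≡ 0) reindex
    (threshold-zero a h′ t (ℓ + i) 1+h′≡2^a (threshold-≤ h′ ℓ t i (≤-trans le (≤-reflexive h*ℓ≡))))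
    where
    open +-*-Solver
    h′ = pred (2 ^ a)
    1+h′≡2^a : suc h′ ≡ 2 ^ a
    1+h′≡2^a = suc-pred (2 ^ a) {{m^n≢0 2 a}}
    reindex : a * ℓ + (ℓ + i) ≡ ℓ + a * ℓ + i
    reindex = trans (sym (+-assoc (a * ℓ) ℓ i)) (cong (_+ i) (+-comm (a * ℓ) ℓ))
    h≡ : h ≡ h′ + suc h′
    h≡ = suc-injective (trans eq (trans (cong (2 *_) (sym 1+h′≡2^a)) (cong (suc h′ +_) (+-identityʳ (suc h′)))))
    h*ℓ≡ : h * ℓ ≡ h′ * ℓ + ℓ * suc h′
    h*ℓ≡ = trans (cong (_* ℓ) h≡) (trans (*-distribʳ-+ ℓ h′ (suc h′)) (cong (h′ * ℓ +_) (*-comm (suc h′) ℓ)))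

^-distribʳ-* : ∀ b x y → (x * y) ^ b ≡ x ^ b * y ^ b
^-distribʳ-* zero    x y = refl
^-distribʳ-* (suc b) x y = trans (cong (x * y *_) (^-distribʳ-* b x y))
  (solve 4 (λ x y s t → x :* y :* (s :* t) := x :* s :* (y :* t)) refl x y (x ^ b) (y ^ b))
  where open +-*-Solver

-- Per point, an encoding costs q for the old colour, 2 for the subset, and R^(1/ℓ) ≤ 2 for the points not in
-- the subset; the remaining factor 4 of R = 16 q makes the losses decay geometrically in the threshold.
module Chain {N : ℕ} (F : List (Subset N)) {q : ℕ} (q>0 : 0 < q)
             (spread : ∀ Y → Spread.#⊇ F Y * (16 * q) ^ ∣ Y ∣ ≤ length F)
             (ℓ : ℕ) .{{_ : NonZero ℓ}} (16q≤2^ℓ : 16 * q ≤ 2 ^ ℓ)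
             (t : ℕ) (∣S∣≤t : ∀ {S} → S ∈ₗ F → ∣ S ∣ ≤ t)
             (ω : ℕ → Fin q → Bool) (κ : ℕ → Fin q) (n : ℕ)
             (ωκ : ∀ i → i < n → ω i (κ i) ≡ false) (ω′κ : ∀ i → i < n → ω (suc i) (κ i) ≡ true)
             (ω-mono : ∀ i x → ω i x ≡ true → ω (suc i) x ≡ true) where

  open Spread F
  open Threshold ℓ

  private
    C = colourings q N
    instance
      _ = >-nonZero q>0
      4q≢0 : NonZero (4 * q)
      4q≢0 = m*n≢0 4 q

  tot : ℕ
  tot = length C * length F

  -- The weight `2 ^ threshold` makes the invariant reproduce itself: a step lowers a positive
  -- threshold by at least one, so the old bad pairs use up at most half of `tot`, and the newly
  -- lost pairs fit into the other half.
  Bounded : ℕ → Set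
  Bounded i = 2 * (bad (threshold t i) (ω i) * 2 ^ threshold t i) ≤ tot

  bounded-0 : Bounded 0
  bounded-0 = ≤-trans (≤-reflexive (cong (λ z → 2 * (z * 2 ^ t)) bad≡0)) z≤n
    where
    good-self : ∀ {S W} → S ∈ₗ F → Good t S W
    good-self {S} {W} S∈F = loseₗ {P = Fits t S W} S∈F (p⊆p∪q W , ≤-trans (∣p─q∣≤∣p∣ S W) (∣S∣≤t S∈F))
    bad≡0 : bad t (ω 0) ≡ 0
    bad≡0 = n≤0⇒n≡0 (≤-trans (∑-mono C (λ c → ≤-trans
      (∑-mono-∈ F (λ {S} S∈F → 𝟙-case (¬? (good? t S (cls (ω 0) c))) (λ ¬g → contradiction (good-self S∈F) ¬g)))
      (≤-reflexive (∑-zero F)))) (≤-reflexive (∑-zero C)))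

  decay : ∀ b b′ lost v → b′ ≤ b + lost →
          lost * (16 * q) ^ suc (v ∸ v / ℓ) ≤ length C * (2 ^ suc v * (length F * q ^ suc v)) →
          2 * (b * 2 ^ suc v) ≤ tot → 2 * (b′ * 2 ^ (v ∸ v / ℓ)) ≤ tot
  decay b b′ lost v b′≤ lost≤ b≤ = *-cancelˡ-≤ 2 (begin
    2 * (2 * (b′ * 2 ^ (v ∸ v / ℓ)))
      ≤⟨ *-monoʳ-≤ 2 (*-monoʳ-≤ 2 (*-mono-≤ b′≤ (^-monoʳ-≤ 2 (m∸n≤m v (v / ℓ))))) ⟩
    2 * (2 * ((b + lost) * 2 ^ v))
      ≡⟨ solve 3 (λ b x z → con 2 :* (con 2 :* ((b :+ x) :* z)) := con 2 :* (b :* (con 2 :* z)) :+ x :* (con 2 :* (con 2 :* z))) refl b lost (2 ^ v) ⟩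
    2 * (b * 2 ^ w) + lost * 2 ^ suc w
      ≤⟨ +-mono-≤ b≤ (≤-trans (*-monoʳ-≤ lost 2^1+w≤4^w) lost*4^w≤tot) ⟩
    tot + tot ≡⟨ cong (tot +_) (sym (+-identityʳ tot)) ⟩
    2 * tot ∎)
    where
    open ≤-Reasoning
    open +-*-Solver
    w = suc v
    e = v / ℓ
    R = 16 * q
    instance
      _ : NonZero ((4 * q) ^ w)
      _ = m^n≢0 (4 * q) w
    2^1+w≤4^w : 2 ^ suc w ≤ 4 ^ w
    2^1+w≤4^w = begin
      2 ^ suc w     ≤⟨ ^-monoʳ-≤ 2 {suc w} {2 * w} (≤-trans (s≤s (s≤s (m≤n+m v v))) (≤-reflexive (solve 1 (λ v → con 2 :+ (v :+ v) := con 2 :* (con 1 :+ v)) refl v))) ⟩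
      2 ^ (2 * w)   ≡⟨ sym (^-*-assoc 2 2 w) ⟩
      4 ^ w         ∎
    R^e≤2^w : R ^ e ≤ 2 ^ w
    R^e≤2^w = begin
      R ^ e         ≤⟨ ^-monoˡ-≤ e 16q≤2^ℓ ⟩
      (2 ^ ℓ) ^ e   ≡⟨ ^-*-assoc 2 ℓ e ⟩
      2 ^ (ℓ * e)   ≤⟨ ^-monoʳ-≤ 2 (≤-trans (≤-trans (≤-reflexive (*-comm ℓ e)) (m/n*n≤m v ℓ)) (n≤1+n v)) ⟩
      2 ^ w         ∎
    R^w≡ : R ^ w ≡ R ^ suc (v ∸ e) * R ^ e
    R^w≡ = trans (cong (R ^_) (cong suc (sym (m∸n+n≡m (m/n≤m v ℓ))))) (^-distribˡ-+-* R (suc (v ∸ e)) e)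
    lost*4^w≤tot : lost * 4 ^ w ≤ tot
    lost*4^w≤tot = *-cancelʳ-≤ (lost * 4 ^ w) tot ((4 * q) ^ w) (begin
      lost * 4 ^ w * (4 * q) ^ w
        ≡⟨ trans (*-assoc lost (4 ^ w) _) (cong (lost *_) (trans (sym (^-distribʳ-* w 4 (4 * q))) (cong (_^ w) (sym (*-assoc 4 4 q))))) ⟩
      lost * R ^ w
        ≡⟨ trans (cong (lost *_) R^w≡) (sym (*-assoc lost _ _)) ⟩
      lost * R ^ suc (v ∸ e) * R ^ e
        ≤⟨ *-mono-≤ lost≤ R^e≤2^w ⟩
      length C * (2 ^ w * (length F * q ^ w)) * 2 ^ w
        ≡⟨ solve 4 (λ c f z y → c :* (z :* (f :* y)) :* z := c :* f :* (z :* z :* y)) refl (length C) (length F) (2 ^ w) (q ^ w) ⟩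
      tot * (2 ^ w * 2 ^ w * q ^ w)
        ≡⟨ cong (tot *_) (trans (cong (_* q ^ w) (sym (^-distribʳ-* w 2 2))) (sym (^-distribʳ-* w 4 q))) ⟩
      tot * (4 * q) ^ w ∎)

  bounded-suc : ∀ i → i < n → ∀ w → w ≡ threshold t i → 0 < w → Bounded i → Bounded (suc i)
  bounded-suc i i<n (suc v) eq _ b with threshold t i | eq
  ... | _ | refl = decay (bad (suc v) (ω i)) (bad (v ∸ v / ℓ) (ω (suc i))) lost v bad-step lost-bound b
    where open Step spread (≤-trans q>0 (m≤n*m q 16)) q>0 (ω i) (ω (suc i)) (κ i) (ωκ i i<n) (ω′κ i i<n) (ω-mono i)
                    (suc v) (v ∸ v / ℓ)

  -- A step gains only from a positive threshold, so the iteration stops at the first index where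
  -- the threshold is 0.
  run : ∀ i → i ≤ n → (∃ λ j → j ≤ n × threshold t j ≡ 0 × Bounded j) ⊎ Bounded i
  run zero    _   = inj₂ bounded-0
  run (suc i) i<n with run i (<⇒≤ i<n)
  ... | inj₁ found = inj₁ found
  ... | inj₂ b with threshold t i ≟ 0
  ...   | yes eq = inj₁ (i , <⇒≤ i<n , eq , b)
  ...   | no neq = inj₂ (bounded-suc i i<n (threshold t i) refl (n≢0⇒n>0 neq) b)

  bounded⇒bad-0 : ∀ j → threshold t j ≡ 0 → Bounded j → 2 * bad 0 (ω j) ≤ tot
  bounded⇒bad-0 j eq bounded = ≤-trans (≤-reflexive (cong (2 *_) (sym (*-identityʳ (bad 0 (ω j))))))
    (subst (λ w → 2 * (bad w (ω j) * 2 ^ w) ≤ tot) eq bounded)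

  bad-0 : threshold t n ≡ 0 → ∃ λ j → j ≤ n × 2 * bad 0 (ω j) ≤ tot
  bad-0 eq with run n ≤-refl
  ... | inj₁ (j , j≤n , eqj , bounded) = j , j≤n , bounded⇒bad-0 j eqj bounded
  ... | inj₂ bounded                   = n , ≤-refl , bounded⇒bad-0 n eq bounded

-- Disjoint members of a spread family

does⇒ : {P : Set p} (d : Dec P) → does d ≡ true → P
does⇒ (yes h) _ = h

∣p∣≤0⇒∉ : {S : Subset N} {x : Fin N} → ∣ S ∣ ≤ 0 → x ∉ S
∣p∣≤0⇒∉ le x∈S = contradiction (≤-trans (x∈p⇒∣p-x∣<∣p∣ x∈S) le) λ ()

Disjoint : Subset N → Subset N → Set
Disjoint S S′ = ∀ {x} → x ∈ S → x ∉ S′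

module DisjointMembers
  {N : ℕ} (F : List (Subset N)) (F>0 : 0 < length F) (r a ℓ G K : ℕ)
  (G≡2*r : G ≡ 2 * r) (K≡a*ℓ : K ≡ a * ℓ)
  .{{_ : NonZero G}} .{{_ : NonZero K}} .{{_ : NonZero ℓ}}
  (spread : ∀ Y → Spread.#⊇ F Y * (16 * (G * K)) ^ ∣ Y ∣ ≤ length F)
  (16q≤2^ℓ : 16 * (G * K) ≤ 2 ^ ℓ)
  (∣S∣<2^a : ∀ {S} → S ∈ₗ F → ∣ S ∣ < 2 ^ a) where

  private
    C = colourings (G * K) N
    instance
      GK≢0 : NonZero (G * K)
      GK≢0 = m*n≢0 G K
      _ = >-nonZero F>0

  grp : Fin G → Vec (Fin (G * K)) N → Subset N
  grp g = cls (λ x → does (g Fin.≟ quotient {G} K x))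

  Hit : Fin G → Vec (Fin (G * K)) N → Set
  Hit g c = Any (_⊆ grp g c) F

  hit? : ∀ g c → Dec (Hit g c)
  hit? g c = Any.any? (_⊆? grp g c) F

  ω : Fin G → ℕ → Fin (G * K) → Bool
  ω g i x = does (g Fin.≟ quotient {G} K x) ∧ does (toℕ (remainder {G} K x) <? i)

  -- `mod K` only makes the colour total in `i`; the run uses it for `i < K`, where it adds the
  -- `i`-th colour of group `g`.
  κ : Fin G → ℕ → Fin (G * K)
  κ g i = combine g (i mod K)

  ω-κ : ∀ g i j → i < K → ω g j (κ g i) ≡ does (i <? j)
  ω-κ g i j i<K = cong₂ _∧_
    (dec-true (g Fin.≟ quotient {G} K (κ g i)) (sym (cong proj₁ (Fin.remQuot-combine g (i mod K)))))
    (cong (λ z → does (z <? j)) (trans (cong (toℕ ∘ proj₂) (Fin.remQuot-combine g (i mod K)))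
      (trans (Fin.toℕ-fromℕ< (m%n<n i K)) (m<n⇒m%n≡m i<K))))

  ω-suc : ∀ g i x → ω g i x ≡ true → ω g (suc i) x ≡ true
  ω-suc g i x eq with does (g Fin.≟ quotient {G} K x)
  ... | true = dec-true (_ <? suc i) (m<n⇒m<1+n (does⇒ (toℕ (remainder {G} K x) <? i) eq))

  ω⊆grp : ∀ g i c → cls (ω g i) c ⊆ grp g c
  ω⊆grp g i c {x} h = ∈-cls⁺ _ c (helper (does (g Fin.≟ quotient {G} K (lookup c x))) (∈-cls⁻ (ω g i) c h))
    where
    helper : ∀ b {b′} → b ∧ b′ ≡ true → b ≡ true
    helper true _ = refl

  open Spread F

  good-0⇒hit : ∀ g i c S → Good 0 S (cls (ω g i) c) → Hit g c
  good-0⇒hit g i c S = Any.map sub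
    where
    W = cls (ω g i) c
    sub : ∀ {S′} → Fits 0 S W S′ → S′ ⊆ grp g c
    sub {S′} (_ , le) {x} x∈ with x ∈? W
    ... | yes x∈W = ω⊆grp g i c x∈W
    ... | no x∉W  = contradiction (x∈p∧x∉q⇒x∈p─q x∈ x∉W) (∣p∣≤0⇒∉ {S = S′ ─ W} le)

  bad-0 : ∀ g → ∃ λ j → j ≤ K × 2 * bad 0 (ω g j) ≤ length C * length F
  -- The run starts at `pred (2 ^ a)`, which bounds the size of every member and is a value from
  -- which `K` steps lead to threshold 0.
  bad-0 g = Chain.bad-0 F (>-nonZero⁻¹ (G * K)) spread ℓ 16q≤2^ℓ (pred (2 ^ a))
    (λ S∈F → ≤-pred (≤-trans (∣S∣<2^a S∈F) (≤-reflexive (sym 2^a≡))))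
    (ω g) (κ g) K
    (λ i i<K → trans (ω-κ g i i i<K) (dec-false (i <? i) (<-irrefl refl)))
    (λ i i<K → trans (ω-κ g i (suc i) i<K) (dec-true (i <? suc i) ≤-refl))
    (ω-suc g)
    (subst (λ z → Threshold.threshold ℓ (pred (2 ^ a)) z ≡ 0) (trans (+-identityʳ (a * ℓ)) (sym K≡a*ℓ))
      (Threshold.threshold-zero ℓ a (pred (2 ^ a)) _ 0 2^a≡ (m≤m*n _ ℓ)))
    where
    2^a≡ : suc (pred (2 ^ a)) ≡ 2 ^ a
    2^a≡ = suc-pred (2 ^ a) {{m^n≢0 2 a}}

  -- A colouring whose group `g` contains no member is bad for all members at once, since goodness
  -- at threshold 0 yields a hit whatever `S` is. So `length F` cancels from the bound on bad pairs.
  misses : ∀ g → 2 * (∑ C λ c → 𝟙 (¬? (hit? g c))) ≤ length C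
  misses g with j , j≤K , b ← bad-0 g = *-cancelʳ-≤ (2 * (∑ C λ c → 𝟙 (¬? (hit? g c)))) (length C) (length F) (begin
    2 * (∑ C λ c → 𝟙 (¬? (hit? g c))) * length F
      ≡⟨ trans (*-assoc 2 (∑ C λ c → 𝟙 (¬? (hit? g c))) (length F)) (cong (2 *_) (sym (∑-*ʳ C (λ c → 𝟙 (¬? (hit? g c))) (length F)))) ⟩
    2 * (∑ C λ c → 𝟙 (¬? (hit? g c)) * length F)
      ≡⟨ cong (2 *_) (∑-cong C (λ c → trans (*-comm (𝟙 (¬? (hit? g c))) (length F)) (sym (∑-const F (𝟙 (¬? (hit? g c))))))) ⟩
    2 * (∑ C λ c → ∑ F λ S → 𝟙 (¬? (hit? g c)))
      ≤⟨ *-monoʳ-≤ 2 (∑-mono C (λ c → ∑-mono F (λ S →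
           𝟙-mono (¬? (hit? g c)) (¬? (good? 0 S (cls (ω g j) c))) (λ ¬h g′ → ¬h (good-0⇒hit g j c S g′))))) ⟩
    2 * bad 0 (ω g j) ≤⟨ b ⟩
    length C * length F ∎)
    where open ≤-Reasoning

  -- By `misses`, a colouring misses on average at most `r` of the `2 * r` groups. Comparing with
  -- `suc r` gives the strict inequality that yields one colouring with at most `r` misses.
  few : (∑ C λ c → ∑ (allFin G) λ g → 𝟙 (¬? (hit? g c))) < ∑ C (const (suc r))
  few = begin-strict
    (∑ C λ c → ∑ (allFin G) λ g → 𝟙 (¬? (hit? g c)))
      ≤⟨ *-cancelˡ-≤ 2 (begin
        2 * (∑ C λ c → ∑ (allFin G) λ g → 𝟙 (¬? (hit? g c)))
          ≡⟨ cong (2 *_) (∑-swap C (allFin G) (λ c g → 𝟙 (¬? (hit? g c)))) ⟩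
        2 * (∑ (allFin G) λ g → ∑ C λ c → 𝟙 (¬? (hit? g c)))
          ≡⟨ sym (∑-*ˡ (allFin G) 2 (λ g → ∑ C λ c → 𝟙 (¬? (hit? g c)))) ⟩
        (∑ (allFin G) λ g → 2 * ∑ C λ c → 𝟙 (¬? (hit? g c)))
          ≤⟨ ∑-mono (allFin G) misses ⟩
        (∑ (allFin G) λ g → length C)
          ≡⟨ trans (∑-const (allFin G) (length C)) (cong (_* length C) (trans (length-allFin G) G≡2*r)) ⟩
        2 * r * length C ≡⟨ *-assoc 2 r (length C) ⟩
        2 * (r * length C) ∎) ⟩
    r * length C <⟨ m<n+m (r * length C) C>0 ⟩
    suc r * length C ≡⟨ trans (*-comm (suc r) (length C)) (sym (∑-const C (suc r))) ⟩
    ∑ C (const (suc r)) ∎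
    where
    C>0 : 0 < length C
    C>0 = subst (0 <_) (sym (trans (length-allVecs (allFin (G * K)) N) (cong (_^ N) (length-allFin (G * K)))))
            (m^n>0 (G * K) N)
    open ≤-Reasoning

  lucky : ∃ λ c → r ≤ length (filter (λ g → hit? g c) (allFin G))
  lucky with c , lt ← ∑<∑⇒∃< C (λ c → ∑ (allFin G) λ g → 𝟙 (¬? (hit? g c))) (const (suc r)) few
    = c , +-cancelʳ-≤ r r _ (begin
    r + r ≡⟨ trans (cong (r +_) (sym (+-identityʳ r))) (sym G≡2*r) ⟩
    G ≡⟨ trans (sym (length-allFin G)) (sym (∑-1 (allFin G))) ⟩
    (∑ (allFin G) λ g → 1) ≤⟨ ∑-mono (allFin G) dichotomy ⟩
    (∑ (allFin G) λ g → 𝟙 (hit? g c) + 𝟙 (¬? (hit? g c))) ≡⟨ ∑-+ (allFin G) _ _ ⟩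
    (∑ (allFin G) λ g → 𝟙 (hit? g c)) + (∑ (allFin G) λ g → 𝟙 (¬? (hit? g c)))
      ≤⟨ +-mono-≤ (≤-reflexive (sym (length-filter≡∑ (λ g → hit? g c) (allFin G)))) (≤-pred lt) ⟩
    length (filter (λ g → hit? g c) (allFin G)) + r ∎)
    where
    open ≤-Reasoning
    dichotomy : ∀ g → 1 ≤ 𝟙 (hit? g c) + 𝟙 (¬? (hit? g c))
    dichotomy g with hit? g c
    ... | yes _ = ≤-refl
    ... | no _  = ≤-refl

  member : Vec (Fin (G * K)) N → Fin G → Subset N
  member c g = firstSat (_⊆? grp g c) F

  member∈F : ∀ c g → Hit g c → member c g ∈ₗ F
  member∈F c g = firstSat-∈ (_⊆? grp g c)

  member-colour : ∀ c g {x} → x ∈ member c g → g ≡ quotient {G} K (lookup c x)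
  member-colour c g {x} h = does⇒ (g Fin.≟ quotient {G} K (lookup c x))
    (∈-cls⁻ (λ y → does (g Fin.≟ quotient {G} K y)) c (firstSat-sat (_⊆? grp g c) (⊆-min (grp g c)) F h))

  member-disjoint : ∀ c {g g′} → g ≢ g′ → Disjoint (member c g) (member c g′)
  member-disjoint c {g} {g′} g≢g′ h h′ = g≢g′ (trans (member-colour c g h) (sym (member-colour c g′ h′)))

  disjoint-members : ∃ λ Ps → length Ps ≡ r × All (_∈ₗ F) Ps × AllPairs Disjoint Ps
  disjoint-members = select (proj₁ lucky) (proj₂ lucky)
    where
    select : ∀ c → r ≤ length (filter (λ g → hit? g c) (allFin G)) →
             ∃ λ Ps → length Ps ≡ r × All (_∈ₗ F) Ps × AllPairs Disjoint Ps
    select c r≤ = List.map (member c) gs ,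
      trans (List.length-map (member c) gs) (trans (List.length-take r hits) (m≤n⇒m⊓n≡m r≤)) ,
      All.map⁺ (All.map (λ {g} → member∈F c g) (All.take⁺ r (All.all-filter (λ g → hit? g c) (allFin G)))) ,
      AllPairs.map⁺ (AllPairs.map (member-disjoint c) (Unique.take⁺ r (Unique.filter⁺ (λ g → hit? g c) (Unique.allFin⁺ G))))
      where
      hits = filter (λ g → hit? g c) (allFin G)
      gs = take r hits

-- Sunflowers

∣∪∣-disjoint : (S S′ : Subset N) → Disjoint S S′ → ∣ S ∪ S′ ∣ ≡ ∣ S ∣ + ∣ S′ ∣
∣∪∣-disjoint []          []           dis = refl
∣∪∣-disjoint (true ∷ S)  (true ∷ S′)  dis = contradiction here (dis here)
∣∪∣-disjoint (true ∷ S)  (false ∷ S′) dis = cong suc (∣∪∣-disjoint S S′ (λ h h′ → dis (there h) (there h′)))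
∣∪∣-disjoint (false ∷ S) (true ∷ S′)  dis =
  trans (cong suc (∣∪∣-disjoint S S′ (λ h h′ → dis (there h) (there h′)))) (sym (+-suc ∣ S ∣ ∣ S′ ∣))
∣∪∣-disjoint (false ∷ S) (false ∷ S′) dis = ∣∪∣-disjoint S S′ (λ h h′ → dis (there h) (there h′))

⊆∧∣≥∣⇒⊇ : {S S′ : Subset N} → S ⊆ S′ → ∣ S′ ∣ ≤ ∣ S ∣ → S′ ⊆ S
⊆∧∣≥∣⇒⊇ {S = S} sub le {x} x∈S′ with x ∈? S
... | yes x∈S = x∈S
... | no x∉S  = contradiction le (<⇒≱ (p⊂q⇒∣p∣<∣q∣ (sub , x , x∈S′ , x∉S)))

∣∣>0⇒nonempty : {S : Subset N} → 0 < ∣ S ∣ → Sub.Nonempty S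
∣∣>0⇒nonempty {N} {S} 0<∣S∣ with nonempty? S
... | yes ne   = ne
... | no empty = contradiction (subst (0 <_) (trans (cong ∣_∣ (Empty-unique empty)) (∣⊥∣≡0 N)) 0<∣S∣) λ ()

module Sunflower
  {N : ℕ} (F : List (Subset N)) (t M R : ℕ) .{{_ : NonZero R}}
  (∣S∣≡t : ∀ {S} → S ∈ₗ F → ∣ S ∣ ≡ t)
  (mult : ∀ Z → ∣ Z ∣ ≡ t → ∑ F (λ S → 𝟙 (S ⊆? Z)) ≤ M)
  (large : M * R ^ t < length F) where

  open Spread F using (#⊇)

  -- More than `M * R ^ (t - ∣ Z ∣)` members above `Z`, with the negative power moved to the other
  -- side.
  Dense : Subset N → Set
  Dense Z = M * R ^ t < #⊇ Z * R ^ ∣ Z ∣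

  dense-⊥ : Dense ⊥
  dense-⊥ = <-≤-trans large (≤-reflexive (sym (begin
    #⊇ ⊥ * R ^ ∣ ⊥ {N} ∣ ≡⟨ cong₂ _*_ (∑-cong F (λ S → 𝟙-yes (⊥ ⊆? S) (⊆-min S))) (cong (R ^_) (∣⊥∣≡0 N)) ⟩
    ∑ F (const 1) * 1    ≡⟨ trans (*-identityʳ _) (∑-1 F) ⟩
    length F ∎)))
    where open ≡-Reasoning

  -- Maximality is by size, among all dense sets and not only supersets. Each round enlarges
  -- `∣ Z ∣`, and `fuel` bounds the room left below `N`.
  maximal : ∀ fuel Z → N ≤ fuel + ∣ Z ∣ → Dense Z → ∃ λ Z → Dense Z × (∀ Z′ → ∣ Z ∣ < ∣ Z′ ∣ → ¬ Dense Z′)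
  maximal fuel Z le dense with anySubset? (λ Z′ → (∣ Z ∣ <? ∣ Z′ ∣) ×-dec (M * R ^ t <? #⊇ Z′ * R ^ ∣ Z′ ∣))
  ... | no none = Z , dense , λ Z′ lt d → none (Z′ , lt , d)
  maximal zero Z le dense | yes (Z′ , lt , d) = contradiction (∣p∣≤n Z′) (<⇒≱ (≤-<-trans le lt))
  maximal (suc fuel) Z le dense | yes (Z′ , lt , d) = maximal fuel Z′
    (≤-trans le (≤-trans (≤-reflexive (sym (+-suc fuel ∣ Z ∣))) (+-monoʳ-≤ fuel lt))) d

  module Kernel (Z : Subset N) (dense : Dense Z) (max : ∀ Z′ → ∣ Z ∣ < ∣ Z′ ∣ → ¬ Dense Z′) where

    petals : List (Subset N)
    petals = List.map (_─ Z) (filter (Z ⊆?_) F)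

    length-petals : length petals ≡ #⊇ Z
    length-petals = trans (List.length-map (_─ Z) (filter (Z ⊆?_) F)) (length-filter≡∑ (Z ⊆?_) F)

    petals>0 : 0 < length petals
    petals>0 with length petals | length-petals
    ... | zero  | eq = contradiction (subst (λ z → M * R ^ t < z * R ^ ∣ Z ∣) (sym eq) dense) λ ()
    ... | suc _ | _ = s≤s z≤n

    ∈-petals : ∀ {P} → P ∈ₗ petals → ∃ λ S → S ∈ₗ F × Z ⊆ S × P ≡ S ─ Z
    ∈-petals P∈ with S , S∈ , eq ← ∈-map⁻ (_─ Z) P∈ with S∈F , Z⊆S ← ∈-filter⁻ (Z ⊆?_) {xs = F} S∈ =
      S , S∈F , (λ h → Z⊆S h) , eq

    -- A set of size `t` lies only in members equal to it, at most `M` by `mult`; a larger set lies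
    -- in none. Neither is dense.
    ∣Z∣<t : ∣ Z ∣ < t
    ∣Z∣<t with ∣ Z ∣ <? t
    ... | yes lt = lt
    ... | no ≮t  = contradiction dense (≤⇒≯ (helper (∣ Z ∣ ≟ t)))
      where
      helper : Dec (∣ Z ∣ ≡ t) → #⊇ Z * R ^ ∣ Z ∣ ≤ M * R ^ t
      helper (yes refl) = *-monoˡ-≤ (R ^ ∣ Z ∣) (≤-trans
        (∑-mono-∈ F (λ {S} S∈F → 𝟙-mono (Z ⊆? S) (S ⊆? Z) (λ Z⊆S → ⊆∧∣≥∣⇒⊇ Z⊆S (≤-reflexive (∣S∣≡t S∈F)))))
        (mult Z refl))
      helper (no ≢t) = ≤-trans (≤-reflexive (cong (_* R ^ ∣ Z ∣) (n≤0⇒n≡0 (≤-trans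
        (∑-mono-∈ F (λ {S} S∈F → 𝟙-case (Z ⊆? S) (λ Z⊆S → contradiction
          (≤-trans (p⊆q⇒∣p∣≤∣q∣ Z⊆S) (≤-reflexive (∣S∣≡t S∈F)))
          (<⇒≱ (≤∧≢⇒< (≮⇒≥ ≮t) (≢t ∘ sym))))))
        (≤-reflexive (∑-zero F)))))) z≤n

    petal-nonempty : ∀ {P} → P ∈ₗ petals → Sub.Nonempty P
    petal-nonempty P∈ with S , S∈F , Z⊆S , refl ← ∈-petals P∈ with nonempty? (S ─ Z)
    ... | yes ne = ne
    ... | no empty = contradiction (p⊆q⇒∣p∣≤∣q∣ S⊆Z) (<⇒≱ (<-≤-trans ∣Z∣<t (≤-reflexive (sym (∣S∣≡t S∈F)))))
      where
      S⊆Z : S ⊆ Z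
      S⊆Z {x} x∈S with x ∈? Z
      ... | yes x∈Z = x∈Z
      ... | no x∉Z  = contradiction (x , x∈p∧x∉q⇒x∈p─q x∈S x∉Z) empty

    ∣P∣≤t : ∀ {P} → P ∈ₗ petals → ∣ P ∣ ≤ t
    ∣P∣≤t P∈ with S , S∈F , _ , refl ← ∈-petals P∈ = ≤-trans (∣p─q∣≤∣p∣ S Z) (≤-reflexive (∣S∣≡t S∈F))

    #⊇-petals : ∀ Y → Spread.#⊇ petals Y ≡ ∑ F (λ S → 𝟙 (Z ⊆? S) * 𝟙 (Y ⊆? (S ─ Z)))
    #⊇-petals Y = trans (∑-map (_─ Z) (filter (Z ⊆?_) F) _) (∑-filter (Z ⊆?_) F _)

    -- The case that matters is `Y` nonempty and disjoint from `Z`: then `Z ∪ Y` is larger than the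
    -- kernel, hence not dense, and comparison with the density of `Z` gives the bound. If `Y` meets
    -- `Z`, no petal contains it.
    spread : ∀ Y → Spread.#⊇ petals Y * R ^ ∣ Y ∣ ≤ length petals
    spread Y = ≤-trans (≤-reflexive (cong (_* R ^ ∣ Y ∣) (#⊇-petals Y)))
      (≤-trans (cases (∣ Y ∣ ≟ 0) (nonempty? (Z ∩ Y))) (≤-reflexive (sym length-petals)))
      where
      open ≤-Reasoning
      cases : Dec (∣ Y ∣ ≡ 0) → Dec (Sub.Nonempty (Z ∩ Y)) →
              ∑ F (λ S → 𝟙 (Z ⊆? S) * 𝟙 (Y ⊆? (S ─ Z))) * R ^ ∣ Y ∣ ≤ #⊇ Z
      cases (yes ≡0) _ = begin
        ∑ F (λ S → 𝟙 (Z ⊆? S) * 𝟙 (Y ⊆? (S ─ Z))) * R ^ ∣ Y ∣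
          ≡⟨ trans (cong (λ e → ∑ F (λ S → 𝟙 (Z ⊆? S) * 𝟙 (Y ⊆? (S ─ Z))) * R ^ e) ≡0) (*-identityʳ _) ⟩
        ∑ F (λ S → 𝟙 (Z ⊆? S) * 𝟙 (Y ⊆? (S ─ Z)))
          ≤⟨ ∑-mono F (λ S → ≤-trans (*-monoʳ-≤ (𝟙 (Z ⊆? S)) (𝟙≤1 (Y ⊆? (S ─ Z)))) (≤-reflexive (*-identityʳ _))) ⟩
        #⊇ Z ∎
      cases (no _) (yes (x , x∈)) = ≤-trans (≤-reflexive (cong (_* R ^ ∣ Y ∣) (n≤0⇒n≡0 (≤-trans
        (∑-mono F (λ S → 𝟙-bound (Z ⊆? S) (λ _ → 𝟙-case (Y ⊆? (S ─ Z)) (λ sub →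
          contradiction (proj₁ (x∈p∩q⁻ Z Y x∈)) (∈─⇒∉ {p = S} (sub (proj₂ (x∈p∩q⁻ Z Y x∈))))))))
        (≤-reflexive (∑-zero F)))))) z≤n
      cases (no ≢0) (no empty) = *-cancelʳ-≤ _ (#⊇ Z) (R ^ ∣ Z ∣) {{m^n≢0 R ∣ Z ∣}} (begin
        ∑ F (λ S → 𝟙 (Z ⊆? S) * 𝟙 (Y ⊆? (S ─ Z))) * R ^ ∣ Y ∣ * R ^ ∣ Z ∣
          ≤⟨ *-monoˡ-≤ (R ^ ∣ Z ∣) (*-monoˡ-≤ (R ^ ∣ Y ∣) (∑-mono F (λ S → 𝟙-bound (Z ⊆? S) (λ Z⊆S →
               𝟙-mono (Y ⊆? (S ─ Z)) (Z ∪ Y ⊆? S) (λ Y⊆ → λ h → [ Z⊆S , (λ h → p─q⊆p S Z (Y⊆ h)) ]′ (x∈p∪q⁻ Z Y h)))))) ⟩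
        #⊇ (Z ∪ Y) * R ^ ∣ Y ∣ * R ^ ∣ Z ∣
          ≡⟨ trans (*-assoc (#⊇ (Z ∪ Y)) _ _) (cong (#⊇ (Z ∪ Y) *_) (trans (sym (^-distribˡ-+-* R ∣ Y ∣ ∣ Z ∣))
               (cong (R ^_) (trans (+-comm ∣ Y ∣ ∣ Z ∣) (sym ∣Z∪Y∣))))) ⟩
        #⊇ (Z ∪ Y) * R ^ ∣ Z ∪ Y ∣
          ≤⟨ ≮⇒≥ (max (Z ∪ Y) (<-≤-trans (m<m+n ∣ Z ∣ (n≢0⇒n>0 ≢0)) (≤-reflexive (sym ∣Z∪Y∣)))) ⟩
        M * R ^ t ≤⟨ <⇒≤ dense ⟩
        #⊇ Z * R ^ ∣ Z ∣ ∎)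
        where
        ∣Z∪Y∣ : ∣ Z ∪ Y ∣ ≡ ∣ Z ∣ + ∣ Y ∣
        ∣Z∪Y∣ = ∣∪∣-disjoint Z Y (λ h h′ → empty (_ , x∈p∩q⁺ (h , h′)))

  Sunflower : ℕ → Set
  Sunflower r = ∃ λ Z → ∃ λ Ps → length Ps ≡ r × AllPairs Disjoint Ps ×
    All (λ P → Sub.Nonempty P × ∃ λ S → S ∈ₗ F × Z ⊆ S × P ≡ S ─ Z) Ps

  sunflower : ∀ r a ℓ .{{_ : NonZero r}} .{{_ : NonZero a}} .{{_ : NonZero ℓ}} →
              R ≡ 16 * (2 * r * (a * ℓ)) → R ≤ 2 ^ ℓ → t < 2 ^ a → Sunflower r
  sunflower r a ℓ R≡ R≤ t<2^a = at-kernel (maximal N ⊥ (m≤m+n N ∣ ⊥ {N} ∣) dense-⊥)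
    where
    at-kernel : (∃ λ Z → Dense Z × (∀ Z′ → ∣ Z ∣ < ∣ Z′ ∣ → ¬ Dense Z′)) → Sunflower r
    at-kernel (Z , dense , max) = collect (DisjointMembers.disjoint-members petals petals>0 r a ℓ (2 * r) (a * ℓ) refl refl
        {{m*n≢0 2 r}} {{m*n≢0 a ℓ}}
        (subst (λ R → ∀ Y → Spread.#⊇ petals Y * R ^ ∣ Y ∣ ≤ length petals) R≡ spread)
        (subst (_≤ 2 ^ ℓ) R≡ R≤) (λ P∈ → ≤-<-trans (∣P∣≤t P∈) t<2^a))
      where
      open Kernel Z dense max
      collect : (∃ λ Ps → length Ps ≡ r × All (_∈ₗ petals) Ps × AllPairs Disjoint Ps) → Sunflower r
      collect (Ps , len , ∈F , dis) = Z , Ps , len , dis , All.map (λ P∈ → petal-nonempty P∈ , ∈-petals P∈) ∈F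

-- Degrees and matchings

⟦∧⟧ : ∀ x y → ⟦ x ∧ y ⟧ ≡ ⟦ x ⟧ * ⟦ y ⟧
⟦∧⟧ true  true  = refl
⟦∧⟧ true  false = refl
⟦∧⟧ false y     = refl

∑-∈⁅⁆ : (x : Fin N) (f : Fin N → ℕ) → ∑ (allFin N) (λ y → 𝟙 (y ∈? ⁅ x ⁆) * f y) ≡ f x
∑-∈⁅⁆ {N} x f = begin
  ∑ (allFin N) (λ y → 𝟙 (y ∈? ⁅ x ⁆) * f y) ≡⟨ ∑-cong (allFin N) only ⟩
  ∑ (allFin N) (λ y → 𝟙 (y ∈? ⁅ x ⁆) * f x) ≡⟨ ∑-*ʳ (allFin N) (λ y → 𝟙 (y ∈? ⁅ x ⁆)) (f x) ⟩
  ∑ (allFin N) (λ y → 𝟙 (y ∈? ⁅ x ⁆)) * f x ≡⟨ cong (_* f x) (trans (sym (∣∣≡∑ ⁅ x ⁆)) (∣⁅x⁆∣≡1 x)) ⟩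
  1 * f x                                    ≡⟨ *-identityˡ (f x) ⟩
  f x ∎
  where
  open ≡-Reasoning
  only : ∀ y → 𝟙 (y ∈? ⁅ x ⁆) * f y ≡ 𝟙 (y ∈? ⁅ x ⁆) * f x
  only y with y ∈? ⁅ x ⁆
  ... | yes h = cong (λ z → 1 * f z) (x∈⁅y⁆⇒x≡y x h)
  ... | no _  = refl

𝟙-∪ : (S S′ : Subset N) → Disjoint S S′ → ∀ x → 𝟙 (x ∈? (S ∪ S′)) ≡ 𝟙 (x ∈? S) + 𝟙 (x ∈? S′)
𝟙-∪ S S′ dis x with x ∈? S | x ∈? S′
... | yes h | yes h′ = contradiction h′ (dis h)
... | yes h | no _   = 𝟙-yes (x ∈? (S ∪ S′)) (p⊆p∪q S′ h)
... | no _  | yes h′ = 𝟙-yes (x ∈? (S ∪ S′)) (q⊆p∪q S S′ h′)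
... | no h  | no h′  = 𝟙-no (x ∈? (S ∪ S′)) (λ h″ → [ h , h′ ]′ (x∈p∪q⁻ S S′ h″))

module Degree {n m : ℕ} (E : Edges n m) where

  degreeIn≡∑ : ∀ S v → degreeIn E S v ≡ ∑ (allFin m) λ e → 𝟙 (e ∈? S) * 𝟙 (v ∈? E e)
  degreeIn≡∑ S v = trans (∣∣≡∑ T) (∑-cong (allFin m) λ e → trans (sym (⟦⟧≡𝟙 T))
    (trans (cong ⟦_⟧ (Vec.lookup∘tabulate _ e))
    (trans (⟦∧⟧ (lookup S e) (lookup (E e) v)) (cong₂ _*_ (⟦⟧≡𝟙 S) (⟦⟧≡𝟙 (E e))))))
    where
    T = tabulate (λ e → lookup S e ∧ lookup (E e) v)

  degreeIn-⊥ : ∀ v → degreeIn E ⊥ v ≡ 0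
  degreeIn-⊥ v = trans (degreeIn≡∑ ⊥ v) (trans (∑-cong (allFin m)
    (λ e → cong (_* 𝟙 (v ∈? E e)) (𝟙-no (e ∈? ⊥) ∉⊥))) (∑-zero (allFin m)))

  degreeIn-⁅⁆ : ∀ e v → degreeIn E ⁅ e ⁆ v ≡ 𝟙 (v ∈? E e)
  degreeIn-⁅⁆ e v = trans (degreeIn≡∑ ⁅ e ⁆ v) (∑-∈⁅⁆ e (λ e → 𝟙 (v ∈? E e)))

  degreeIn-∪ : ∀ S S′ → Disjoint S S′ → ∀ v → degreeIn E (S ∪ S′) v ≡ degreeIn E S v + degreeIn E S′ v
  degreeIn-∪ S S′ dis v = begin
    degreeIn E (S ∪ S′) v ≡⟨ degreeIn≡∑ (S ∪ S′) v ⟩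
    ∑ (allFin m) (λ e → 𝟙 (e ∈? (S ∪ S′)) * 𝟙 (v ∈? E e))
      ≡⟨ ∑-cong (allFin m) (λ e → trans (cong (_* 𝟙 (v ∈? E e)) (𝟙-∪ S S′ dis e))
           (*-distribʳ-+ (𝟙 (v ∈? E e)) (𝟙 (e ∈? S)) (𝟙 (e ∈? S′)))) ⟩
    ∑ (allFin m) (λ e → 𝟙 (e ∈? S) * 𝟙 (v ∈? E e) + 𝟙 (e ∈? S′) * 𝟙 (v ∈? E e))
      ≡⟨ ∑-+ (allFin m) (λ e → 𝟙 (e ∈? S) * 𝟙 (v ∈? E e)) (λ e → 𝟙 (e ∈? S′) * 𝟙 (v ∈? E e)) ⟩
    ∑ (allFin m) (λ e → 𝟙 (e ∈? S) * 𝟙 (v ∈? E e)) + ∑ (allFin m) (λ e → 𝟙 (e ∈? S′) * 𝟙 (v ∈? E e)) ≡⟨ cong₂ _+_ (sym (degreeIn≡∑ S v)) (sym (degreeIn≡∑ S′ v)) ⟩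
    degreeIn E S v + degreeIn E S′ v ∎
    where open ≡-Reasoning

  covered⇒degreeIn>0 : ∀ {S v} → Covered E S v → 0 < degreeIn E S v
  covered⇒degreeIn>0 {S} {v} (e , e∈S , v∈e) = ≤-trans
    (≤-reflexive (sym (cong₂ _*_ (𝟙-yes (e ∈? S) e∈S) (𝟙-yes (v ∈? E e) v∈e))))
    (≤-trans (term≤∑ (λ e → 𝟙 (e ∈? S) * 𝟙 (v ∈? E e)) (∈-allFin e)) (≤-reflexive (sym (degreeIn≡∑ S v))))

  disjoint-⋃ : ∀ {P : Subset m} {Ps} → All (Disjoint P) Ps → Disjoint P (Sub.⋃ Ps)
  disjoint-⋃ []                  h h′ = ∉⊥ h′
  disjoint-⋃ {Ps = Q ∷ Ps} (d ∷ ds) h h′ with x∈p∪q⁻ Q (Sub.⋃ Ps) h′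
  ... | inj₁ h″ = d h h″
  ... | inj₂ h″ = disjoint-⋃ ds h h″

  degreeIn-⋃ : ∀ {Ps v d} → AllPairs Disjoint Ps → All (λ P → degreeIn E P v ≡ d) Ps →
               degreeIn E (Sub.⋃ Ps) v ≡ length Ps * d
  degreeIn-⋃ {v = v} [] [] = degreeIn-⊥ v
  degreeIn-⋃ {P ∷ Ps} {v} (dis ∷ diss) (eq ∷ eqs) =
    trans (degreeIn-∪ P (Sub.⋃ Ps) (disjoint-⋃ dis) v) (cong₂ _+_ eq (degreeIn-⋃ diss eqs))

  -- Removing a common part from edge sets with equal degrees leaves edge sets with equal degrees.
  regular-⋃ : ∀ r (U : Subset n) Z Ps → .{{NonZero r}} → length Ps ≡ r → AllPairs Disjoint Ps →
              All (λ P → Sub.Nonempty P × ∃ λ S → (∀ v → degreeIn E S v ≡ 𝟙 (v ∈? U)) × Z ⊆ S × P ≡ S ─ Z) Ps →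
              RegularSub r E (Sub.⋃ Ps)
  regular-⋃ r U Z Ps len dis props = nonempty len props , regular
    where
    nonempty : ∀ {Ps} → length Ps ≡ r → All (λ P → Sub.Nonempty P × _) Ps → Sub.Nonempty (Sub.⋃ Ps)
    nonempty {[]} eq _ = contradiction (sym eq) (≢-nonZero⁻¹ r)
    nonempty {P ∷ Ps} _ (((e , e∈P) , _) ∷ _) = e , p⊆p∪q (Sub.⋃ Ps) e∈P
    -- `Z ⊆ S` makes the truncated subtraction exact. The value depends on `v`, `U` and `Z` but not
    -- on the petal.
    petal-degree : ∀ v {P} → (Sub.Nonempty P × ∃ λ S → (∀ v → degreeIn E S v ≡ 𝟙 (v ∈? U)) × Z ⊆ S × P ≡ S ─ Z) →
                   degreeIn E P v ≡ 𝟙 (v ∈? U) ∸ degreeIn E Z v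
    petal-degree v (_ , S , deg , Z⊆S , refl) = begin
      degreeIn E (S ─ Z) v
        ≡⟨ sym (m+n∸m≡n (degreeIn E Z v) _) ⟩
      degreeIn E Z v + degreeIn E (S ─ Z) v ∸ degreeIn E Z v
        ≡⟨ cong (_∸ degreeIn E Z v) (sym (degreeIn-∪ Z (S ─ Z) (λ h h′ → ∈─⇒∉ {p = S} h′ h) v)) ⟩
      degreeIn E (Z ∪ (S ─ Z)) v ∸ degreeIn E Z v
        ≡⟨ cong (λ S → degreeIn E S v ∸ degreeIn E Z v) (⊆-antisym join split) ⟩
      degreeIn E S v ∸ degreeIn E Z v ≡⟨ cong (_∸ degreeIn E Z v) (deg v) ⟩
      𝟙 (v ∈? U) ∸ degreeIn E Z v ∎
      where
      open ≡-Reasoning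
      join : Z ∪ (S ─ Z) ⊆ S
      join h = [ Z⊆S , (λ h → p─q⊆p S Z h) ]′ (x∈p∪q⁻ Z (S ─ Z) h)
      split : S ⊆ Z ∪ (S ─ Z)
      split {x} h with x ∈? Z
      ... | yes x∈Z = p⊆p∪q (S ─ Z) x∈Z
      ... | no x∉Z  = q⊆p∪q Z (S ─ Z) (x∈p∧x∉q⇒x∈p─q h x∉Z)
    regular : ∀ v → Covered E (Sub.⋃ Ps) v → degreeIn E (Sub.⋃ Ps) v ≡ r
    regular v cov = finish (𝟙 (v ∈? U) ∸ degreeIn E Z v) (≤-trans (m∸n≤m _ (degreeIn E Z v)) (𝟙≤1 (v ∈? U)))
      (trans (degreeIn-⋃ dis (All.map (petal-degree v) props)) (cong (_* _) len))
      where
      -- A covered vertex has positive degree in the union, which excludes `d = 0`; the common petal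
      -- degree is at most 1, which leaves `d = 1`.
      finish : ∀ d → d ≤ 1 → degreeIn E (Sub.⋃ Ps) v ≡ r * d → degreeIn E (Sub.⋃ Ps) v ≡ r
      finish zero    _ eq = contradiction (covered⇒degreeIn>0 cov) (<⇒≱ (≤-reflexive (cong suc (trans eq (*-zeroʳ r)))))
      finish (suc zero) _ eq = trans eq (*-identityʳ r)
      finish (suc (suc d)) (s≤s ()) eq

module Matchings {n m : ℕ} (E : Edges n m) (k : ℕ) (uniform : Uniform k E) (k>0 : 0 < k)
                 {H : Fin m → Set} (H? : Decidable H)
                 (D : ℕ) (deg≤D : ∀ v → ∑ (allFin m) (λ e → 𝟙 (H? e) * 𝟙 (v ∈? E e)) ≤ D) where

  open Degree E

  #H : ℕ
  #H = ∑ (allFin m) λ e → 𝟙 (H? e)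

  Tuple : ℕ → Set
  Tuple = Vec (Fin m)

  tuples : ∀ t → List (Tuple t)
  tuples = allVecs (allFin m)

  eset : ∀ {t} → Tuple t → Subset m
  eset []      = ⊥
  eset (e ∷ τ) = ⁅ e ⁆ ∪ eset τ

  vset : ∀ {t} → Tuple t → Subset n
  vset []      = ⊥
  vset (e ∷ τ) = E e ∪ vset τ

  Meets : Fin m → Subset n → Set
  Meets e U = Sub.Nonempty (E e ∩ U)

  meets? : ∀ e U → Dec (Meets e U)
  meets? e U = nonempty? (E e ∩ U)

  data Matching : ∀ {t} → Tuple t → Set where
    []  : Matching []
    _∷_ : ∀ {t e} {τ : Tuple t} → H e × ¬ Meets e (vset τ) → Matching τ → Matching (e ∷ τ)

  matching? : ∀ {t} (τ : Tuple t) → Dec (Matching τ)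
  matching? []      = yes []
  matching? (e ∷ τ) = map′ (λ (h , M) → h ∷ M) (λ { (h ∷ M) → h , M })
    ((H? e ×-dec ¬? (meets? e (vset τ))) ×-dec matching? τ)

  ¬meets⇒disjoint : ∀ {e U} → ¬ Meets e U → Disjoint (E e) U
  ¬meets⇒disjoint ¬meets h h′ = ¬meets (_ , x∈p∩q⁺ (h , h′))

  edge⊆vset : ∀ {t} {e} (τ : Tuple t) → e ∈ eset τ → E e ⊆ vset τ
  edge⊆vset []      e∈ = contradiction e∈ ∉⊥
  edge⊆vset {e = e} (e′ ∷ τ) e∈ h with x∈p∪q⁻ ⁅ e′ ⁆ (eset τ) e∈
  ... | inj₁ e∈⁅⁆ = p⊆p∪q (vset τ) (subst (λ e → _ ∈ E e) (x∈⁅y⁆⇒x≡y e′ e∈⁅⁆) h)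
  ... | inj₂ e∈τ  = q⊆p∪q (E e′) (vset τ) (edge⊆vset τ e∈τ h)

  edge-nonempty : ∀ e → Sub.Nonempty (E e)
  edge-nonempty e = ∣∣>0⇒nonempty (≤-trans k>0 (≤-reflexive (sym (uniform e))))

  fresh-edge : ∀ {t e} (τ : Tuple t) → ¬ Meets e (vset τ) → Disjoint ⁅ e ⁆ (eset τ)
  fresh-edge {e = e} τ ¬meets h h′ with refl ← x∈⁅y⁆⇒x≡y e h with v , v∈ ← edge-nonempty e =
    ¬meets⇒disjoint ¬meets v∈ (edge⊆vset τ h′ v∈)

  ∣eset∣ : ∀ {t} {τ : Tuple t} → Matching τ → ∣ eset τ ∣ ≡ t
  ∣eset∣ [] = ∣⊥∣≡0 m
  ∣eset∣ {τ = e ∷ τ} ((_ , ¬meets) ∷ M) =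
    trans (∣∪∣-disjoint ⁅ e ⁆ (eset τ) (fresh-edge τ ¬meets)) (cong₂ _+_ (∣⁅x⁆∣≡1 e) (∣eset∣ M))

  ∣vset∣ : ∀ {t} {τ : Tuple t} → Matching τ → ∣ vset τ ∣ ≡ t * k
  ∣vset∣ [] = ∣⊥∣≡0 n
  ∣vset∣ {τ = e ∷ τ} ((_ , ¬meets) ∷ M) =
    trans (∣∪∣-disjoint (E e) (vset τ) (¬meets⇒disjoint ¬meets)) (cong₂ _+_ (uniform e) (∣vset∣ M))

  degreeIn-eset : ∀ {t} {τ : Tuple t} → Matching τ → ∀ v → degreeIn E (eset τ) v ≡ 𝟙 (v ∈? vset τ)
  degreeIn-eset [] v = trans (degreeIn-⊥ v) (sym (𝟙-no (v ∈? ⊥) ∉⊥))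
  degreeIn-eset {τ = e ∷ τ} ((_ , ¬meets) ∷ M) v = begin
    degreeIn E (⁅ e ⁆ ∪ eset τ) v                 ≡⟨ degreeIn-∪ ⁅ e ⁆ (eset τ) (fresh-edge τ ¬meets) v ⟩
    degreeIn E ⁅ e ⁆ v + degreeIn E (eset τ) v    ≡⟨ cong₂ _+_ (degreeIn-⁅⁆ e v) (degreeIn-eset M v) ⟩
    𝟙 (v ∈? E e) + 𝟙 (v ∈? vset τ)                ≡⟨ sym (𝟙-∪ (E e) (vset τ) (¬meets⇒disjoint ¬meets) v) ⟩
    𝟙 (v ∈? (E e ∪ vset τ)) ∎
    where open ≡-Reasoning

  -- Every entry of such a tuple is an element of `Z`. For `∣ Z ∣ ≡ t` this pays for the orders of
  -- one matching with `t ^ t`.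
  multiplicity : ∀ t Z → ∑ (tuples t) (λ τ → 𝟙 (eset τ ⊆? Z)) ≤ ∣ Z ∣ ^ t
  multiplicity zero    Z = ≤-trans (≤-reflexive (+-identityʳ _)) (𝟙≤1 (eset [] ⊆? Z))
  multiplicity (suc t) Z = begin
    ∑ (tuples (suc t)) (λ τ → 𝟙 (eset τ ⊆? Z))
      ≡⟨ ∑-allVecs (allFin m) t _ ⟩
    ∑ (allFin m) (λ e → ∑ (tuples t) λ τ → 𝟙 ((⁅ e ⁆ ∪ eset τ) ⊆? Z))
      ≤⟨ ∑-mono (allFin m) (λ e → ∑-mono (tuples t) (λ τ → 𝟙-case ((⁅ e ⁆ ∪ eset τ) ⊆? Z) (λ sub → ≤-reflexive (sym (cong₂ _*_
           (𝟙-yes (e ∈? Z) (sub (p⊆p∪q (eset τ) (x∈⁅x⁆ e))))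
           (𝟙-yes (eset τ ⊆? Z) (λ h → sub (q⊆p∪q ⁅ e ⁆ (eset τ) h)))))))) ⟩
    ∑ (allFin m) (λ e → ∑ (tuples t) λ τ → 𝟙 (e ∈? Z) * 𝟙 (eset τ ⊆? Z))
      ≡⟨ ∑-cong (allFin m) (λ e → ∑-*ˡ (tuples t) (𝟙 (e ∈? Z)) _) ⟩
    ∑ (allFin m) (λ e → 𝟙 (e ∈? Z) * ∑ (tuples t) λ τ → 𝟙 (eset τ ⊆? Z))
      ≡⟨ ∑-*ʳ (allFin m) (λ e → 𝟙 (e ∈? Z)) _ ⟩
    ∑ (allFin m) (λ e → 𝟙 (e ∈? Z)) * ∑ (tuples t) (λ τ → 𝟙 (eset τ ⊆? Z))
      ≤⟨ *-mono-≤ (≤-reflexive (sym (∣∣≡∑ Z))) (multiplicity t Z) ⟩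
    ∣ Z ∣ * ∣ Z ∣ ^ t ∎
    where open ≤-Reasoning

  #matchings : ℕ → ℕ
  #matchings t = ∑ (tuples t) λ τ → 𝟙 (matching? τ)

  blocked : ∀ U → ∑ (allFin m) (λ e → 𝟙 (H? e) * 𝟙 (meets? e U)) ≤ ∣ U ∣ * D
  blocked U = begin
    ∑ (allFin m) (λ e → 𝟙 (H? e) * 𝟙 (meets? e U))
      ≤⟨ ∑-mono (allFin m) (λ e → *-monoʳ-≤ (𝟙 (H? e)) (𝟙-case (meets? e U) (λ (v , v∈) →
           ≤-trans (≤-reflexive (sym (cong₂ _*_ (𝟙-yes (v ∈? U) (proj₂ (x∈p∩q⁻ (E e) U v∈))) (𝟙-yes (v ∈? E e) (proj₁ (x∈p∩q⁻ (E e) U v∈))))))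
             (term≤∑ (λ v → 𝟙 (v ∈? U) * 𝟙 (v ∈? E e)) (∈-allFin v))))) ⟩
    ∑ (allFin m) (λ e → 𝟙 (H? e) * ∑ (allFin n) (λ v → 𝟙 (v ∈? U) * 𝟙 (v ∈? E e)))
      ≡⟨ ∑-cong (allFin m) (λ e → sym (∑-*ˡ (allFin n) (𝟙 (H? e)) _)) ⟩
    ∑ (allFin m) (λ e → ∑ (allFin n) (λ v → 𝟙 (H? e) * (𝟙 (v ∈? U) * 𝟙 (v ∈? E e))))
      ≡⟨ ∑-swap (allFin m) (allFin n) _ ⟩
    ∑ (allFin n) (λ v → ∑ (allFin m) (λ e → 𝟙 (H? e) * (𝟙 (v ∈? U) * 𝟙 (v ∈? E e))))
      ≡⟨ ∑-cong (allFin n) (λ v → trans (∑-cong (allFin m) (λ e → swap* (𝟙 (H? e)) (𝟙 (v ∈? U)) (𝟙 (v ∈? E e))))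
           (∑-*ˡ (allFin m) (𝟙 (v ∈? U)) (λ e → 𝟙 (H? e) * 𝟙 (v ∈? E e)))) ⟩
    ∑ (allFin n) (λ v → 𝟙 (v ∈? U) * ∑ (allFin m) (λ e → 𝟙 (H? e) * 𝟙 (v ∈? E e)))
      ≤⟨ ∑-mono (allFin n) (λ v → *-monoʳ-≤ (𝟙 (v ∈? U)) (deg≤D v)) ⟩
    ∑ (allFin n) (λ v → 𝟙 (v ∈? U) * D)
      ≡⟨ trans (∑-*ʳ (allFin n) (λ v → 𝟙 (v ∈? U)) D) (cong (_* D) (sym (∣∣≡∑ U))) ⟩
    ∣ U ∣ * D ∎
    where
    open ≤-Reasoning
    swap* : ∀ x y z → x * (y * z) ≡ y * (x * z)
    swap* = solve 3 (λ x y z → x :* (y :* z) := y :* (x :* z)) refl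
      where open +-*-Solver

  -- A matching of size `t` covers `t * k` vertices, which block at most `t * k * D` edges of `H`,
  -- by assumption at most half of them. The other half extends it.
  extend : ∀ t → 2 * (t * k * D) ≤ #H → #H * #matchings t ≤ 2 * #matchings (suc t)
  extend t small = begin
    #H * #matchings t ≡⟨ sym (∑-*ˡ (tuples t) #H _) ⟩
    ∑ (tuples t) (λ τ → #H * 𝟙 (matching? τ))
      ≤⟨ ∑-mono (tuples t) per-tuple ⟩
    ∑ (tuples t) (λ τ → 2 * ∑ (allFin m) (λ e → 𝟙 (matching? (e ∷ τ))))
      ≡⟨ ∑-*ˡ (tuples t) 2 _ ⟩
    2 * ∑ (tuples t) (λ τ → ∑ (allFin m) (λ e → 𝟙 (matching? (e ∷ τ))))
      ≡⟨ cong (2 *_) (trans (∑-swap (tuples t) (allFin m) (λ τ e → 𝟙 (matching? (e ∷ τ)))) (sym (∑-allVecs (allFin m) t _))) ⟩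
    2 * #matchings (suc t) ∎
    where
    open ≤-Reasoning
    free : Tuple t → ℕ
    free τ = ∑ (allFin m) λ e → 𝟙 (H? e) * 𝟙 (¬? (meets? e (vset τ)))
    half : ∀ {τ} → Matching τ → #H ≤ 2 * free τ
    half {τ} M = +-cancelʳ-≤ #H #H (2 * free τ) (begin
      #H + #H ≡⟨ cong (#H +_) (sym (+-identityʳ #H)) ⟩
      2 * #H ≤⟨ *-monoʳ-≤ 2 (≤-trans (∑-mono (allFin m) dichotomy) (≤-reflexive (∑-+ (allFin m) _ _))) ⟩
      2 * (free τ + ∑ (allFin m) (λ e → 𝟙 (H? e) * 𝟙 (meets? e (vset τ))))
        ≤⟨ *-monoʳ-≤ 2 (+-monoʳ-≤ (free τ) (≤-trans (blocked (vset τ)) (≤-reflexive (cong (_* D) (∣vset∣ M))))) ⟩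
      2 * (free τ + t * k * D) ≡⟨ *-distribˡ-+ 2 (free τ) (t * k * D) ⟩
      2 * free τ + 2 * (t * k * D) ≤⟨ +-monoʳ-≤ (2 * free τ) small ⟩
      2 * free τ + #H ∎)
      where
      dichotomy : ∀ e → 𝟙 (H? e) ≤ 𝟙 (H? e) * 𝟙 (¬? (meets? e (vset τ))) + 𝟙 (H? e) * 𝟙 (meets? e (vset τ))
      dichotomy e with H? e | meets? e (vset τ)
      ... | no _  | _     = z≤n
      ... | yes _ | yes _ = ≤-refl
      ... | yes _ | no _  = ≤-refl
    per-tuple : ∀ τ → #H * 𝟙 (matching? τ) ≤ 2 * ∑ (allFin m) (λ e → 𝟙 (matching? (e ∷ τ)))
    per-tuple τ = ≤-trans (≤-reflexive (*-comm #H _)) (𝟙-bound (matching? τ) (λ M → ≤-trans (half M)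
      (*-monoʳ-≤ 2 (∑-mono (allFin m) (λ e → 𝟙-bound (H? e) (λ h → 𝟙-mono (¬? (meets? e (vset τ))) (matching? (e ∷ τ)) (λ ¬meets → (h , ¬meets) ∷ M)))))))

  #matchings-≥ : ∀ t → 2 * (t * k * D) ≤ #H → #H ^ t ≤ 2 ^ t * #matchings t
  #matchings-≥ zero    small = s≤s z≤n
  #matchings-≥ (suc t) small = begin
    #H * #H ^ t                     ≤⟨ *-monoʳ-≤ #H (#matchings-≥ t small′) ⟩
    #H * (2 ^ t * #matchings t)     ≡⟨ solve 3 (λ x y z → x :* (y :* z) := y :* (x :* z)) refl #H (2 ^ t) (#matchings t) ⟩
    2 ^ t * (#H * #matchings t)     ≤⟨ *-monoʳ-≤ (2 ^ t) (extend t small′) ⟩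
    2 ^ t * (2 * #matchings (suc t)) ≡⟨ solve 2 (λ y z → y :* (con 2 :* z) := con 2 :* y :* z) refl (2 ^ t) (#matchings (suc t)) ⟩
    2 ^ suc t * #matchings (suc t) ∎
    where
    open ≤-Reasoning
    open +-*-Solver
    small′ : 2 * (t * k * D) ≤ #H
    small′ = ≤-trans (*-monoʳ-≤ 2 (*-monoˡ-≤ D (*-monoˡ-≤ k (n≤1+n t)))) small

-- Matchings on a common vertex set

prod : Vec ℕ N → ℕ
prod []       = 1
prod (y ∷ ys) = y * prod ys

prodIn : Vec ℕ N → Subset N → ℕ
prodIn []       []          = 1
prodIn (y ∷ ys) (true ∷ U)  = y * prodIn ys U
prodIn (y ∷ ys) (false ∷ U) = prodIn ys U

-- Up to the common factor `prod ys` this gives `U` the weight ∏ 1/y over its vertices, with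
-- denominators cleared.
prodOut : Vec ℕ N → Subset N → ℕ
prodOut []       []          = 1
prodOut (y ∷ ys) (true ∷ U)  = prodOut ys U
prodOut (y ∷ ys) (false ∷ U) = y * prodOut ys U

prodOut*prodIn : (ys : Vec ℕ N) (U : Subset N) → prodOut ys U * prodIn ys U ≡ prod ys
prodOut*prodIn []       []          = refl
prodOut*prodIn (y ∷ ys) (true ∷ U)  = trans
  (solve 3 (λ y s t → s :* (y :* t) := y :* (s :* t)) refl y (prodOut ys U) (prodIn ys U))
  (cong (y *_) (prodOut*prodIn ys U))
  where open +-*-Solver
prodOut*prodIn (y ∷ ys) (false ∷ U) = trans (*-assoc y _ _) (cong (y *_) (prodOut*prodIn ys U))

prodIn-⊥ : (ys : Vec ℕ N) → prodIn ys ⊥ ≡ 1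
prodIn-⊥ []       = refl
prodIn-⊥ (y ∷ ys) = prodIn-⊥ ys

prodIn-∪ : (ys : Vec ℕ N) (U V : Subset N) → Disjoint U V → prodIn ys (U ∪ V) ≡ prodIn ys U * prodIn ys V
prodIn-∪ []       []          []          dis = refl
prodIn-∪ (y ∷ ys) (true ∷ U)  (true ∷ V)  dis = contradiction here (dis here)
prodIn-∪ (y ∷ ys) (true ∷ U)  (false ∷ V) dis =
  trans (cong (y *_) (prodIn-∪ ys U V (λ h h′ → dis (there h) (there h′)))) (sym (*-assoc y _ _))
prodIn-∪ (y ∷ ys) (false ∷ U) (true ∷ V)  dis = trans
  (cong (y *_) (prodIn-∪ ys U V (λ h h′ → dis (there h) (there h′))))
  (solve 3 (λ y s t → y :* (s :* t) := s :* (y :* t)) refl y (prodIn ys U) (prodIn ys V))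
  where open +-*-Solver
prodIn-∪ (y ∷ ys) (false ∷ U) (false ∷ V) dis = prodIn-∪ ys U V (λ h h′ → dis (there h) (there h′))

subsets : ∀ n → List (Subset n)
subsets = allVecs (true ∷ false ∷ [])

∈-sides : ∀ b → b ∈ₗ (true ∷ false ∷ [])
∈-sides true  = here refl
∈-sides false = there (here refl)

-- Expansion of ∏ (1 + y): a vertex contributes 1 when it is in `U` and its `y` otherwise. This
-- generating function stands in for binomial estimates of the number of vertex sets.
∑-prodOut : (ys : Vec ℕ N) → ∑ (subsets N) (prodOut ys) ≡ prod (Vec.map suc ys)
∑-prodOut []       = refl
∑-prodOut {suc n} (y ∷ ys) = begin
  ∑ (subsets (suc n)) (prodOut (y ∷ ys))   ≡⟨ ∑-allVecs (true ∷ false ∷ []) n (prodOut (y ∷ ys)) ⟩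
  Σ₁ + (Σ₂ + 0)                            ≡⟨ cong (Σ₁ +_) (trans (+-identityʳ Σ₂) (∑-*ˡ (subsets n) y (prodOut ys))) ⟩
  Σ₁ + y * Σ₁                              ≡⟨ cong (suc y *_) (∑-prodOut ys) ⟩
  suc y * prod (Vec.map suc ys) ∎
  where
  open ≡-Reasoning
  Σ₁ = ∑ (subsets n) (prodOut ys)
  Σ₂ = ∑ (subsets n) (λ U → y * prodOut ys U)

module Popular {n m : ℕ} (E : Edges n m) (k : ℕ) (uniform : Uniform k E) (k>0 : 0 < k)
               {H : Fin m → Set} (H? : Decidable H)
               (D : ℕ) (deg≤D : ∀ v → ∑ (allFin m) (λ e → 𝟙 (H? e) * 𝟙 (v ∈? E e)) ≤ D)
               (ys : Vec ℕ n) (cost : ℕ) (cost-≥ : ∀ e → H e → prodIn ys (E e) ≤ cost) where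

  open Matchings E k uniform k>0 H? D deg≤D
  open Degree E

  MatchingOn : ∀ {t} → Subset n → Tuple t → Set
  MatchingOn U τ = Matching τ × vset τ ≡ U

  matchingOn? : ∀ {t} U → Decidable (MatchingOn {t} U)
  matchingOn? U τ = matching? τ ×-dec Vec.≡-dec Bool._≟_ (vset τ) U

  #on : ℕ → Subset n → ℕ
  #on t U = ∑ (tuples t) λ τ → 𝟙 (matchingOn? U τ)

  prodIn-vset : ∀ {t} {τ : Tuple t} → Matching τ → prodIn ys (vset τ) ≤ cost ^ t
  prodIn-vset [] = ≤-reflexive (prodIn-⊥ ys)
  prodIn-vset {τ = e ∷ τ} ((h , ¬meets) ∷ M) = ≤-trans
    (≤-reflexive (prodIn-∪ ys (E e) (vset τ) (¬meets⇒disjoint ¬meets)))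
    (*-mono-≤ (cost-≥ e h) (prodIn-vset M))

  -- `prod ys` splits into the parts inside and outside the vertex set of a matching. The inner part
  -- is at most `cost ^ t`, because the edges are disjoint; the outer part is the weight of the
  -- vertex set.
  weigh : ∀ t → #matchings t * prod ys ≤ cost ^ t * ∑ (subsets n) (λ U → prodOut ys U * #on t U)
  weigh t = begin
    #matchings t * prod ys ≡⟨ sym (∑-*ʳ (tuples t) (λ τ → 𝟙 (matching? τ)) (prod ys)) ⟩
    ∑ (tuples t) (λ τ → 𝟙 (matching? τ) * prod ys)
      ≤⟨ ∑-mono (tuples t) (λ τ → 𝟙-bound (matching? τ) (per-matching τ)) ⟩
    ∑ (tuples t) (λ τ → cost ^ t * ∑ (subsets n) (λ U → prodOut ys U * 𝟙 (matchingOn? U τ)))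
      ≡⟨ ∑-*ˡ (tuples t) (cost ^ t) _ ⟩
    cost ^ t * ∑ (tuples t) (λ τ → ∑ (subsets n) (λ U → prodOut ys U * 𝟙 (matchingOn? U τ)))
      ≡⟨ cong (cost ^ t *_) (trans (∑-swap (tuples t) (subsets n) (λ τ U → prodOut ys U * 𝟙 (matchingOn? U τ)))
           (∑-cong (subsets n) (λ U → ∑-*ˡ (tuples t) (prodOut ys U) (λ τ → 𝟙 (matchingOn? U τ))))) ⟩
    cost ^ t * ∑ (subsets n) (λ U → prodOut ys U * #on t U) ∎
    where
    open ≤-Reasoning
    per-matching : ∀ (τ : Tuple t) → Matching τ →
      prod ys ≤ cost ^ t * ∑ (subsets n) (λ U → prodOut ys U * 𝟙 (matchingOn? U τ))
    per-matching τ M = begin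
      prod ys ≡⟨ sym (prodOut*prodIn ys (vset τ)) ⟩
      prodOut ys (vset τ) * prodIn ys (vset τ) ≤⟨ *-monoʳ-≤ (prodOut ys (vset τ)) (prodIn-vset M) ⟩
      prodOut ys (vset τ) * cost ^ t ≡⟨ *-comm (prodOut ys (vset τ)) (cost ^ t) ⟩
      cost ^ t * prodOut ys (vset τ)
        ≡⟨ cong (cost ^ t *_) (sym (trans (cong (prodOut ys (vset τ) *_) (𝟙-yes (matchingOn? (vset τ) τ) (M , refl))) (*-identityʳ _))) ⟩
      cost ^ t * (prodOut ys (vset τ) * 𝟙 (matchingOn? (vset τ) τ))
        ≤⟨ *-monoʳ-≤ (cost ^ t) (term≤∑-allVecs _ ∈-sides (λ U → prodOut ys U * 𝟙 (matchingOn? U τ)) (vset τ)) ⟩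
      cost ^ t * ∑ (subsets n) (λ U → prodOut ys U * 𝟙 (matchingOn? U τ)) ∎

  -- If every vertex set carried at most (tR)^t matchings, `weigh` would bound their number by (64
  -- `cost` t R)^t, while the greedy count gives at least (`#H` / 2)^t. The hypothesis `large`
  -- contradicts this base against base.
  popular : ∀ t R → .{{_ : NonZero t}} → 2 * (t * k * D) ≤ #H → 0 < prod ys → prod (Vec.map suc ys) ≤ 64 ^ t * prod ys →
            2 * (cost * (64 * (t * R))) < #H → ∃ λ U → t ^ t * R ^ t < #on t U
  popular t R small ys>0 ys-suc large with anySubset? (λ U → t ^ t * R ^ t <? #on t U)
  ... | yes found = found
  ... | no none   = contradiction (*-cancelʳ-≤ (#H ^ t) (X ^ t) (prod ys) {{>-nonZero ys>0}} few) (<⇒≱ (^-monoˡ-< t large))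
    where
    open ≤-Reasoning
    X = 2 * (cost * (64 * (t * R)))
    B = t ^ t * R ^ t
    few : #H ^ t * prod ys ≤ X ^ t * prod ys
    few = begin
      #H ^ t * prod ys ≤⟨ *-monoˡ-≤ (prod ys) (#matchings-≥ t small) ⟩
      2 ^ t * #matchings t * prod ys ≡⟨ *-assoc (2 ^ t) (#matchings t) (prod ys) ⟩
      2 ^ t * (#matchings t * prod ys) ≤⟨ *-monoʳ-≤ (2 ^ t) (weigh t) ⟩
      2 ^ t * (cost ^ t * ∑ (subsets n) (λ U → prodOut ys U * #on t U))
        ≤⟨ *-monoʳ-≤ (2 ^ t) (*-monoʳ-≤ (cost ^ t) (∑-mono (subsets n) (λ U →
             *-monoʳ-≤ (prodOut ys U) (≮⇒≥ (λ lt → none (U , lt)))))) ⟩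
      2 ^ t * (cost ^ t * ∑ (subsets n) (λ U → prodOut ys U * B))
        ≡⟨ cong (λ z → 2 ^ t * (cost ^ t * z)) (trans (∑-*ʳ (subsets n) (prodOut ys) B) (cong (_* B) (∑-prodOut ys))) ⟩
      2 ^ t * (cost ^ t * (prod (Vec.map suc ys) * B))
        ≤⟨ *-monoʳ-≤ (2 ^ t) (*-monoʳ-≤ (cost ^ t) (*-monoˡ-≤ B ys-suc)) ⟩
      2 ^ t * (cost ^ t * (64 ^ t * prod ys * B))
        ≡⟨ solve 5 (λ a c s p b → a :* (c :* (s :* p :* b)) := a :* (c :* (s :* b)) :* p) refl (2 ^ t) (cost ^ t) (64 ^ t) (prod ys) B ⟩
      2 ^ t * (cost ^ t * (64 ^ t * (t ^ t * R ^ t))) * prod ys ≡⟨ cong (_* prod ys) (sym X^t) ⟩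
      X ^ t * prod ys ∎
      where
      open +-*-Solver
      X^t : X ^ t ≡ 2 ^ t * (cost ^ t * (64 ^ t * (t ^ t * R ^ t)))
      X^t = trans (^-distribʳ-* t 2 (cost * (64 * (t * R)))) (cong (2 ^ t *_)
        (trans (^-distribʳ-* t cost (64 * (t * R))) (cong (cost ^ t *_)
        (trans (^-distribʳ-* t 64 (t * R)) (cong (64 ^ t *_) (^-distribʳ-* t t R))))))

  -- `F` has one entry per ordered matching, so an edge set recurs in several orders; the sunflower
  -- lemma absorbs this through its multiplicity `t ^ t`. All entries cover the same `U`, hence have
  -- equal degrees.
  regular-from-popular : ∀ t R r a ℓ .{{_ : NonZero t}} .{{_ : NonZero R}} .{{_ : NonZero r}} .{{_ : NonZero a}} .{{_ : NonZero ℓ}} →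
    (∃ λ U → t ^ t * R ^ t < #on t U) → R ≡ 16 * (2 * r * (a * ℓ)) → R ≤ 2 ^ ℓ → t < 2 ^ a →
    ∃ λ S → RegularSub r E S
  regular-from-popular t R r a ℓ (U , many) R≡ R≤ t<2^a = assemble
    (Sunflower.sunflower F t (t ^ t) R ∣S∣≡t mult (<-≤-trans many (≤-reflexive (sym length-F))) r a ℓ R≡ R≤ t<2^a)
    where
    F : List (Subset m)
    F = List.map eset (filter (matchingOn? U) (tuples t))
    length-F : length F ≡ #on t U
    length-F = trans (List.length-map eset (filter (matchingOn? U) (tuples t))) (length-filter≡∑ (matchingOn? U) (tuples t))
    ∈-F : ∀ {S} → S ∈ₗ F → ∃ λ τ → MatchingOn U τ × S ≡ eset τ
    ∈-F S∈ with τ , τ∈ , eq ← ∈-map⁻ eset S∈ = τ , proj₂ (∈-filter⁻ (matchingOn? U) {xs = tuples t} τ∈) , eq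
    ∣S∣≡t : ∀ {S} → S ∈ₗ F → ∣ S ∣ ≡ t
    ∣S∣≡t S∈ with τ , (M , _) , refl ← ∈-F S∈ = ∣eset∣ M
    mult : ∀ Z → ∣ Z ∣ ≡ t → ∑ F (λ S → 𝟙 (S ⊆? Z)) ≤ t ^ t
    mult Z ∣Z∣≡t = begin
      ∑ F (λ S → 𝟙 (S ⊆? Z))
        ≡⟨ trans (∑-map eset (filter (matchingOn? U) (tuples t)) _) (∑-filter (matchingOn? U) (tuples t) _) ⟩
      ∑ (tuples t) (λ τ → 𝟙 (matchingOn? U τ) * 𝟙 (eset τ ⊆? Z))
        ≤⟨ ∑-mono (tuples t) (λ τ → 𝟙-bound (matchingOn? U τ) (λ _ → ≤-refl)) ⟩
      ∑ (tuples t) (λ τ → 𝟙 (eset τ ⊆? Z)) ≤⟨ multiplicity t Z ⟩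
      ∣ Z ∣ ^ t ≡⟨ cong (_^ t) ∣Z∣≡t ⟩
      t ^ t ∎
      where open ≤-Reasoning
    degrees : ∀ {S} → S ∈ₗ F → ∀ v → degreeIn E S v ≡ 𝟙 (v ∈? U)
    degrees S∈ v with τ , (M , refl) , refl ← ∈-F S∈ = degreeIn-eset M v
    assemble : Sunflower.Sunflower F t (t ^ t) R ∣S∣≡t mult (<-≤-trans many (≤-reflexive (sym length-F))) r →
               ∃ λ S → RegularSub r E S
    assemble (Z , Ps , len , dis , props) = Sub.⋃ Ps , regular-⋃ r U Z Ps len dis
      (All.map (λ (ne , S , S∈F , Z⊆S , eq) → ne , S , degrees S∈F , (λ {x} → Z⊆S {x}) , eq) props)

-- Vertex weights and powers

-- The estimate (1 + 1/y)^j ≤ 1/(1 - j/y) without division; the induction step is (y + 1) d ≤ y (d +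
-- 1) for d ≤ y.
suc^-*-≤ : ∀ y j d → j + d ≡ y → suc y ^ j * d ≤ y ^ suc j
suc^-*-≤ y zero    d refl = ≤-reflexive (trans (*-identityˡ d) (sym (*-identityʳ d)))
suc^-*-≤ y (suc j) d eq   = begin
  suc y * suc y ^ j * d    ≡⟨ solve 3 (λ a x d → a :* x :* d := x :* (a :* d)) refl (suc y) (suc y ^ j) d ⟩
  suc y ^ j * (suc y * d)  ≤⟨ *-monoʳ-≤ (suc y ^ j) (+-mono-≤ (m+n≤o⇒n≤o (suc j) (≤-reflexive eq)) (≤-refl {y * d})) ⟩
  suc y ^ j * (y + y * d)  ≡⟨ solve 3 (λ x y d → x :* (y :+ y :* d) := y :* (x :* (con 1 :+ d))) refl (suc y ^ j) y d ⟩
  y * (suc y ^ j * suc d)  ≤⟨ *-monoʳ-≤ y (suc^-*-≤ y j (suc d) (trans (+-suc j d) eq)) ⟩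
  y * y ^ suc j ∎
  where
  open ≤-Reasoning
  open +-*-Solver

suc^≤2*^ : ∀ y j → .{{_ : NonZero y}} → j + j ≤ y → suc y ^ j ≤ 2 * y ^ j
suc^≤2*^ y j 2j≤y = *-cancelʳ-≤ (suc y ^ j) (2 * y ^ j) y (begin
  suc y ^ j * y             ≤⟨ *-monoʳ-≤ (suc y ^ j) y≤2d ⟩
  suc y ^ j * (2 * d)       ≡⟨ solve 2 (λ x d → x :* (con 2 :* d) := con 2 :* (x :* d)) refl (suc y ^ j) d ⟩
  2 * (suc y ^ j * d)       ≤⟨ *-monoʳ-≤ 2 (suc^-*-≤ y j d j+d≡y) ⟩
  2 * (y * y ^ j)           ≡⟨ solve 2 (λ x y → con 2 :* (y :* x) := con 2 :* x :* y) refl (y ^ j) y ⟩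
  2 * y ^ j * y ∎)
  where
  open ≤-Reasoning
  open +-*-Solver
  d = y ∸ j
  j+d≡y : j + d ≡ y
  j+d≡y = m+[n∸m]≡n (m+n≤o⇒n≤o j 2j≤y)
  y≤2d : y ≤ 2 * d
  y≤2d = begin
    y         ≡⟨ sym j+d≡y ⟩
    j + d     ≤⟨ +-monoˡ-≤ d (+-cancelˡ-≤ j j d (≤-trans 2j≤y (≤-reflexive (sym j+d≡y)))) ⟩
    d + d     ≡⟨ cong (d +_) (sym (+-identityʳ d)) ⟩
    2 * d ∎

-- Two halves of the exponent and its parity bit contribute a factor 2 each. The bound 8 replaces e.
suc^≤8*^ : ∀ y s → .{{_ : NonZero y}} → s ≤ y → suc y ^ s ≤ 8 * y ^ s
suc^≤8*^ y s s≤y = begin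
  suc y ^ s                                  ≡⟨ cong (suc y ^_) s≡ ⟩
  suc y ^ (b + (h + h))                      ≡⟨ split (suc y) ⟩
  suc y ^ b * (suc y ^ h * suc y ^ h)        ≤⟨ *-mono-≤ (odd b (≤-pred (m%n<n s 2))) (*-mono-≤ half half) ⟩
  2 * y ^ b * (2 * y ^ h * (2 * y ^ h))      ≡⟨ solve 2 (λ u v → con 2 :* u :* (con 2 :* v :* (con 2 :* v)) := con 8 :* (u :* (v :* v))) refl (y ^ b) (y ^ h) ⟩
  8 * (y ^ b * (y ^ h * y ^ h))              ≡⟨ cong (8 *_) (sym (split y)) ⟩
  8 * y ^ (b + (h + h))                      ≡⟨ cong (λ s → 8 * y ^ s) (sym s≡) ⟩
  8 * y ^ s ∎
  where
  open ≤-Reasoning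
  open +-*-Solver
  b = s % 2
  h = s / 2
  s≡ : s ≡ b + (h + h)
  s≡ = trans (m≡m%n+[m/n]*n s 2) (cong (b +_) (trans (*-comm h 2) (cong (h +_) (+-identityʳ h))))
  split : ∀ z → z ^ (b + (h + h)) ≡ z ^ b * (z ^ h * z ^ h)
  split z = trans (^-distribˡ-+-* z b (h + h)) (cong (z ^ b *_) (^-distribˡ-+-* z h h))
  half : suc y ^ h ≤ 2 * y ^ h
  half = suc^≤2*^ y h (m+n≤o⇒n≤o b (≤-trans (≤-reflexive (sym s≡)) s≤y))
  odd : ∀ b → b ≤ 1 → suc y ^ b ≤ 2 * y ^ b
  odd zero    _ = s≤s z≤n
  odd (suc zero) _ = ≤-trans (≤-reflexive (*-identityʳ (suc y))) (≤-trans (+-monoˡ-≤ y (>-nonZero⁻¹ y))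
    (≤-reflexive (solve 1 (λ y → y :+ y := con 2 :* (y :* con 1)) refl y)))
  odd (suc (suc b)) (s≤s ())

-- Cut the exponent into at most `t` blocks of length at most `y`, each costing 8.
suc^≤8^* : ∀ y t s → .{{_ : NonZero y}} → s ≤ t * y → suc y ^ s ≤ 8 ^ t * y ^ s
suc^≤8^* y zero    zero _ = ≤-refl
suc^≤8^* y (suc t) s le with s ≤? y
... | yes s≤y = ≤-trans (suc^≤8*^ y s s≤y) (*-monoˡ-≤ (y ^ s) (m≤m*n 8 (8 ^ t) {{m^n≢0 8 t}}))
... | no s≰y  = begin
  suc y ^ s                              ≡⟨ split (suc y) ⟩
  suc y ^ y * suc y ^ (s ∸ y)            ≤⟨ *-mono-≤ (suc^≤8*^ y y ≤-refl) (suc^≤8^* y t (s ∸ y) (m≤n+o⇒m∸n≤o s y le)) ⟩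
  8 * y ^ y * (8 ^ t * y ^ (s ∸ y))      ≡⟨ solve 4 (λ a b c d → a :* b :* (c :* d) := a :* c :* (b :* d)) refl 8 (y ^ y) (8 ^ t) (y ^ (s ∸ y)) ⟩
  8 ^ suc t * (y ^ y * y ^ (s ∸ y))      ≡⟨ cong (8 ^ suc t *_) (sym (split y)) ⟩
  8 ^ suc t * y ^ s ∎
  where
  open ≤-Reasoning
  open +-*-Solver
  split : ∀ z → z ^ s ≡ z ^ y * z ^ (s ∸ y)
  split z = trans (cong (z ^_) (sym (m+[n∸m]≡n (<⇒≤ (≰⇒> s≰y))))) (^-distribˡ-+-* z y (s ∸ y))

weights : (x y : ℕ) → Subset N → Vec ℕ N
weights x y = Vec.map (λ b → if b then x else y)

prod-weights : ∀ x y (A : Subset N) → prod (weights x y A) ≡ x ^ ∣ A ∣ * y ^ ∣ Sub.∁ A ∣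
prod-weights x y []          = refl
prod-weights x y (true ∷ A)  = trans (cong (x *_) (prod-weights x y A)) (sym (*-assoc x _ _))
prod-weights x y (false ∷ A) = trans (cong (y *_) (prod-weights x y A))
  (solve 3 (λ y u v → y :* (u :* v) := u :* (y :* v)) refl y (x ^ ∣ A ∣) (y ^ ∣ Sub.∁ A ∣))
  where open +-*-Solver

suc-weights : ∀ x y (A : Subset N) → Vec.map suc (weights x y A) ≡ weights (suc x) (suc y) A
suc-weights x y []          = refl
suc-weights x y (true ∷ A)  = cong (suc x ∷_) (suc-weights x y A)
suc-weights x y (false ∷ A) = cong (suc y ∷_) (suc-weights x y A)

-- The vertices of `A` and the others cost `8 ^ t` each, which is where 64 comes from. The weights
-- are the average spacings: about `∣ A ∣ / t` on `A` and `N / t` elsewhere suffice.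
prod-suc-weights : ∀ x y t (A : Subset N) → .{{_ : NonZero x}} .{{_ : NonZero y}} → ∣ A ∣ ≤ t * x → N ≤ t * y →
                   prod (Vec.map suc (weights x y A)) ≤ 64 ^ t * prod (weights x y A)
prod-suc-weights x y t A ∣A∣≤ N≤ = begin
  prod (Vec.map suc (weights x y A))                 ≡⟨ trans (cong prod (suc-weights x y A)) (prod-weights (suc x) (suc y) A) ⟩
  suc x ^ ∣ A ∣ * suc y ^ ∣ Sub.∁ A ∣                ≤⟨ *-mono-≤ (suc^≤8^* x t ∣ A ∣ ∣A∣≤) (suc^≤8^* y t _ (≤-trans (∣p∣≤n (Sub.∁ A)) N≤)) ⟩
  8 ^ t * x ^ ∣ A ∣ * (8 ^ t * y ^ ∣ Sub.∁ A ∣)      ≡⟨ solve 3 (λ e u v → e :* u :* (e :* v) := e :* e :* (u :* v)) refl (8 ^ t) (x ^ ∣ A ∣) (y ^ ∣ Sub.∁ A ∣) ⟩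
  8 ^ t * 8 ^ t * (x ^ ∣ A ∣ * y ^ ∣ Sub.∁ A ∣)      ≡⟨ cong₂ _*_ (sym (^-distribʳ-* t 8 8)) (sym (prod-weights x y A)) ⟩
  64 ^ t * prod (weights x y A) ∎
  where
  open ≤-Reasoning
  open +-*-Solver

prod-weights>0 : ∀ x y (A : Subset N) → .{{_ : NonZero x}} .{{_ : NonZero y}} → 0 < prod (weights x y A)
prod-weights>0 x y A = ≤-trans (*-mono-≤ (m^n>0 x ∣ A ∣) (m^n>0 y ∣ Sub.∁ A ∣)) (≤-reflexive (sym (prod-weights x y A)))

prodIn-weights : ∀ {x y} (A U : Subset N) → x ≤ y → prodIn (weights x y A) U ≤ y ^ ∣ U ∣
prodIn-weights []      []          x≤y = ≤-refl
prodIn-weights (true ∷ A)  (true ∷ U)  x≤y = *-mono-≤ x≤y (prodIn-weights A U x≤y)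
prodIn-weights {y = y} (false ∷ A) (true ∷ U) x≤y = *-monoʳ-≤ y (prodIn-weights A U x≤y)
prodIn-weights (a ∷ A) (false ∷ U) x≤y = prodIn-weights A U x≤y

-- One vertex of `U` in `A` is enough to trade a factor `y` for `x`; multiplying by `y` avoids the
-- predecessor of `∣ U ∣`.
prodIn-weights-∩ : ∀ {x y} {A U : Subset N} {v} → x ≤ y → v ∈ A → v ∈ U →
                   y * prodIn (weights x y A) U ≤ x * y ^ ∣ U ∣
prodIn-weights-∩ {x = x} {y} {A = true ∷ A} {U = true ∷ U} x≤y here here = begin
  y * (x * prodIn (weights x y A) U)  ≡⟨ solve 3 (λ x y z → y :* (x :* z) := x :* (y :* z)) refl x y (prodIn (weights x y A) U) ⟩
  x * (y * prodIn (weights x y A) U)  ≤⟨ *-monoʳ-≤ x (*-monoʳ-≤ y (prodIn-weights A U x≤y)) ⟩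
  x * (y * y ^ ∣ U ∣) ∎
  where
  open ≤-Reasoning
  open +-*-Solver
prodIn-weights-∩ {x = x} {y} {A = _ ∷ A} {U = false ∷ U} x≤y (there v∈A) (there v∈U) =
  prodIn-weights-∩ {x = x} {y} {A} {U} x≤y v∈A v∈U
prodIn-weights-∩ {x = x} {y} {A = a ∷ A} {U = true ∷ U} x≤y (there v∈A) (there v∈U) = begin
  y * (w a * prodIn (weights x y A) U)  ≡⟨ solve 3 (λ x y z → y :* (x :* z) := x :* (y :* z)) refl (w a) y (prodIn (weights x y A) U) ⟩
  w a * (y * prodIn (weights x y A) U)  ≤⟨ *-mono-≤ (w≤y a) (prodIn-weights-∩ x≤y v∈A v∈U) ⟩
  y * (x * y ^ ∣ U ∣)                   ≡⟨ solve 3 (λ x y z → y :* (x :* z) := x :* (y :* z)) refl x y (y ^ ∣ U ∣) ⟩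
  x * (y * y ^ ∣ U ∣) ∎
  where
  open ≤-Reasoning
  open +-*-Solver
  w : Bool → ℕ
  w b = if b then x else y
  w≤y : ∀ b → w b ≤ y
  w≤y true  = x≤y
  w≤y false = ≤-refl

-- Pigeonhole on a telescoping sum: one of the `suc L` increments is at least the average.
-- Truncation can only enlarge an increment.
large-step : (g : ℕ → ℕ) → ∀ L → ∃ λ J → J ≤ L × g (suc L) ≤ g 0 + suc L * (g (suc J) ∸ g J)
large-step g zero    = 0 , z≤n , ≤-trans (m≤n+m∸n (g 1) (g 0)) (≤-reflexive (cong (g 0 +_) (sym (*-identityˡ _))))
large-step g (suc L) with large-step g L
... | J , J≤L , le with (g (suc J) ∸ g J) ≤? (g (suc (suc L)) ∸ g (suc L))
...   | yes d≤ = suc L , ≤-refl , (begin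
  g (suc (suc L))                                ≤⟨ m≤n+m∸n _ (g (suc L)) ⟩
  g (suc L) + d                                  ≤⟨ +-monoˡ-≤ d (≤-trans le (+-monoʳ-≤ (g 0) (*-monoʳ-≤ (suc L) d≤))) ⟩
  g 0 + suc L * d + d                            ≡⟨ solve 3 (λ g l d → g :+ l :* d :+ d := g :+ (con 1 :+ l) :* d) refl (g 0) (suc L) d ⟩
  g 0 + suc (suc L) * d ∎)
  where
  open ≤-Reasoning
  open +-*-Solver
  d = g (suc (suc L)) ∸ g (suc L)
...   | no d≰ = J , m≤n⇒m≤1+n J≤L , (begin
  g (suc (suc L))                                ≤⟨ m≤n+m∸n _ (g (suc L)) ⟩
  g (suc L) + (g (suc (suc L)) ∸ g (suc L))      ≤⟨ +-mono-≤ le (<⇒≤ (≰⇒> d≰)) ⟩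
  g 0 + suc L * d + d                            ≡⟨ solve 3 (λ g l d → g :+ l :* d :+ d := g :+ (con 1 :+ l) :* d) refl (g 0) (suc L) d ⟩
  g 0 + suc (suc L) * d ∎)
  where
  open ≤-Reasoning
  open +-*-Solver
  d = g (suc J) ∸ g J

-- Dyadic degree levels

∑-unique : {P : Pred (Fin N) p} (P? : Decidable P) → (∀ {i j} → P i → P j → i ≡ j) → ∑ (allFin N) (𝟙 ∘ P?) ≤ 1
∑-unique {N} P? unique with Fin.any? P?
... | no none = ≤-trans (∑-mono (allFin N) (λ j → 𝟙-case (P? j) (λ Pj → contradiction (j , Pj) none)))
                  (≤-trans (≤-reflexive (∑-zero (allFin N))) z≤n)
... | yes (i , Pi) = ≤-trans (∑-mono (allFin N) (λ j → 𝟙-mono (P? j) (i Fin.≟ j) (unique Pi)))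
                       (≤-reflexive (∑-allFin-≟ i))

other-element : {S : Subset N} {v : Fin N} → 2 ≤ ∣ S ∣ → v ∈ S → ∃ λ u → u ≢ v × u ∈ S
other-element {S = S} {v} 2≤ v∈S with nonempty? (S ─ ⁅ v ⁆)
... | yes (u , u∈) = u , (λ { refl → ∈─⇒∉ {p = S} u∈ (x∈⁅x⁆ u) }) , p─q⊆p S ⁅ v ⁆ u∈
... | no empty = contradiction (≤-trans (p⊆q⇒∣p∣≤∣q∣ S⊆) (≤-reflexive (∣⁅x⁆∣≡1 v))) (<⇒≱ 2≤)
  where
  S⊆ : S ⊆ ⁅ v ⁆
  S⊆ {x} x∈S with x ∈? ⁅ v ⁆
  ... | yes h = h
  ... | no h  = contradiction (x , x∈p∧x∉q⇒x∈p─q x∈S h) empty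

two-elements : {S : Subset N} {u v : Fin N} → u ≢ v → u ∈ S → v ∈ S → 2 ≤ ∣ S ∣
two-elements {S = S} {u} {v} u≢v u∈S v∈S = ≤-trans
  (≤-reflexive (sym (trans (∣∪∣-disjoint ⁅ u ⁆ ⁅ v ⁆ (λ h h′ → u≢v (trans (sym (x∈⁅y⁆⇒x≡y u h)) (x∈⁅y⁆⇒x≡y v h′))))
    (cong₂ _+_ (∣⁅x⁆∣≡1 u) (∣⁅x⁆∣≡1 v)))))
  (p⊆q⇒∣p∣≤∣q∣ sub)
  where
  sub : ⁅ u ⁆ ∪ ⁅ v ⁆ ⊆ S
  sub h = [ (λ h → subst (_∈ S) (sym (x∈⁅y⁆⇒x≡y u h)) u∈S) , (λ h → subst (_∈ S) (sym (x∈⁅y⁆⇒x≡y v h)) v∈S) ]′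
    (x∈p∪q⁻ ⁅ u ⁆ ⁅ v ⁆ h)

module LinearHypergraph {n m : ℕ} (E : Edges n m) (k : ℕ) (2≤k : 2 ≤ k)
                        (uniform : Uniform k E) (linear : Linear E) where

  private
    V = allFin n
    I = allFin m

  deg : Fin n → ℕ
  deg v = ∑ I λ e → 𝟙 (v ∈? E e)

  ∑-deg : ∑ V deg ≡ m * k
  ∑-deg = trans (∑-swap V I (λ v e → 𝟙 (v ∈? E e))) (trans (∑-cong I (λ e → trans (sym (∣∣≡∑ (E e))) (uniform e)))
    (trans (∑-const I k) (cong (_* k) (length-allFin m))))

  codegree≤1 : ∀ {u v} → u ≢ v → ∑ I (λ e → 𝟙 ((u ∈? E e) ×-dec (v ∈? E e))) ≤ 1
  codegree≤1 {u} {v} u≢v = ∑-unique (λ e → (u ∈? E e) ×-dec (v ∈? E e)) same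
    where
    same : ∀ {e f} → (u ∈ E e × v ∈ E e) → (u ∈ E f × v ∈ E f) → e ≡ f
    same {e} {f} (ue , ve) (uf , vf) = decidable-stable (e Fin.≟ f) (λ e≢f →
      contradiction (linear e f e≢f) (<⇒≱ (two-elements u≢v (x∈p∩q⁺ (ue , uf)) (x∈p∩q⁺ (ve , vf)))))

  -- Each edge through `v` has a second vertex, as `2 ≤ k`, and by linearity a second vertex `u`
  -- serves only one edge.
  deg≤n : ∀ v → deg v ≤ n
  deg≤n v = begin
    ∑ I (λ e → 𝟙 (v ∈? E e))
      ≤⟨ ∑-mono I (λ e → 𝟙-case (v ∈? E e) (λ v∈ → via e v∈ (other-element (≤-trans 2≤k (≤-reflexive (sym (uniform e)))) v∈))) ⟩
    ∑ I (λ e → ∑ V (λ u → 𝟙 (¬? (u Fin.≟ v)) * 𝟙 ((u ∈? E e) ×-dec (v ∈? E e))))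
      ≡⟨ trans (∑-swap I V (λ e u → 𝟙 (¬? (u Fin.≟ v)) * 𝟙 ((u ∈? E e) ×-dec (v ∈? E e))))
           (∑-cong V (λ u → ∑-*ˡ I (𝟙 (¬? (u Fin.≟ v))) (λ e → 𝟙 ((u ∈? E e) ×-dec (v ∈? E e))))) ⟩
    ∑ V (λ u → 𝟙 (¬? (u Fin.≟ v)) * ∑ I (λ e → 𝟙 ((u ∈? E e) ×-dec (v ∈? E e))))
      ≤⟨ ∑-mono V (λ u → 𝟙-bound (¬? (u Fin.≟ v)) codegree≤1) ⟩
    ∑ V (const 1) ≡⟨ trans (∑-1 V) (length-allFin n) ⟩
    n ∎
    where
    open ≤-Reasoning
    via : ∀ e → v ∈ E e → (∃ λ u → u ≢ v × u ∈ E e) →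
          1 ≤ ∑ V (λ u → 𝟙 (¬? (u Fin.≟ v)) * 𝟙 ((u ∈? E e) ×-dec (v ∈? E e)))
    via e v∈ (u , u≢v , u∈) = ≤-trans
      (≤-reflexive (sym (cong₂ _*_ (𝟙-yes (¬? (u Fin.≟ v)) u≢v) (𝟙-yes ((u ∈? E e) ×-dec (v ∈? E e)) (u∈ , v∈)))))
      (term≤∑ (λ u → 𝟙 (¬? (u Fin.≟ v)) * 𝟙 ((u ∈? E e) ×-dec (v ∈? E e))) (∈-allFin u))

  m*k≤n*n : m * k ≤ n * n
  m*k≤n*n = ≤-trans (≤-reflexive (sym ∑-deg)) (≤-trans (∑-mono V deg≤n)
    (≤-reflexive (trans (∑-const V n) (cong (_* n) (length-allFin n)))))

  -- Degrees are taken in the whole hypergraph. An edge is thus classified by its largest degree,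
  -- and the increments of `#low` count the dyadic levels.
  Low : ℕ → Fin m → Set
  Low j e = Sub.Lift (λ v → deg v < 2 ^ j) (E e)

  low? : ∀ j e → Dec (Low j e)
  low? j e = Lift? (λ v → deg v <? 2 ^ j) (E e)

  #low : ℕ → ℕ
  #low j = ∑ I λ e → 𝟙 (low? j e)

  k>0 : 0 < k
  k>0 = ≤-trans (s≤s z≤n) 2≤k

  some-vertex : ∀ e → Sub.Nonempty (E e)
  some-vertex e = ∣∣>0⇒nonempty (≤-trans k>0 (≤-reflexive (sym (uniform e))))

  deg>0 : ∀ {e v} → v ∈ E e → 0 < deg v
  deg>0 {e} {v} v∈ = ≤-trans (≤-reflexive (sym (𝟙-yes (v ∈? E e) v∈))) (term≤∑ (λ e → 𝟙 (v ∈? E e)) (∈-allFin e))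

  #low-0 : #low 0 ≡ 0
  #low-0 = n≤0⇒n≡0 (≤-trans (∑-mono I (λ e → 𝟙-case (low? 0 e) (λ low →
    contradiction (low (proj₂ (some-vertex e))) (<⇒≱ (s≤s (deg>0 (proj₂ (some-vertex e)))))))) (≤-reflexive (∑-zero I)))

  #low-all : ∀ {L} → n < 2 ^ L → #low L ≡ m
  #low-all {L} n< = trans (∑-cong I (λ e → 𝟙-yes (low? L e) (λ {v} _ → ≤-<-trans (deg≤n v) n<)))
    (trans (∑-1 I) (length-allFin m))

  module DyadicLevel (J : ℕ) where

    D = 2 ^ suc J

    H : Fin m → Set
    H e = Low (suc J) e × ¬ Low J e

    H? : Decidable H
    H? e = low? (suc J) e ×-dec ¬? (low? J e)

    #H : ℕ
    #H = ∑ I λ e → 𝟙 (H? e)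

    #H-≥ : #low (suc J) ∸ #low J ≤ #H
    #H-≥ = m≤n+o⇒m∸n≤o (#low (suc J)) (#low J) (≤-trans (∑-mono I split) (≤-reflexive (∑-+ I _ (λ e → 𝟙 (H? e)))))
      where
      split : ∀ e → 𝟙 (low? (suc J) e) ≤ 𝟙 (low? J e) + 𝟙 (H? e)
      split e with low? (suc J) e | low? J e
      ... | no _  | _     = z≤n
      ... | yes _ | yes _ = s≤s z≤n
      ... | yes _ | no _  = s≤s z≤n

    -- A vertex whose full degree exceeds `D` lies in no edge of `H`.
    degH≤D : ∀ v → ∑ I (λ e → 𝟙 (H? e) * 𝟙 (v ∈? E e)) ≤ D
    degH≤D v with deg v ≤? D
    ... | yes le = ≤-trans (∑-mono I (λ e → 𝟙-bound (H? e) (λ _ → ≤-refl))) le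
    ... | no ≰D  = ≤-trans (∑-mono I (λ e → 𝟙-bound (H? e) (λ (low , _) → 𝟙-case (v ∈? E e) (λ v∈ →
                     contradiction (<⇒≤ (low v∈)) ≰D)))) (≤-trans (≤-reflexive (∑-zero I)) z≤n)

    Top : Subset n
    Top = tabulate λ v → does (2 ^ J ≤? deg v)

    ∈-Top : ∀ {v} → 2 ^ J ≤ deg v → v ∈ Top
    ∈-Top {v} le = Vec.lookup⇒[]= v Top (trans (Vec.lookup∘tabulate _ v) (dec-true (2 ^ J ≤? deg v) le))

    ∈-Top⁻ : ∀ {v} → v ∈ Top → 2 ^ J ≤ deg v
    ∈-Top⁻ {v} h = does⇒ (2 ^ J ≤? deg v) (trans (sym (Vec.lookup∘tabulate _ v)) (Vec.[]=⇒lookup h))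

    ∣Top∣-≤ : ∣ Top ∣ * 2 ^ J ≤ m * k
    ∣Top∣-≤ = begin
      ∣ Top ∣ * 2 ^ J                        ≡⟨ trans (cong (_* 2 ^ J) (∣∣≡∑ Top)) (sym (∑-*ʳ V (λ v → 𝟙 (v ∈? Top)) (2 ^ J))) ⟩
      ∑ V (λ v → 𝟙 (v ∈? Top) * 2 ^ J)       ≤⟨ ∑-mono V (λ v → 𝟙-bound (v ∈? Top) ∈-Top⁻) ⟩
      ∑ V deg                              ≡⟨ ∑-deg ⟩
      m * k ∎
      where open ≤-Reasoning

    top-vertex : ∀ {e} → H e → ∃ λ v → v ∈ Top × v ∈ E e
    top-vertex {e} (_ , ¬low) with Fin.any? (λ v → (v ∈? E e) ×-dec (2 ^ J ≤? deg v))
    ... | yes (v , v∈ , le) = v , ∈-Top le , v∈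
    ... | no none = contradiction (λ {v} v∈ → ≰⇒> (λ le → none (v , v∈ , le))) ¬low

    #H≤n*D : #H ≤ n * D
    #H≤n*D = begin
      #H ≤⟨ ∑-mono I (λ e → 𝟙-case (H? e) (λ h → ≤-trans
              (≤-reflexive (sym (cong₂ _*_ (𝟙-yes (H? e) h) (𝟙-yes (proj₁ (some-vertex e) ∈? E e) (proj₂ (some-vertex e))))))
              (term≤∑ (λ v → 𝟙 (H? e) * 𝟙 (v ∈? E e)) (∈-allFin (proj₁ (some-vertex e)))))) ⟩
      ∑ I (λ e → ∑ V (λ v → 𝟙 (H? e) * 𝟙 (v ∈? E e)))   ≡⟨ ∑-swap I V (λ e v → 𝟙 (H? e) * 𝟙 (v ∈? E e)) ⟩
      ∑ V (λ v → ∑ I (λ e → 𝟙 (H? e) * 𝟙 (v ∈? E e)))   ≤⟨ ∑-mono V degH≤D ⟩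
      ∑ V (const D)                                      ≡⟨ trans (∑-const V D) (cong (_* D) (length-allFin n)) ⟩
      n * D ∎
      where open ≤-Reasoning

    -- Every edge of `H` has a vertex in `Top`, so at least one of its `k` weights is the cheap `x`.
    cost-≥ : ∀ x y κ → .{{_ : NonZero y}} → k ≡ suc κ → x ≤ y → ∀ e → H e → prodIn (weights x y Top) (E e) ≤ x * y ^ κ
    cost-≥ x y κ k≡ x≤y e h with v , v∈Top , v∈e ← top-vertex h = *-cancelˡ-≤ y (begin
      y * prodIn (weights x y Top) (E e)   ≤⟨ prodIn-weights-∩ {A = Top} {E e} x≤y v∈Top v∈e ⟩
      x * y ^ ∣ E e ∣                    ≡⟨ cong (λ z → x * y ^ z) (trans (uniform e) k≡) ⟩
      x * (y * y ^ κ)                    ≡⟨ solve 3 (λ x y z → x :* (y :* z) := y :* (x :* z)) refl x y (y ^ κ) ⟩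
      y * (x * y ^ κ) ∎)
      where
      open ≤-Reasoning
      open +-*-Solver

-- Choice of the parameters

n<2^n : ∀ n → n < 2 ^ n
n<2^n zero    = s≤s z≤n
n<2^n (suc n) = ≤-trans (+-mono-≤ (>-nonZero⁻¹ (2 ^ n) {{m^n≢0 2 n}}) (n<2^n n)) (≤-reflexive (cong (2 ^ n +_) (sym (+-identityʳ _))))

-- The left side is 256 r L², below 2^(8 + 3L); the choice of 8 L for `ℓ` suffices because 8 ≤ 5 L
-- for L ≥ 2.
spread-≤-2^ : ∀ r L → 2 ≤ L → r < 2 ^ L → 16 * (2 * r * (L * (8 * L))) ≤ 2 ^ (8 * L)
spread-≤-2^ r L 2≤L r< = begin
  16 * (2 * r * (L * (8 * L)))              ≡⟨ solve 2 (λ r L → con 16 :* (con 2 :* r :* (L :* (con 8 :* L))) := con 256 :* (r :* (L :* L))) refl r L ⟩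
  256 * (r * (L * L))                       ≤⟨ *-monoʳ-≤ 256 (*-mono-≤ (<⇒≤ r<) (*-mono-≤ (<⇒≤ (n<2^n L)) (<⇒≤ (n<2^n L)))) ⟩
  2 ^ 8 * (2 ^ L * (2 ^ L * 2 ^ L))         ≡⟨ sym (trans (^-distribˡ-+-* 2 8 (L + (L + L))) (cong (256 *_)
                                                 (trans (^-distribˡ-+-* 2 L (L + L)) (cong (2 ^ L *_) (^-distribˡ-+-* 2 L L))))) ⟩
  2 ^ (8 + (L + (L + L)))                   ≤⟨ ^-monoʳ-≤ 2 (≤-trans (+-monoˡ-≤ (L + (L + L)) (≤-trans (m≤n+m 8 2) (*-monoʳ-≤ 5 2≤L)))
                                                 (≤-reflexive (solve 1 (λ L → con 5 :* L :+ (L :+ (L :+ L)) := con 8 :* L) refl L))) ⟩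
  2 ^ (8 * L) ∎
  where
  open ≤-Reasoning
  open +-*-Solver

module Assemble {n m : ℕ} (E : Edges n m) (κ : ℕ) (uniform : Uniform (2 + κ) E) (linear : Linear E)
  (j r : ℕ) .{{_ : NonZero r}} (0<j : 0 < j) (2^j≤n : 2 ^ j ≤ n) (n<2^L : n < 2 ^ suc j) (r≤n : r ≤ n) where

  k = 2 + κ
  k₁ = suc κ
  L = suc j
  R = 16 * (2 * r * (L * (8 * L)))

  open LinearHypergraph E k (s≤s (s≤s z≤n)) uniform linear

  module AtLevel (J : ℕ) (J≤j : J ≤ j) (m≤L*h : m ≤ L * DyadicLevel.#H J)
                 (m-large : 4 * k * n * L ≤ m)
                 (m-dense : 128 * (8 * k * k * L) * (2 * n) ^ k₁ * R * (4 * k * L) ^ k₁ * (2 * n) ^ κ < 2 * k * m ^ k₁) where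

    open DyadicLevel J

    h = #H
    -- `t = h / Q` is the largest size for which `#matchings-≥` applies: `t * k` covered vertices
    -- block at most half of the `h` edges.
    Q = 2 * (k * D)
    instance
      D≢0 : NonZero D
      D≢0 = m^n≢0 2 (suc J)
      Q≢0 : NonZero Q
      Q≢0 = m*n≢0 2 (k * D) {{_}} {{m*n≢0 k D}}
    t = h / Q

    D≤2n : D ≤ 2 * n
    D≤2n = *-monoʳ-≤ 2 (≤-trans (^-monoʳ-≤ 2 J≤j) 2^j≤n)

    Q≤h : Q ≤ h
    Q≤h = *-cancelˡ-≤ L (begin
      L * (2 * (k * D))          ≤⟨ *-monoʳ-≤ L (*-monoʳ-≤ 2 (*-monoʳ-≤ k D≤2n)) ⟩
      L * (2 * (k * (2 * n)))    ≡⟨ solve 3 (λ L k n → L :* (con 2 :* (k :* (con 2 :* n))) := con 4 :* k :* n :* L) refl L k n ⟩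
      4 * k * n * L              ≤⟨ m-large ⟩
      m                          ≤⟨ m≤L*h ⟩
      L * h ∎)
      where
      open ≤-Reasoning
      open +-*-Solver

    t>0 : 0 < t
    t>0 = ≤-trans (≤-reflexive (sym (n/n≡1 Q))) (/-monoˡ-≤ Q Q≤h)

    instance
      t≢0 : NonZero t
      t≢0 = >-nonZero t>0

    -- `y` is n/t rounded up generously, so that n ≤ ty ≤ 2n. The first term of `x` bounds
    -- `∣ Top ∣ / t`; the minimum with `y` secures `x ≤ y`, and `∣ Top ∣ ≤ n ≤ t * y` keeps
    -- `∣ Top ∣ ≤ t * x` true.
    y x : ℕ
    y = suc (n / t)
    x = (8 * k * k * L) ⊓ y

    t*Q≤h : t * Q ≤ h
    t*Q≤h = m/n*n≤m h Q

    h≤2tQ : h ≤ 2 * t * Q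
    h≤2tQ = begin
      h              ≡⟨ m≡m%n+[m/n]*n h Q ⟩
      h % Q + t * Q  ≤⟨ +-monoˡ-≤ (t * Q) (≤-trans (<⇒≤ (m%n<n h Q)) (m≤n*m Q t)) ⟩
      t * Q + t * Q  ≡⟨ solve 2 (λ t q → t :* q :+ t :* q := con 2 :* t :* q) refl t Q ⟩
      2 * t * Q ∎
      where
      open ≤-Reasoning
      open +-*-Solver

    t≤n : t ≤ n
    t≤n = *-cancelʳ-≤ t n Q (≤-trans t*Q≤h (≤-trans #H≤n*D (*-monoʳ-≤ n (≤-trans (m≤n*m D k) (m≤n*m (k * D) 2)))))

    n≤t*y : n ≤ t * y
    n≤t*y = begin
      n                    ≡⟨ m≡m%n+[m/n]*n n t ⟩
      n % t + n / t * t    ≤⟨ +-monoˡ-≤ (n / t * t) (<⇒≤ (m%n<n n t)) ⟩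
      suc (n / t) * t      ≡⟨ *-comm (suc (n / t)) t ⟩
      t * y ∎
      where open ≤-Reasoning

    t*y≤2n : t * y ≤ 2 * n
    t*y≤2n = begin
      t * y            ≡⟨ *-comm t (suc (n / t)) ⟩
      t + n / t * t    ≤⟨ +-mono-≤ t≤n (m/n*n≤m n t) ⟩
      n + n            ≡⟨ cong (n +_) (sym (+-identityʳ n)) ⟩
      2 * n ∎
      where open ≤-Reasoning

    ∣Top∣≤t*x : ∣ Top ∣ ≤ t * x
    ∣Top∣≤t*x = ≤-trans (⊓-glb bound₁ (≤-trans (∣p∣≤n Top) n≤t*y)) (≤-reflexive (sym (*-distribˡ-⊓ t (8 * k * k * L) y)))
      where
      open ≤-Reasoning
      open +-*-Solver
      bound₁ : ∣ Top ∣ ≤ t * (8 * k * k * L)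
      bound₁ = *-cancelʳ-≤ ∣ Top ∣ (t * (8 * k * k * L)) (2 ^ J) {{m^n≢0 2 J}} (begin
        ∣ Top ∣ * 2 ^ J                                    ≤⟨ ∣Top∣-≤ ⟩
        m * k                                              ≤⟨ *-monoˡ-≤ k (≤-trans m≤L*h (*-monoʳ-≤ L h≤2tQ)) ⟩
        L * (2 * t * (2 * (k * (2 * 2 ^ J)))) * k          ≡⟨ solve 4 (λ L t k z → L :* (con 2 :* t :* (con 2 :* (k :* (con 2 :* z)))) :* k := t :* (con 8 :* k :* k :* L) :* z) refl L t k (2 ^ J) ⟩
        t * (8 * k * k * L) * 2 ^ J ∎)

    x≢0 : NonZero x
    x≢0 = >-nonZero (⊓-glb {1} {8 * k * k * L} {y} (s≤s z≤n) (s≤s z≤n))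

    Y = 128 * (x * y ^ k₁ * R)

    -- `Y < Q` is what remains of the condition of `popular` after `t` is cancelled. Here m ≤ 4kL tD
    -- is raised to the power `k₁`: the powers of `t` join those of `y` and give `(2 * n) ^ k₁`, one
    -- factor `D` is kept to cancel against `Q`, and the other `κ` factors are bounded by `2 * n`.
    Y*m^k₁≤ : Y * m ^ k₁ ≤ 128 * (8 * k * k * L) * (2 * n) ^ k₁ * R * (4 * k * L) ^ k₁ * (2 * n) ^ κ * D
    Y*m^k₁≤ = begin
      Y * m ^ k₁                                          ≤⟨ *-monoʳ-≤ Y (^-monoˡ-≤ k₁ (≤-trans m≤L*h (*-monoʳ-≤ L h≤2tQ))) ⟩
      Y * (L * (2 * t * (2 * (k * D)))) ^ k₁              ≡⟨ cong (λ z → Y * z ^ k₁) (solve 4 (λ L t k D → L :* (con 2 :* t :* (con 2 :* (k :* D))) := con 4 :* k :* L :* (t :* D)) refl L t k D) ⟩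
      Y * (4 * k * L * (t * D)) ^ k₁                      ≡⟨ cong (Y *_) (trans (^-distribʳ-* k₁ (4 * k * L) (t * D)) (cong ((4 * k * L) ^ k₁ *_) (^-distribʳ-* k₁ t D))) ⟩
      Y * ((4 * k * L) ^ k₁ * (t ^ k₁ * D ^ k₁))            ≡⟨ rearrange x (y ^ k₁) R ((4 * k * L) ^ k₁) (t ^ k₁) (D ^ κ) D ⟩
      128 * x * (t ^ k₁ * y ^ k₁) * R * (4 * k * L) ^ k₁ * D ^ κ * D
                                                         ≡⟨ cong (λ z → 128 * x * z * R * (4 * k * L) ^ k₁ * D ^ κ * D) (sym (^-distribʳ-* k₁ t y)) ⟩
      128 * x * (t * y) ^ k₁ * R * (4 * k * L) ^ k₁ * D ^ κ * D
        ≤⟨ *-monoˡ-≤ D (*-mono-≤ (*-monoˡ-≤ ((4 * k * L) ^ k₁) (*-monoˡ-≤ R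
             (*-mono-≤ (*-monoʳ-≤ 128 (m⊓n≤m (8 * k * k * L) y)) (^-monoˡ-≤ k₁ t*y≤2n)))) (^-monoˡ-≤ κ D≤2n)) ⟩
      128 * (8 * k * k * L) * (2 * n) ^ k₁ * R * (4 * k * L) ^ k₁ * (2 * n) ^ κ * D ∎
      where
      open ≤-Reasoning
      open +-*-Solver
      rearrange : ∀ x yp R b tp dκ D → 128 * (x * yp * R) * (b * (tp * (D * dκ))) ≡ 128 * x * (tp * yp) * R * b * dκ * D
      rearrange = solve 7 (λ x yp R b tp dκ D → con 128 :* (x :* yp :* R) :* (b :* (tp :* (D :* dκ))) := con 128 :* x :* (tp :* yp) :* R :* b :* dκ :* D) refl

    Y<Q : Y < Q
    Y<Q = ≰⇒> λ Q≤Y → contradiction (*-cancelʳ-≤ (2 * k * m ^ k₁) bound D (begin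
      2 * k * m ^ k₁ * D     ≡⟨ solve 3 (λ k M D → con 2 :* k :* M :* D := con 2 :* (k :* D) :* M) refl k (m ^ k₁) D ⟩
      Q * m ^ k₁             ≤⟨ *-monoˡ-≤ (m ^ k₁) Q≤Y ⟩
      Y * m ^ k₁             ≤⟨ Y*m^k₁≤ ⟩
      bound * D ∎)) (<⇒≱ m-dense)
      where
      bound = 128 * (8 * k * k * L) * (2 * n) ^ k₁ * R * (4 * k * L) ^ k₁ * (2 * n) ^ κ
      open ≤-Reasoning
      open +-*-Solver

    large : 2 * (x * y ^ k₁ * (64 * (t * R))) < h
    large = begin-strict
      2 * (x * y ^ k₁ * (64 * (t * R)))  ≡⟨ solve 4 (λ x z t R → con 2 :* (x :* z :* (con 64 :* (t :* R))) := t :* (con 128 :* (x :* z :* R))) refl x (y ^ k₁) t R ⟩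
      t * Y                             <⟨ *-monoʳ-< t Y<Q ⟩
      t * Q                             ≤⟨ t*Q≤h ⟩
      h ∎
      where
      open ≤-Reasoning
      open +-*-Solver

    cost-bound : ∀ e → H e → prodIn (weights x y Top) (E e) ≤ x * y ^ k₁
    cost-bound = cost-≥ x y k₁ refl (m⊓n≤n (8 * k * k * L) y)

    regular : ∃ λ S → RegularSub r E S
    regular = regular-from-popular t R r L (8 * L) {{t≢0}} {{R≢0}}
      (popular t R {{t≢0}} small (prod-weights>0 x y Top {{x≢0}}) (prod-suc-weights x y t Top {{x≢0}} ∣Top∣≤t*x n≤t*y) large)
      refl (spread-≤-2^ r L (s≤s 0<j) (≤-<-trans r≤n n<2^L)) (≤-<-trans t≤n n<2^L)
      where
      open Popular E k uniform k>0 H? D degH≤D (weights x y Top) (x * y ^ k₁)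
             cost-bound
      R≢0 : NonZero R
      R≢0 = m*n≢0 16 (2 * r * (L * (8 * L))) {{_}} {{m*n≢0 (2 * r) (L * (8 * L)) {{m*n≢0 2 r}} }}
      small : 2 * (t * k * D) ≤ h
      small = ≤-trans (≤-reflexive (solve 3 (λ t k D → con 2 :* (t :* k :* D) := t :* (con 2 :* (k :* D))) refl t k D)) t*Q≤h
        where open +-*-Solver

  regular-sub : 4 * k * n * L ≤ m →
                128 * (8 * k * k * L) * (2 * n) ^ k₁ * R * (4 * k * L) ^ k₁ * (2 * n) ^ κ < 2 * k * m ^ k₁ →
                ∃ λ S → RegularSub r E S
  regular-sub m-large m-dense = at (large-step #low j)
    where
    at : (∃ λ J → J ≤ j × #low L ≤ #low 0 + L * (#low (suc J) ∸ #low J)) → ∃ λ S → RegularSub r E S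
    at (J , J≤j , le) = AtLevel.regular J J≤j (begin
      m                                              ≡⟨ sym (#low-all {L} n<2^L) ⟩
      #low L                                         ≤⟨ le ⟩
      #low 0 + L * (#low (suc J) ∸ #low J)           ≡⟨ cong (_+ L * (#low (suc J) ∸ #low J)) #low-0 ⟩
      L * (#low (suc J) ∸ #low J)                    ≤⟨ *-monoʳ-≤ L (DyadicLevel.#H-≥ J) ⟩
      L * DyadicLevel.#H J ∎) m-large m-dense
      where open ≤-Reasoning

-- Rational lower bounds for the logarithm

ℕtoℚ-mkℚ : ∀ a → ℕtoℚ a ≡ mkℚ (ℤ.+ a) 0 (coprime-sym (1-coprimeTo a))
ℕtoℚ-mkℚ a = Q.normalize-coprime (coprime-sym (1-coprimeTo a))

ℕtoℚ-* : ∀ a b → ℕtoℚ (a ℕ.* b) ≡ ℕtoℚ a Q.* ℕtoℚ b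
ℕtoℚ-* a b = trans (cong (Q._/ 1) (ℤ.pos-* a b)) (sym (cong₂ Q._*_ (ℕtoℚ-mkℚ a) (ℕtoℚ-mkℚ b)))

ℕtoℚ-+ : ∀ a b → ℕtoℚ (a ℕ.+ b) ≡ ℕtoℚ a Q.+ ℕtoℚ b
ℕtoℚ-+ a b = trans (cong (Q._/ 1) (trans (ℤ.pos-+ a b) (sym (cong₂ ℤ._+_ (ℤ.*-identityʳ (ℤ.+ a)) (ℤ.*-identityʳ (ℤ.+ b))))))
  (sym (cong₂ Q._+_ (ℕtoℚ-mkℚ a) (ℕtoℚ-mkℚ b)))

ℕtoℚ-mono-≤ : ∀ {a b} → a ℕ.≤ b → ℕtoℚ a Q.≤ ℕtoℚ b
ℕtoℚ-mono-≤ {a} {b} le = subst₂ Q._≤_ (sym (ℕtoℚ-mkℚ a)) (sym (ℕtoℚ-mkℚ b))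
  (*≤* (ℤ.*-monoʳ-≤-nonNeg (ℤ.+ 1) (ℤ.+≤+ le)))

ℕtoℚ-cancel-≤ : ∀ {a b} → ℕtoℚ a Q.≤ ℕtoℚ b → a ℕ.≤ b
ℕtoℚ-cancel-≤ {a} {b} le with subst₂ Q._≤_ (ℕtoℚ-mkℚ a) (ℕtoℚ-mkℚ b) le
... | *≤* le′ = ℤ.drop‿+≤+ (subst₂ ℤ._≤_ (ℤ.*-identityʳ (ℤ.+ a)) (ℤ.*-identityʳ (ℤ.+ b)) le′)

0≤ℕtoℚ : ∀ a → 0ℚ Q.≤ ℕtoℚ a
0≤ℕtoℚ a = ℕtoℚ-mono-≤ {0} {a} z≤n

*-mono-nonNeg : ∀ {p q r s} → 0ℚ Q.≤ p → 0ℚ Q.≤ r → p Q.≤ q → r Q.≤ s → p Q.* r Q.≤ q Q.* s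
*-mono-nonNeg {p} {q} {r} {s} 0≤p 0≤r p≤q r≤s = Q.≤-trans
  (Q.*-monoʳ-≤-nonNeg r {{Q.nonNegative 0≤r}} p≤q)
  (Q.*-monoˡ-≤-nonNeg q {{Q.nonNegative (Q.≤-trans 0≤p p≤q)}} r≤s)

*-nonNeg : ∀ {p q} → 0ℚ Q.≤ p → 0ℚ Q.≤ q → 0ℚ Q.≤ p Q.* q
*-nonNeg {p} {q} 0≤p 0≤q = *-mono-nonNeg {0ℚ} {p} {0ℚ} {q} Q.≤-refl Q.≤-refl 0≤p 0≤q

^ℚ-nonNeg : ∀ {x} i → 0ℚ Q.≤ x → 0ℚ Q.≤ x ^ℚ i
^ℚ-nonNeg zero    0≤x = 0≤ℕtoℚ 1
^ℚ-nonNeg (suc i) 0≤x = *-nonNeg 0≤x (^ℚ-nonNeg i 0≤x)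

recip : ∀ b .{{_ : ℕ.NonZero b}} → ℚ
recip b = (ℤ.+ 1) Q./ b

ℕtoℚ*recip : ∀ b .{{_ : ℕ.NonZero b}} → ℕtoℚ b Q.* recip b ≡ 1ℚ
ℕtoℚ*recip (suc b) = Q.toℚᵘ-injective (ℚᵘ.≃-trans (Q.toℚᵘ-homo-* (ℕtoℚ (suc b)) (recip (suc b)))
  (ℚᵘ.≃-trans (ℚᵘ.*-cong (Q.toℚᵘ-fromℚᵘ (ℚᵘ.mkℚᵘ (ℤ.+ suc b) 0)) (Q.toℚᵘ-fromℚᵘ (ℚᵘ.mkℚᵘ (ℤ.+ 1) b)))
    (ℚᵘ.*≡* (cong ℤ.+_ (cong suc (trans (ℕ.*-identityʳ (b ℕ.* 1)) (trans (ℕ.*-identityʳ b) (sym (trans (ℕ.+-identityʳ (b ℕ.+ 0)) (ℕ.+-identityʳ b))))))))))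

recip-nonNeg : ∀ b .{{_ : ℕ.NonZero b}} → 0ℚ Q.≤ recip b
recip-nonNeg b = Q.nonNegative⁻¹ (recip b) {{Q.normalize-nonNeg 1 b}}

recip-! : ∀ i → ℕtoℚ (suc i) Q.* recip (suc i !) {{suc i ℕ.!≢0}} ≡ recip (i !) {{i ℕ.!≢0}}
recip-! i = begin
  s Q.* u                   ≡⟨ solve 2 (λ s u → s :* u := con 1ℚ :* (s :* u)) refl s u ⟩
  1ℚ Q.* (s Q.* u)          ≡⟨ cong (Q._* (s Q.* u)) (sym (ℕtoℚ*recip (i !) {{i ℕ.!≢0}})) ⟩
  f Q.* v Q.* (s Q.* u)     ≡⟨ solve 4 (λ f v s u → f :* v :* (s :* u) := v :* (s :* f :* u)) refl f v s u ⟩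
  v Q.* (s Q.* f Q.* u)     ≡⟨ cong (λ z → v Q.* (z Q.* u)) (sym (ℕtoℚ-* (suc i) (i !))) ⟩
  v Q.* (ℕtoℚ (suc i !) Q.* u) ≡⟨ cong (v Q.*_) (ℕtoℚ*recip (suc i !) {{suc i ℕ.!≢0}}) ⟩
  v Q.* 1ℚ                  ≡⟨ Q.*-identityʳ v ⟩
  v ∎
  where
  open ≡-Reasoning
  open QSolver.+-*-Solver
  s = ℕtoℚ (suc i)
  f = ℕtoℚ (i !)
  u = recip (suc i !) {{suc i ℕ.!≢0}}
  v = recip (i !) {{i ℕ.!≢0}}

-- Growth of the partial sums of the exponential series

term : ℚ → ℕ → ℚ
term x i = x ^ℚ i Q.* recip (i !) {{i ℕ.!≢0}}

module _ {x h : ℚ} (0≤x : 0ℚ Q.≤ x) (0≤h : 0ℚ Q.≤ h) where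

  open QSolver.+-*-Solver
  open Q.≤-Reasoning

  private
    0≤x+h : 0ℚ Q.≤ x Q.+ h
    0≤x+h = Q.+-mono-≤ 0≤x 0≤h

  -- A mean value estimate: the derivative of the power is largest at the right end `x + h`.
  ^ℚ-increment : ∀ i → (x Q.+ h) ^ℚ suc i Q.≤ x ^ℚ suc i Q.+ ℕtoℚ (suc i) Q.* h Q.* (x Q.+ h) ^ℚ i
  ^ℚ-increment zero = Q.≤-reflexive
    (solve 2 (λ x h → (x :+ h) :* con 1ℚ := x :* con 1ℚ :+ con 1ℚ :* h :* con 1ℚ) refl x h)
  ^ℚ-increment (suc i) = begin
    (x Q.+ h) Q.* P                            ≡⟨ Q.*-distribʳ-+ P x h ⟩
    x Q.* P Q.+ h Q.* P                        ≤⟨ Q.+-monoˡ-≤ (h Q.* P) (Q.*-monoˡ-≤-nonNeg x {{Q.nonNegative 0≤x}} (^ℚ-increment i)) ⟩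
    x Q.* (X Q.+ s Q.* h Q.* O) Q.+ h Q.* P    ≡⟨ solve 6 (λ x h s O P X → x :* (X :+ s :* h :* O) :+ h :* P := x :* X :+ (s :* h :* (x :* O) :+ h :* P)) refl x h s O P X ⟩
    x Q.* X Q.+ (s Q.* h Q.* (x Q.* O) Q.+ h Q.* P)
      ≤⟨ Q.+-monoʳ-≤ (x Q.* X) (Q.+-monoˡ-≤ (h Q.* P) (Q.*-monoˡ-≤-nonNeg (s Q.* h) {{Q.nonNegative (*-nonNeg (0≤ℕtoℚ (suc i)) 0≤h)}}
           (Q.*-monoʳ-≤-nonNeg O {{Q.nonNegative (^ℚ-nonNeg i 0≤x+h)}} x≤x+h))) ⟩
    x Q.* X Q.+ (s Q.* h Q.* P Q.+ h Q.* P)    ≡⟨ solve 5 (λ x h s P X → x :* X :+ (s :* h :* P :+ h :* P) := x :* X :+ (con 1ℚ :+ s) :* h :* P) refl x h s P X ⟩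
    x Q.* X Q.+ (1ℚ Q.+ s) Q.* h Q.* P         ≡⟨ cong (λ z → x Q.* X Q.+ z Q.* h Q.* P) (sym (ℕtoℚ-+ 1 (suc i))) ⟩
    x Q.* X Q.+ ℕtoℚ (suc (suc i)) Q.* h Q.* P ∎
    where
    s = ℕtoℚ (suc i)
    O = (x Q.+ h) ^ℚ i
    P = (x Q.+ h) ^ℚ suc i
    X = x ^ℚ suc i
    x≤x+h : x Q.≤ x Q.+ h
    x≤x+h = Q.≤-trans (Q.≤-reflexive (sym (Q.+-identityʳ x))) (Q.+-monoʳ-≤ x 0≤h)

  term-increment : ∀ i → term (x Q.+ h) (suc i) Q.≤ term x (suc i) Q.+ h Q.* term (x Q.+ h) i
  term-increment i = begin
    (x Q.+ h) ^ℚ suc i Q.* u                               ≤⟨ Q.*-monoʳ-≤-nonNeg u {{Q.nonNegative (recip-nonNeg (suc i !) {{suc i ℕ.!≢0}})}} (^ℚ-increment i) ⟩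
    (X Q.+ ℕtoℚ (suc i) Q.* h Q.* O) Q.* u                 ≡⟨ solve 5 (λ X s h O u → (X :+ s :* h :* O) :* u := X :* u :+ h :* (O :* (s :* u))) refl X (ℕtoℚ (suc i)) h O u ⟩
    X Q.* u Q.+ h Q.* (O Q.* (ℕtoℚ (suc i) Q.* u))         ≡⟨ cong (λ z → X Q.* u Q.+ h Q.* (O Q.* z)) (recip-! i) ⟩
    term x (suc i) Q.+ h Q.* term (x Q.+ h) i ∎
    where
    u = recip (suc i !) {{suc i ℕ.!≢0}}
    O = (x Q.+ h) ^ℚ i
    X = x ^ℚ suc i

  expPartial-increment : ∀ i → expPartial (x Q.+ h) i Q.+ h Q.* term (x Q.+ h) i
                             Q.≤ expPartial x i Q.+ h Q.* expPartial (x Q.+ h) i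
  expPartial-increment zero    = Q.≤-reflexive (cong (λ z → 1ℚ Q.+ h Q.* z) (Q.*-identityˡ 1ℚ))
  expPartial-increment (suc i) = begin
    e′ Q.+ t′ Q.+ h Q.* t′                            ≤⟨ Q.+-monoˡ-≤ (h Q.* t′) (Q.+-monoʳ-≤ e′ (term-increment i)) ⟩
    e′ Q.+ (t Q.+ h Q.* t₀) Q.+ h Q.* t′              ≡⟨ solve 5 (λ e t h s t′ → e :+ (t :+ h :* s) :+ h :* t′ := e :+ h :* s :+ (t :+ h :* t′)) refl e′ t h t₀ t′ ⟩
    e′ Q.+ h Q.* t₀ Q.+ (t Q.+ h Q.* t′)              ≤⟨ Q.+-monoˡ-≤ (t Q.+ h Q.* t′) (expPartial-increment i) ⟩
    e Q.+ h Q.* e′ Q.+ (t Q.+ h Q.* t′)               ≡⟨ solve 5 (λ e h e′ t t′ → e :+ h :* e′ :+ (t :+ h :* t′) := e :+ t :+ h :* (e′ :+ t′)) refl e h e′ t t′ ⟩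
    e Q.+ t Q.+ h Q.* (e′ Q.+ t′) ∎
    where
    e  = expPartial x i
    e′ = expPartial (x Q.+ h) i
    t  = term x (suc i)
    t′ = term (x Q.+ h) (suc i)
    t₀ = term (x Q.+ h) i

-- With h = 1/2 the increment estimate reads e′ ≤ e + e′/2, which is solved for e′.
expPartial-+½ : ∀ {x} → 0ℚ Q.≤ x → ∀ i → expPartial (x Q.+ ½) i Q.≤ ℕtoℚ 2 Q.* expPartial x i
expPartial-+½ {x} 0≤x i = begin
  e′                                                  ≡⟨ solve 1 (λ e → e := con (ℕtoℚ 2) :* (e :+ con (Q.- ½) :* e)) refl e′ ⟩
  ℕtoℚ 2 Q.* (e′ Q.+ (Q.- ½) Q.* e′)                  ≤⟨ Q.*-monoˡ-≤-nonNeg (ℕtoℚ 2) (Q.+-monoˡ-≤ ((Q.- ½) Q.* e′) e′≤) ⟩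
  ℕtoℚ 2 Q.* (e Q.+ ½ Q.* e′ Q.+ (Q.- ½) Q.* e′)      ≡⟨ solve 2 (λ e e′ → con (ℕtoℚ 2) :* (e :+ con ½ :* e′ :+ con (Q.- ½) :* e′) := con (ℕtoℚ 2) :* e) refl e e′ ⟩
  ℕtoℚ 2 Q.* e ∎
  where
  open Q.≤-Reasoning
  open QSolver.+-*-Solver
  e  = expPartial x i
  e′ = expPartial (x Q.+ ½) i
  0≤½ : 0ℚ Q.≤ ½
  0≤½ = Q.nonNegative⁻¹ ½
  e′≤ : e′ Q.≤ e Q.+ ½ Q.* e′
  e′≤ = Q.≤-trans
    (Q.≤-trans (Q.≤-reflexive (sym (Q.+-identityʳ e′))) (Q.+-monoʳ-≤ e′ (*-nonNeg 0≤½
      (*-nonNeg (^ℚ-nonNeg i (Q.+-mono-≤ 0≤x 0≤½)) (recip-nonNeg (i !) {{i ℕ.!≢0}})))))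
    (expPartial-increment 0≤x 0≤½ i)

half : ℕ → ℚ
half j = ℕtoℚ j Q.* ½

half-nonNeg : ∀ j → 0ℚ Q.≤ half j
half-nonNeg j = *-nonNeg (0≤ℕtoℚ j) (Q.nonNegative⁻¹ ½)

half-suc : ∀ j → half (suc j) ≡ half j Q.+ ½
half-suc j = trans (cong (Q._* ½) (ℕtoℚ-+ 1 j)) (solve 1 (λ x → (con 1ℚ :+ x) :* con ½ := x :* con ½ :+ con ½) refl (ℕtoℚ j))
  where open QSolver.+-*-Solver

expPartial-0 : ∀ i → expPartial 0ℚ i ≡ 1ℚ
expPartial-0 zero    = refl
expPartial-0 (suc i) = trans (cong₂ Q._+_ (expPartial-0 i)
  (trans (cong (Q._* recip (suc i !) {{suc i ℕ.!≢0}}) (Q.*-zeroˡ (0ℚ ^ℚ i))) (Q.*-zeroˡ (recip (suc i !) {{suc i ℕ.!≢0}})))) (Q.+-identityʳ 1ℚ)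

expPartial-half : ∀ j i → expPartial (half j) i Q.≤ ℕtoℚ (2 ℕ.^ j)
expPartial-half zero    i = Q.≤-reflexive (expPartial-0 i)
expPartial-half (suc j) i = begin
  expPartial (half (suc j)) i         ≡⟨ cong (λ x → expPartial x i) (half-suc j) ⟩
  expPartial (half j Q.+ ½) i         ≤⟨ expPartial-+½ (half-nonNeg j) i ⟩
  ℕtoℚ 2 Q.* expPartial (half j) i    ≤⟨ Q.*-monoˡ-≤-nonNeg (ℕtoℚ 2) (expPartial-half j i) ⟩
  ℕtoℚ 2 Q.* ℕtoℚ (2 ℕ.^ j)           ≡⟨ sym (ℕtoℚ-* 2 (2 ℕ.^ j)) ⟩
  ℕtoℚ (2 ℕ.^ suc j) ∎
  where open Q.≤-Reasoning

-- exp ½ ≤ 2, hence j/2 ≤ log n as soon as 2 ^ j ≤ n.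
≤log-half : ∀ {j n} → 2 ℕ.^ j ℕ.≤ n → ≤log (half j) n
≤log-half {j} le i = Q.≤-trans (expPartial-half j i) (ℕtoℚ-mono-≤ le)

ℕtoℚ-^ : ∀ a i → ℕtoℚ (a ℕ.^ i) ≡ ℕtoℚ a ^ℚ i
ℕtoℚ-^ a zero    = refl
ℕtoℚ-^ a (suc i) = trans (ℕtoℚ-* a (a ℕ.^ i)) (cong (ℕtoℚ a Q.*_) (ℕtoℚ-^ a i))

2^*half^ : ∀ j i → ℕtoℚ (2 ℕ.^ i) Q.* half j ^ℚ i ≡ ℕtoℚ (j ℕ.^ i)
2^*half^ j zero    = refl
2^*half^ j (suc i) = begin
  ℕtoℚ (2 ℕ.* 2 ℕ.^ i) Q.* (half j Q.* half j ^ℚ i)        ≡⟨ cong (Q._* (half j Q.* half j ^ℚ i)) (ℕtoℚ-* 2 (2 ℕ.^ i)) ⟩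
  ℕtoℚ 2 Q.* ℕtoℚ (2 ℕ.^ i) Q.* (half j Q.* half j ^ℚ i)   ≡⟨ solve 3 (λ a x y → con (ℕtoℚ 2) :* a :* (x :* con ½ :* y) := x :* (a :* y)) refl (ℕtoℚ (2 ℕ.^ i)) (ℕtoℚ j) (half j ^ℚ i) ⟩
  ℕtoℚ j Q.* (ℕtoℚ (2 ℕ.^ i) Q.* half j ^ℚ i)              ≡⟨ cong (ℕtoℚ j Q.*_) (2^*half^ j i) ⟩
  ℕtoℚ j Q.* ℕtoℚ (j ℕ.^ i)                                ≡⟨ sym (ℕtoℚ-* j (j ℕ.^ i)) ⟩
  ℕtoℚ (j ℕ.^ suc i) ∎
  where
  open ≡-Reasoning
  open QSolver.+-*-Solver

-- The factor `2 ^ e` inside the constant cancels the halves in `half j ^ℚ e`. A single copy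
-- suffices, since a positive natural number is at most its power with exponent `suc k′`.
clear-halves : ∀ C e k′ A j M → .{{_ : ℕ.NonZero C}} →
  ℕtoℚ (2 ℕ.^ e ℕ.* C) ^ℚ suc k′ Q.* ℕtoℚ A Q.* half j ^ℚ e Q.≤ ℕtoℚ M → C ℕ.* A ℕ.* j ℕ.^ e ℕ.≤ M
clear-halves C e k′ A j M le = ℕtoℚ-cancel-≤ (Q.≤-trans (begin
  ℕtoℚ (C ℕ.* A ℕ.* j ℕ.^ e)                              ≡⟨ trans (ℕtoℚ-* (C ℕ.* A) (j ℕ.^ e)) (cong₂ Q._*_ (ℕtoℚ-* C A) (sym (2^*half^ j e))) ⟩
  ℕtoℚ C Q.* ℕtoℚ A Q.* (ℕtoℚ (2 ℕ.^ e) Q.* half j ^ℚ e)  ≡⟨ solve 4 (λ c a b x → c :* a :* (b :* x) := b :* c :* a :* x) refl (ℕtoℚ C) (ℕtoℚ A) (ℕtoℚ (2 ℕ.^ e)) (half j ^ℚ e) ⟩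
  ℕtoℚ (2 ℕ.^ e) Q.* ℕtoℚ C Q.* ℕtoℚ A Q.* half j ^ℚ e    ≡⟨ cong (λ z → z Q.* ℕtoℚ A Q.* half j ^ℚ e) (sym (ℕtoℚ-* (2 ℕ.^ e) C)) ⟩
  ℕtoℚ c Q.* ℕtoℚ A Q.* half j ^ℚ e                       ≤⟨ Q.*-monoʳ-≤-nonNeg (half j ^ℚ e) {{Q.nonNegative (^ℚ-nonNeg e (half-nonNeg j))}}
                                                               (Q.*-monoʳ-≤-nonNeg (ℕtoℚ A) {{Q.nonNegative (0≤ℕtoℚ A)}} (ℕtoℚ-mono-≤ (ℕ.m≤m*n c (c ℕ.^ k′) {{ℕ.m^n≢0 c k′}}))) ⟩
  ℕtoℚ (c ℕ.^ suc k′) Q.* ℕtoℚ A Q.* half j ^ℚ e          ≡⟨ cong (λ z → z Q.* ℕtoℚ A Q.* half j ^ℚ e) (ℕtoℚ-^ c (suc k′)) ⟩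
  ℕtoℚ c ^ℚ suc k′ Q.* ℕtoℚ A Q.* half j ^ℚ e ∎) le)
  where
  open Q.≤-Reasoning
  open QSolver.+-*-Solver
  c = 2 ℕ.^ e ℕ.* C
  instance
    c≢0 : ℕ.NonZero c
    c≢0 = ℕ.m*n≢0 (2 ℕ.^ e) C {{ℕ.m^n≢0 2 e}}

-- Constants

dyadic : ∀ i n → 0 < n → n < 2 ^ i → ∃ λ j → 2 ^ j ≤ n × n < 2 ^ suc j
dyadic zero    n 0<n n<1 = contradiction 0<n (<⇒≱ n<1)
dyadic (suc i) n 0<n n<  with 2 ^ i ≤? n
... | yes le = i , le , n<
... | no ≰   = dyadic i n 0<n (≰⇒> ≰)

module Constants (κ : ℕ) where

  k k₁ : ℕ
  k = 2 + κ
  k₁ = suc κ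

  -- This is k - 1 times 2k + 1/(k-1): the density condition is used in its (k-1)-th power.
  exponent : ℕ
  exponent = 2 * k * k₁ + 1

  -- `C₁` collects the constants of `m-dense` and `C₂` that of `m-large`. The factors `2 ^ (3 + k₁)`
  -- and 8 in place of 4 come from `L ≤ 2 * j`.
  C₁ C₂ C : ℕ
  C₁ = 128 * (8 * k * k) * 2 ^ k₁ * 256 * (4 * k) ^ k₁ * 2 ^ κ * 2 ^ (3 + k₁)
  C₂ = (8 * k) ^ k₁
  C = C₁ + C₂

  C₂>0 : 0 < C₂
  C₂>0 = m^n>0 (8 * k) k₁

  C>0 : 0 < C
  C>0 = ≤-trans C₂>0 (m≤n+m C₂ C₁)

  module _ (r n m j : ℕ) .{{_ : NonZero r}} .{{_ : NonZero n}} .{{_ : NonZero j}}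
           (dense : C * (r * n ^ (k₁ + κ)) * j ^ exponent ≤ m ^ k₁) where

    private
      L = suc j
      W = r * n ^ (k₁ + κ)

    L≤2j : L ≤ 2 * j
    L≤2j = ≤-trans (+-monoˡ-≤ j (>-nonZero⁻¹ j)) (≤-reflexive (cong (j +_) (sym (+-identityʳ j))))

    W≤m^k₁ : W ≤ m ^ k₁
    W≤m^k₁ = begin
      W                       ≤⟨ m≤n*m W C {{>-nonZero C>0}} ⟩
      C * W                   ≤⟨ m≤m*n (C * W) (j ^ exponent) {{m^n≢0 j exponent}} ⟩
      C * W * j ^ exponent    ≤⟨ dense ⟩
      m ^ k₁ ∎
      where open ≤-Reasoning

    -- Compare r n^(2k-3) ≤ m^(k-1) ≤ n^(2k-2). The bound on `r` is what lets `R` stay below `2 ^ ℓ`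
    -- with `ℓ` of order log n.
    r≤n : m ≤ n * n → r ≤ n
    r≤n m≤n² = *-cancelʳ-≤ r n (n ^ (k₁ + κ)) {{m^n≢0 n (k₁ + κ)}} (begin
      W                      ≤⟨ W≤m^k₁ ⟩
      m ^ k₁                 ≤⟨ ^-monoˡ-≤ k₁ m≤n² ⟩
      (n * n) ^ k₁           ≡⟨ trans (^-distribʳ-* k₁ n n) (sym (^-distribˡ-+-* n k₁ k₁)) ⟩
      n ^ (k₁ + k₁)          ≡⟨ cong (n ^_) (+-suc k₁ κ) ⟩
      n * n ^ (k₁ + κ) ∎)
      where open ≤-Reasoning

    m-large : 4 * k * n * L ≤ m
    m-large = ≮⇒≥ λ lt → <⇒≱ (^-monoˡ-< k₁ lt) (begin
      (4 * k * n * L) ^ k₁                     ≤⟨ ^-monoˡ-≤ k₁ (*-monoʳ-≤ (4 * k * n) L≤2j) ⟩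
      (4 * k * n * (2 * j)) ^ k₁               ≡⟨ cong (_^ k₁) (rearrange k n j) ⟩
      (8 * k * n * j) ^ k₁                     ≡⟨ trans (^-distribʳ-* k₁ (8 * k * n) j) (cong (_* j ^ k₁) (^-distribʳ-* k₁ (8 * k) n)) ⟩
      C₂ * n ^ k₁ * j ^ k₁                     ≤⟨ *-mono-≤ (*-mono-≤ (m≤n+m C₂ C₁)
                                                    (≤-trans (^-monoʳ-≤ n (m≤m+n k₁ κ)) (m≤n*m (n ^ (k₁ + κ)) r)))
                                                    (^-monoʳ-≤ j k₁≤exponent) ⟩
      C * W * j ^ exponent                     ≤⟨ dense ⟩
      m ^ k₁ ∎)
      where
      open ≤-Reasoning
      rearrange : ∀ k n j → 4 * k * n * (2 * j) ≡ 8 * k * n * j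
      rearrange = solve 3 (λ k n j → con 4 :* k :* n :* (con 2 :* j) := con 8 :* k :* n :* j) refl
        where open +-*-Solver
      k₁≤exponent : k₁ ≤ exponent
      k₁≤exponent = ≤-trans (m≤n*m k₁ (2 * k)) (m≤m+n (2 * k * k₁) 1)

    -- The logarithmic factors add up to `L ^ (3 + k₁)`: one from the bound on `Top`, two from `R`,
    -- and `k₁` from the loss of a factor `L` in passing to one degree level. `exponent` covers
    -- them, and the factor `2 * k` on the right makes the inequality strict.
    m-dense : 128 * (8 * k * k * L) * (2 * n) ^ k₁ * (16 * (2 * r * (L * (8 * L)))) * (4 * k * L) ^ k₁ * (2 * n) ^ κ
              < 2 * k * m ^ k₁
    m-dense = begin-strict
      128 * (8 * k * k * L) * (2 * n) ^ k₁ * (16 * (2 * r * (L * (8 * L)))) * (4 * k * L) ^ k₁ * (2 * n) ^ κ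
        ≡⟨ cong₂ (λ u v → 128 * (8 * k * k * L) * u * (16 * (2 * r * (L * (8 * L)))) * v * (2 * n) ^ κ)
             (^-distribʳ-* k₁ 2 n) (^-distribʳ-* k₁ (4 * k) L) ⟩
      128 * (8 * k * k * L) * (2 ^ k₁ * n ^ k₁) * (16 * (2 * r * (L * (8 * L)))) * ((4 * k) ^ k₁ * L ^ k₁) * (2 * n) ^ κ
        ≡⟨ cong (128 * (8 * k * k * L) * (2 ^ k₁ * n ^ k₁) * (16 * (2 * r * (L * (8 * L)))) * ((4 * k) ^ k₁ * L ^ k₁) *_) (^-distribʳ-* κ 2 n) ⟩
      128 * (8 * k * k * L) * (2 ^ k₁ * n ^ k₁) * (16 * (2 * r * (L * (8 * L)))) * ((4 * k) ^ k₁ * L ^ k₁) * (2 ^ κ * n ^ κ)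
        ≡⟨ rearrange (8 * k * k) L (2 ^ k₁) (n ^ k₁) r ((4 * k) ^ k₁) (L ^ k₁) (2 ^ κ) (n ^ κ) ⟩
      B * (r * (n ^ k₁ * n ^ κ)) * L ^ (3 + k₁)
        ≡⟨ cong (λ z → B * (r * z) * L ^ (3 + k₁)) (sym (^-distribˡ-+-* n k₁ κ)) ⟩
      B * W * L ^ (3 + k₁)
        ≤⟨ *-monoʳ-≤ (B * W) (≤-trans (^-monoˡ-≤ (3 + k₁) L≤2j) (≤-reflexive (^-distribʳ-* (3 + k₁) 2 j))) ⟩
      B * W * (2 ^ (3 + k₁) * j ^ (3 + k₁))
        ≡⟨ collect B W (2 ^ (3 + k₁)) (j ^ (3 + k₁)) ⟩
      C₁ * W * j ^ (3 + k₁)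
        ≤⟨ *-mono-≤ (*-monoˡ-≤ W (m≤m+n C₁ C₂)) (^-monoʳ-≤ j small) ⟩
      C * W * j ^ exponent    ≤⟨ dense ⟩
      m ^ k₁                  <⟨ m<m*n (m ^ k₁) (2 * k) {{>-nonZero m^k₁>0}} (s≤s (s≤s z≤n)) ⟩
      m ^ k₁ * (2 * k)        ≡⟨ *-comm (m ^ k₁) (2 * k) ⟩
      2 * k * m ^ k₁ ∎
      where
      open ≤-Reasoning
      B = 128 * (8 * k * k) * 2 ^ k₁ * 256 * (4 * k) ^ k₁ * 2 ^ κ
      m^k₁>0 : 0 < m ^ k₁
      m^k₁>0 = ≤-trans (*-mono-≤ (>-nonZero⁻¹ r) (m^n>0 n (k₁ + κ))) W≤m^k₁
      rearrange : ∀ K L u v r w l y z →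
        128 * (K * L) * (u * v) * (16 * (2 * r * (L * (8 * L)))) * (w * l) * (y * z) ≡
        128 * K * u * 256 * w * y * (r * (v * z)) * (L * (L * (L * l)))
      rearrange = solve 9 (λ K L u v r w l y z →
        con 128 :* (K :* L) :* (u :* v) :* (con 16 :* (con 2 :* r :* (L :* (con 8 :* L)))) :* (w :* l) :* (y :* z) :=
        con 128 :* K :* u :* con 256 :* w :* y :* (r :* (v :* z)) :* (L :* (L :* (L :* l)))) refl
        where open +-*-Solver
      collect : ∀ B W x y → B * W * (x * y) ≡ B * x * W * y
      collect = solve 4 (λ B W x y → B :* W :* (x :* y) := B :* x :* W :* y) refl
        where open +-*-Solver
      small : 3 + k₁ ≤ exponent
      small = ≤-trans (m≤m+n (4 + κ) (1 + 5 * κ + 2 * κ * κ)) (≤-reflexive (eq κ))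
        where
        open +-*-Solver
        eq : ∀ κ → 4 + κ + (1 + 5 * κ + 2 * κ * κ) ≡ 2 * (2 + κ) * (1 + κ) + 1
        eq = solve 1 (λ κ → con 4 :+ κ :+ (con 1 :+ con 5 :* κ :+ con 2 :* κ :* κ) := con 2 :* (con 2 :+ κ) :* (con 1 :+ κ) :+ con 1) refl

2*k∸3 : ∀ κ → 2 * (2 + κ) ∸ 3 ≡ suc κ + κ
2*k∸3 κ = cong (_∸ 3) (eq κ)
  where
  open +-*-Solver
  eq : ∀ κ → 2 * (2 + κ) ≡ 3 + (suc κ + κ)
  eq = solve 1 (λ κ → con 2 :* (con 2 :+ κ) := con 3 :+ (con 1 :+ κ :+ κ)) refl

theorem5p5 : (k : ℕ) → k ≥ 2 →
    Σ ℚ λ c → (0ℚ Q.< c) ×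
    ((r : ℕ) → r ≥ 1 → (n : ℕ) → n ≥ 2 → (m : ℕ) → (E : Edges n m) →
    Simple E → Uniform k E → Linear E →
    ((x : ℚ) → 0ℚ Q.≤ x → ≤log x n →
    (c ^ℚ (k ∸ 1)) Q.* ℕtoℚ (r * n ^ (2 * k ∸ 3)) Q.* (x ^ℚ (2 * k * (k ∸ 1) + 1))
    Q.≤ ℕtoℚ (m ^ (k ∸ 1))) →
    ∃ λ (S : Subset m) → RegularSub r E S)
theorem5p5 (suc zero) (s≤s ())
theorem5p5 (suc (suc κ)) _ = ℕtoℚ (2 ^ exponent * C) , c>0 , λ r r≥1 n n≥2 m E _ uniform linear dense →
  at-scale r n m E {{>-nonZero r≥1}} n≥2 uniform linear dense (dyadic n n (≤-trans (s≤s z≤n) n≥2) (n<2^n n))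
  where
  open Constants κ
  c>0 : 0ℚ Q.< ℕtoℚ (2 ^ exponent * C)
  c>0 = Q.positive⁻¹ (ℕtoℚ (2 ^ exponent * C))
    {{Q.normalize-pos (2 ^ exponent * C) 1 {{_}} {{m*n≢0 (2 ^ exponent) C {{m^n≢0 2 exponent}} {{>-nonZero C>0}}}} }}
  at-scale : ∀ r n m (E : Edges n m) .{{_ : NonZero r}} → n ≥ 2 → Uniform k E → Linear E →
    ((x : ℚ) → 0ℚ Q.≤ x → ≤log x n →
      (ℕtoℚ (2 ^ exponent * C) ^ℚ k₁) Q.* ℕtoℚ (r * n ^ (2 * k ∸ 3)) Q.* (x ^ℚ exponent) Q.≤ ℕtoℚ (m ^ k₁)) →
    (∃ λ j → 2 ^ j ≤ n × n < 2 ^ suc j) → ∃ λ S → RegularSub r E S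
  at-scale r n m E n≥2 uniform linear dense (zero , _ , n<2) = contradiction n≥2 (<⇒≱ n<2)
  at-scale r n m E n≥2 uniform linear dense (suc i , 2^j≤n , n<2^L) =
    Assemble.regular-sub E κ uniform linear j r (s≤s z≤n) 2^j≤n n<2^L
      (r≤n r n m j dense-ℕ (≤-trans (m≤m*n m k) (LinearHypergraph.m*k≤n*n E k (s≤s (s≤s z≤n)) uniform linear)))
      (m-large r n m j dense-ℕ) (m-dense r n m j dense-ℕ)
    where
    j = suc i
    instance
      n≢0 : NonZero n
      n≢0 = >-nonZero (≤-trans (s≤s z≤n) n≥2)
    -- The density hypothesis speaks of all rational lower bounds of log n. The single value j/2,
    -- with j the integer part of the binary logarithm, is within a constant factor of log n and
    -- turns it into an inequality of natural numbers.
    dense-ℕ : C * (r * n ^ (k₁ + κ)) * j ^ exponent ≤ m ^ k₁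
    dense-ℕ = subst (λ e → C * (r * n ^ e) * j ^ exponent ≤ m ^ k₁) (2*k∸3 κ)
      (clear-halves C exponent κ (r * n ^ (2 * k ∸ 3)) j (m ^ k₁) {{>-nonZero C>0}}
        (dense (half j) (half-nonNeg j) (≤log-half {j} 2^j≤n)))
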